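{- Let $k \geq 2$ be an integer and let $M$ be a cographic binary matroid with $M \notin \mathcal{C}_k$. Then $M$ has a minor $P$ such that one of the following holds: (i) $P$ is a single-element extension of a matroid $E$, where $E$ is a minor-minimal matroid with $E \notin \mathcal{C}_{k-1}$; (ii) $P \cong M(Q_i)$ for some $i \in \{1,2,\dots,9\}$; (iii) $P$ is a coextension of $M(Q_i)$ by $n$ elements, for some $n \leq k$ and some $i \in \{1,2,\dots,9\}$. Here the graphs $Q_1,\dots,Q_9$ are the following (multigraphs, loops allowed; $K_4$ on $v_1,v_2,v_3,v_4$ means all six edges $v_iv_j$, $i<j$): $Q_1$: $K_4$ on $v_1,\dots,v_4$ together with one loop at $v_1$. $Q_2$: vertices $v_1,\dots,v_4$, edges forming the cycle $v_1v_2, v_2v_3, v_3v_4, v_4v_1$, plus one further edge parallel to each of $v_1v_2$, $v_2v_3$, $v_3v_4$ (7 edges). $Q_3$: vertices $w_1,w_2,w_3$, exactly two parallel edges between each pair of them, and one loop at $w_1$ (7 edges). $Q_4$: $K_4$ on $v_1,\dots,v_4$ plus one further edge parallel to each of $v_1v_2$, $v_1v_3$, $v_1v_4$ (9 edges). $Q_5$: $K_4$ on $v_1,\dots,v_4$ plus one further edge parallel to $v_1v_2$, one further edge parallel to $v_3v_4$, and a loop at $v_1$ (9 edges). $Q_6$: vertices $u_1,\dots,u_6$, edges $u_2u_3, u_5u_6, u_2u_5, u_4u_5, u_3u_4, u_1u_2, u_1u_6, u_1u_5, u_3u_5, u_4u_6$. $Q_7$: vertices $u_1,\dots,u_6$,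 edges $u_2u_3, u_5u_6, u_4u_5, u_3u_4, u_1u_2, u_1u_6, u_3u_5, u_2u_6, u_1u_4$, and a loop at $u_3$. $Q_8$: vertices $u_1,\dots,u_6$, edges $u_2u_3$ (two parallel copies), $u_5u_6, u_4u_5, u_3u_4, u_1u_2, u_1u_6, u_1u_4, u_2u_5, u_3u_6$. $Q_9$: vertices $u_1,\dots,u_6$, edges $u_2u_3, u_5u_6, u_4u_5$, $u_3u_4$ (two parallel copies), $u_1u_2$ (two parallel copies), $u_1u_6, u_2u_5, u_3u_6$.
   Context: All matroids are binary. For a binary matroid $M$ represented over $GF(2)$ by a matrix $A$ and a set $S \subseteq E(M)$, let $A_S$ be the matrix obtained from $A$ by appending a new bottom row with entry $1$ in the columns of elements of $S$ and $0$ elsewhere; the splitting matroid is $M_S = M(A_S)$. For $k\ge 1$, $\mathcal{C}_k$ denotes the class of cographic binary matroids $M$ such that $M_S$ is graphic for every $S \subseteq E(M)$ with $|S| = k$. $M(G)$ denotes the cycle matroid of a graph $G$. A matroid $P$ is a single-element extension of $E$ if $P \backslash e = E$ for some $e \in E(P)$; $P$ is a coextension of $Q$ by $n$ elements if $P / T \cong Q$ for some $T \subseteq E(P)$ with $|T| = n$. -}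

module Defs where

open import Data.Bool using (Bool; true; false; _∧_; _xor_; if_then_else_)
open import Data.Nat using (ℕ; zero; suc; _<_)
open import Data.Fin using (Fin; zero; suc; #_; inject₁; fromℕ)
open import Data.Fin.Subset as Sub using (Subset; _∈_; _∉_; _⊆_; _∪_; ⁅_⁆; ∁; Nonempty; ∣_∣)
open import Data.Vec using (Vec; []; _∷_; lookup; zipWith; foldr′)
open import Data.Vec.Relation.Unary.Any using (Any)
open import Data.Product using (Σ; _×_; _,_; ∃)
open import Data.Sum using (_⊎_)
open import Relation.Binary.PropositionalEquality using (_≡_)
open import Relation.Nullary using (¬_)
open import Function.Bundles using (_⇔_)

record Matroid : Set₁ where
  field
    size  : ℕ
    Indep : Subset size → Set
open Matroid public

MaxIndepIn : (M : Matroid) → Subset (size M) → Subset (size M) → Set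
MaxIndepIn M C B =
  B ⊆ C × Indep M B × (∀ x → x ∈ C → x ∉ B → ¬ Indep M (B ∪ ⁅ x ⁆))

Basis : (M : Matroid) → Subset (size M) → Set
Basis M B = MaxIndepIn M Sub.⊤ B

dual : Matroid → Matroid
dual M = record { size = size M
                ; Indep = λ X → Σ (Subset (size M)) λ B → Basis M B × X ⊆ ∁ B }

-- independence of Y (disjoint from C) in the contraction M / C
ContrIndep : (M : Matroid) → Subset (size M) → Subset (size M) → Set
ContrIndep M C Y = Σ (Subset (size M)) λ B → MaxIndepIn M C B × Indep M (Y ∪ B)

image : ∀ {m n} → (Fin m → Fin n) → Subset m → Subset n
image {zero}  f []      = Sub.⊥
image {suc m} f (b ∷ X) = (if b then ⁅ f zero ⁆ else Sub.⊥) ∪ image (λ i → f (suc i)) X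

Iso : Matroid → Matroid → Set
Iso P Q = Σ (Fin (size P) → Fin (size Q)) λ σ →
  (∀ i j → σ i ≡ σ j → i ≡ j) × (∀ y → ∃ λ x → σ x ≡ y) ×
  (∀ X → Indep P X ⇔ Indep Q (image σ X))

-- N ≅ M / C \ D, via an injection f of E(N) onto E(M) - (C ∪ D)
record MinorVia (M : Matroid) (C D : Subset (size M)) (N : Matroid) : Set where
  field
    f       : Fin (size N) → Fin (size M)
    f-inj   : ∀ i j → f i ≡ f j → i ≡ j
    disj    : ∀ x → x ∈ C → x ∉ D
    f-avoid : ∀ i → f i ∉ C × f i ∉ D
    f-cover : ∀ x → x ∉ C → x ∉ D → ∃ λ i → f i ≡ x
    indep   : ∀ X → Indep N X ⇔ ContrIndep M C (image f X)

IsMinor : Matroid → Matroid → Set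
IsMinor N M = Σ (Subset (size M)) λ C → Σ (Subset (size M)) λ D → MinorVia M C D N

SingleExt : Matroid → Matroid → Set
SingleExt P E = Σ (Fin (size P)) λ e → MinorVia P Sub.⊥ ⁅ e ⁆ E

Coext : Matroid → Matroid → ℕ → Set
Coext P Q n = Σ (Subset (size P)) λ T → ∣ T ∣ ≡ n × MinorVia P T Sub.⊥ Q

Mat : ℕ → ℕ → Set
Mat r n = Vec (Vec Bool n) r

-- entry of (sum of the columns in Y) in the given row
rowSum : ∀ {n} → Vec Bool n → Subset n → Bool
rowSum ρ Y = foldr′ _xor_ false (zipWith _∧_ ρ Y)

BinIndep : ∀ {r n} → Mat r n → Subset n → Set
BinIndep A X = ∀ Y → Y ⊆ X → Nonempty Y → Any (λ ρ → rowSum ρ Y ≡ true) A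

BinM : ∀ {r n} → Mat r n → Matroid
BinM {r} {n} A = record { size = n ; Indep = BinIndep A }

Represents : ∀ {r} (M : Matroid) → Mat r (size M) → Set
Represents M A = ∀ X → Indep M X ⇔ BinIndep A X

Binary : Matroid → Set
Binary M = Σ ℕ λ r → Σ (Mat r (size M)) λ A → Represents M A

splitMat : ∀ {r n} → Mat r n → Subset n → Mat (suc r) n
splitMat A S = A Data.Vec.∷ʳ S

record Graph : Set where
  field
    nv ne : ℕ
    ends  : Vec (Fin nv × Fin nv) ne
open Graph public

Joins : (G : Graph) → Fin (ne G) → Fin (nv G) → Fin (nv G) → Set
Joins G e u w with lookup (ends G) e
... | a , b = (a ≡ u × b ≡ w) ⊎ (a ≡ w × b ≡ u)

-- a cycle of G with all edges in X: distinct vertices vs 0 .. vs len,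
-- distinct edges es 0 .. es len, es i joins vs i and vs (i+1),
-- and es len joins vs len back to vs 0 (len = 0: a loop; len = 1: two parallel edges)
record Cycle (G : Graph) (X : Subset (ne G)) : Set where
  field
    len    : ℕ
    vs     : Fin (suc len) → Fin (nv G)
    es     : Fin (suc len) → Fin (ne G)
    vs-inj : ∀ i j → vs i ≡ vs j → i ≡ j
    es-inj : ∀ i j → es i ≡ es j → i ≡ j
    es-in  : ∀ i → es i ∈ X
    step   : ∀ (i : Fin len) → Joins G (es (inject₁ i)) (vs (inject₁ i)) (vs (suc i))
    close  : Joins G (es (fromℕ len)) (vs (fromℕ len)) (vs zero)

cycleM : Graph → Matroid
cycleM G = record { size = ne G ; Indep = λ X → ¬ Cycle G X }

Graphic : Matroid → Set
Graphic M = Σ Graph λ G → Iso M (cycleM G)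

Cographic : Matroid → Set
Cographic M = Graphic (dual M)

-- M ∈ C_k : M cographic and M_S graphic for every k-subset S
-- (for every GF(2)-representation A of M; M_S = M(A_S))
InC : ℕ → Matroid → Set
InC k M = Cographic M ×
  (∀ r (A : Mat r (size M)) → Represents M A →
     ∀ (S : Subset (size M)) → ∣ S ∣ ≡ k → Graphic (BinM (splitMat A S)))

MinMinimalNotIn : ℕ → Matroid → Set₁
MinMinimalNotIn k E = Binary E × ¬ InC k E ×
  (∀ N → IsMinor N E → size N < size E → InC k N)

-- The graphs Q_1 .. Q_9 (vertex v_i / w_i / u_i is # (i-1))

mkG : (v e : ℕ) → Vec (Fin v × Fin v) e → Graph
mkG v e es = record { nv = v ; ne = e ; ends = es }

K4 : Vec (Fin 4 × Fin 4) 6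
K4 = (# 0 , # 1) ∷ (# 0 , # 2) ∷ (# 0 , # 3) ∷ (# 1 , # 2) ∷ (# 1 , # 3) ∷ (# 2 , # 3) ∷ []

Q₁ Q₂ Q₃ Q₄ Q₅ Q₆ Q₇ Q₈ Q₉ : Graph
Q₁ = mkG 4 7 (K4 Data.Vec.++ ((# 0 , # 0) ∷ []))
Q₂ = mkG 4 7 ((# 0 , # 1) ∷ (# 1 , # 2) ∷ (# 2 , # 3) ∷ (# 3 , # 0) ∷
              (# 0 , # 1) ∷ (# 1 , # 2) ∷ (# 2 , # 3) ∷ [])
Q₃ = mkG 3 7 ((# 0 , # 1) ∷ (# 0 , # 1) ∷ (# 1 , # 2) ∷ (# 1 , # 2) ∷
              (# 0 , # 2) ∷ (# 0 , # 2) ∷ (# 0 , # 0) ∷ [])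
Q₄ = mkG 4 9 (K4 Data.Vec.++ ((# 0 , # 1) ∷ (# 0 , # 2) ∷ (# 0 , # 3) ∷ []))
Q₅ = mkG 4 9 (K4 Data.Vec.++ ((# 0 , # 1) ∷ (# 2 , # 3) ∷ (# 0 , # 0) ∷ []))
Q₆ = mkG 6 10 ((# 1 , # 2) ∷ (# 4 , # 5) ∷ (# 1 , # 4) ∷ (# 3 , # 4) ∷ (# 2 , # 3) ∷
               (# 0 , # 1) ∷ (# 0 , # 5) ∷ (# 0 , # 4) ∷ (# 2 , # 4) ∷ (# 3 , # 5) ∷ [])
Q₇ = mkG 6 10 ((# 1 , # 2) ∷ (# 4 , # 5) ∷ (# 3 , # 4) ∷ (# 2 , # 3) ∷ (# 0 , # 1) ∷
               (# 0 , # 5) ∷ (# 2 , # 4) ∷ (# 1 , # 5) ∷ (# 0 , # 3) ∷ (# 2 , # 2) ∷ [])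
Q₈ = mkG 6 10 ((# 1 , # 2) ∷ (# 1 , # 2) ∷ (# 4 , # 5) ∷ (# 3 , # 4) ∷ (# 2 , # 3) ∷
               (# 0 , # 1) ∷ (# 0 , # 5) ∷ (# 0 , # 3) ∷ (# 1 , # 4) ∷ (# 2 , # 5) ∷ [])
Q₉ = mkG 6 10 ((# 1 , # 2) ∷ (# 4 , # 5) ∷ (# 3 , # 4) ∷ (# 2 , # 3) ∷ (# 2 , # 3) ∷
               (# 0 , # 1) ∷ (# 0 , # 1) ∷ (# 0 , # 5) ∷ (# 1 , # 4) ∷ (# 2 , # 5) ∷ [])

Q : Fin 9 → Graph
Q zero = Q₁
Q (suc zero) = Q₂
Q (suc (suc zero)) = Q₃
Q (suc (suc (suc zero))) = Q₄
Q (suc (suc (suc (suc zero)))) = Q₅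
Q (suc (suc (suc (suc (suc zero))))) = Q₆
Q (suc (suc (suc (suc (suc (suc zero)))))) = Q₇
Q (suc (suc (suc (suc (suc (suc (suc zero))))))) = Q₈
Q (suc (suc (suc (suc (suc (suc (suc (suc zero)))))))) = Q₉

{-# OPTIONS --safe #-}
module Submission where

-- It suffices to show: if M is cographic and has no minor M(Q₁), M(Q₂), M(Q₃), M(Q₄) or M(Q₆), then M_S is graphic
-- for every set S whatsoever. Let V be the row space of M.
--
-- Suppose first that a basis of V can be chosen among the stars of a graph that becomes a forest after the removal
-- of one vertex, the apex. Modulo the stars, S can be moved to the edges at the apex, and splitting the apex gives a
-- graph for M_S. Adding the rows of M one by one, such a graph can be maintained (by rerooting and splitting trees)
-- until M has a minor M(K₄) or a minor M(K₃) with every edge doubled.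
--
-- In that case start from this minor M / X and uncontract the elements of X one at a time. An element that is a
-- coloop or in series with another one can be left contracted, since series extension preserves graphicness. Up to
-- isomorphism only four templates (graphs with some parallel classes of arbitrary size) remain: every other
-- one-element coextension has one of the minors above, or else a minor F₇, F₇* or M(K₃₃), which a cographic matroid
-- has not. For the templates all splittings are graphic. Both facts depend only on the multiplicities 0, 1, ≥ 2 of
-- the points of GF(2)^r with r ≤ 5 and are decided by evaluation.

open import Defs
import Algebra.Properties.CommutativeSemigroup as CommutativeSemigroup
open import Data.Bool using (Bool; true; false; _∧_; _∨_; not; _xor_; if_then_else_)
import Data.Bool as Bool hiding (module Bool)
open import Data.Bool.Properties using (xor-assoc; xor-comm; xor-same; xor-identityʳ; ∧-comm; ∧-distribʳ-xor; ∧-zeroʳ; ¬-not)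
import Data.Bool.Properties as Bool
open import Data.Bool.Solver using (module xor-∧-Solver)
open import Data.Empty using (⊥; ⊥-elim)
open import Data.Fin using (Fin; zero; #_; suc; inject₁; fromℕ)
open import Data.Fin.Properties using (_≟_; any?)
import Data.Fin.Properties as Fin
import Data.Fin.Relation.Unary.Top as Top
open import Data.Fin.Subset as Sub using (Subset; _∈_; _∉_; _⊆_; _∪_; ⁅_⁆; ∁; Nonempty; ∣_∣)
open import Data.Fin.Subset.Properties using (anySubset?; _∈?_; _⊆?_; nonempty?)
import Data.Fin.Subset.Properties as Sub
open import Data.List using (List; []; _∷_; _++_)
import Data.List as List hiding (module List)
open import Data.List.Membership.Propositional using () renaming (_∈_ to _∈ₗ_)
import Data.List.Membership.Propositional.Properties as Mem
import Data.List.Properties as List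
open import Data.List.Relation.Unary.All using (All; []; _∷_)
import Data.List.Relation.Unary.All as All
import Data.List.Relation.Unary.All.Properties as All
import Data.List.Relation.Unary.Any as Anyₗ
open import Data.Nat using (ℕ; zero; suc; _+_; _*_; _≤_; _<_; _∸_; z≤n; s≤s; s≤s⁻¹)
import Data.Nat as ℕ hiding (module ℕ)
import Data.Nat.DivMod as ℕ
import Data.Nat.Properties as ℕ
import Data.Nat.Solver as ℕ
open import Data.Product using (Σ; _×_; _,_; ∃; proj₁; proj₂)
open import Data.Sum using (_⊎_; inj₁; inj₂; [_,_]′)
open import Data.Unit using (⊤; tt)
open import Data.Vec using (Vec; []; _∷_; lookup; zipWith; replicate; tabulate)
import Data.Vec as Vec
open import Data.Vec.Properties using (lookup⇒[]=; []=⇒lookup; lookup∘tabulate; lookup-zipWith; lookup-map; lookup-replicate; zipWith-assoc; zipWith-comm)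
import Data.Vec.Properties as Vec
open import Data.Vec.Relation.Unary.Any using (Any; here; there)
open import Function using (_∘_; id; case_of_)
open import Function.Bundles using (_⇔_; mk⇔; module Equivalence)
open import Relation.Binary.PropositionalEquality
open import Relation.Nullary using (¬_; Dec; yes; no; ¬?)
import Relation.Nullary
open import Relation.Nullary.Decidable using (_×-dec_; _→-dec_; True; toWitness)
open import Relation.Unary using (Decidable)
open xor-∧-Solver using (solve; _:+_; _:*_; _:=_)
open Equivalence using (to; from)
open ℕ.+-*-Solver using () renaming (solve to solveℕ; _:+_ to _⊹_; _:=_ to _:≡_; con to conℕ)

-- Everything happens in the cycle space `K`, where it is linear: splitting by `S` intersects `K`
-- with the orthogonal complement of `S`, and a matroid is graphic once `K` is the kernel of rows
-- with at most two ones in each column. Cographicness is used in the form that `K` is a cut space;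
-- a degree count shows that such a space has no minor of large nullity and girth on few elements.
--
-- M(K₄) and the doubled M(K₃) are the obstructions to splitting the apex: a branch with both parts
-- of the split on each of its sides, or a tree attached twice to each part while the parts are
-- connected twice elsewhere.
--
-- The uncontracting stage meets two infinities. Parallel classes are unbounded, but no reference
-- matroid has three parallel elements, and sparseness of rows depends only on which points occur;
-- hence the cap at two. The number of contracted elements is unbounded too, but the templates have
-- ranks 2, 3, 4 and 4, an extension that is not in series raises the rank, and at rank 4 each such
-- extension yields a reference minor. From there on only series elements remain.

private
  module ℕ+ = CommutativeSemigroup ℕ.+-commutativeSemigroup

private variable
  n m k ρ σ : ℕ
  A : Set

-- Vectors over GF(2)

infixl 6 _⊕_
infix 7 _·_

_⊕_ : Vec Bool n → Vec Bool n → Vec Bool n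
_⊕_ = zipWith _xor_

𝟘 : Vec Bool n
𝟘 = replicate _ false

_·_ : Vec Bool n → Vec Bool n → Bool
_·_ = rowSum

xor-interchange : ∀ a b c d → (a xor b) xor (c xor d) ≡ (a xor c) xor (b xor d)
xor-interchange = solve 4 (λ a b c d → (a :+ b) :+ (c :+ d) := (a :+ c) :+ (b :+ d)) refl

xor-cancel : ∀ a b → a xor (a xor b) ≡ b
xor-cancel true  true  = refl
xor-cancel true  false = refl
xor-cancel false b     = refl

xor≡false⇒≡ : ∀ {a b} → a xor b ≡ false → a ≡ b
xor≡false⇒≡ {true}  {true}  _ = refl
xor≡false⇒≡ {false} {false} _ = refl

≡⇒xor≡false : ∀ {a b} → a ≡ b → a xor b ≡ false
≡⇒xor≡false {a} refl = xor-same a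

·-comm : (x y : Vec Bool n) → x · y ≡ y · x
·-comm [] [] = refl
·-comm (a ∷ x) (b ∷ y) = cong₂ _xor_ (∧-comm a b) (·-comm x y)

·-⊕ˡ : (x y z : Vec Bool n) → (x ⊕ y) · z ≡ (x · z) xor (y · z)
·-⊕ˡ [] [] [] = refl
·-⊕ˡ (a ∷ x) (b ∷ y) (c ∷ z) =
  trans (cong₂ _xor_ (∧-distribʳ-xor c a b) (·-⊕ˡ x y z))
        (xor-interchange (a ∧ c) (b ∧ c) (x · z) (y · z))

·-⊕ʳ : (x y z : Vec Bool n) → x · (y ⊕ z) ≡ (x · y) xor (x · z)
·-⊕ʳ x y z = trans (·-comm x (y ⊕ z))
  (trans (·-⊕ˡ y z x) (cong₂ _xor_ (·-comm y x) (·-comm z x)))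

𝟘-· : (y : Vec Bool n) → 𝟘 · y ≡ false
𝟘-· [] = refl
𝟘-· (b ∷ y) = 𝟘-· y

·-𝟘 : (y : Vec Bool n) → y · 𝟘 ≡ false
·-𝟘 y = trans (·-comm y 𝟘) (𝟘-· y)

⁅⁆-· : (e : Fin n) (y : Vec Bool n) → ⁅ e ⁆ · y ≡ lookup y e
⁅⁆-· zero    (b ∷ y) = trans (cong (b xor_) (𝟘-· y)) (xor-identityʳ b)
⁅⁆-· (suc e) (b ∷ y) = ⁅⁆-· e y

·-⁅⁆ : (e : Fin n) (y : Vec Bool n) → y · ⁅ e ⁆ ≡ lookup y e
·-⁅⁆ e y = trans (·-comm y ⁅ e ⁆) (⁅⁆-· e y)

lookup-ext : {x y : Vec Bool n} → (∀ i → lookup x i ≡ lookup y i) → x ≡ y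
lookup-ext {x = []} {[]} h = refl
lookup-ext {x = a ∷ x} {b ∷ y} h = cong₂ _∷_ (h zero) (lookup-ext (h ∘ suc))

⊕-lookup : (x y : Vec Bool n) (i : Fin n) → lookup (x ⊕ y) i ≡ lookup x i xor lookup y i
⊕-lookup x y i = lookup-zipWith _xor_ i x y

𝟘-lookup : (i : Fin n) → lookup 𝟘 i ≡ false
𝟘-lookup i = lookup-replicate i false

⊕-assoc : (x y z : Vec Bool n) → (x ⊕ y) ⊕ z ≡ x ⊕ (y ⊕ z)
⊕-assoc = zipWith-assoc xor-assoc

⊕-comm : (x y : Vec Bool n) → x ⊕ y ≡ y ⊕ x
⊕-comm = zipWith-comm xor-comm

⊕-cancel : (x y : Vec Bool n) → x ⊕ (x ⊕ y) ≡ y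
⊕-cancel [] [] = refl
⊕-cancel (a ∷ x) (b ∷ y) = cong₂ _∷_ (xor-cancel a b) (⊕-cancel x y)

⊕-identityˡ : (x : Vec Bool n) → 𝟘 ⊕ x ≡ x
⊕-identityˡ [] = refl
⊕-identityˡ (a ∷ x) = cong (a ∷_) (⊕-identityˡ x)

⊕-identityʳ : (x : Vec Bool n) → x ⊕ 𝟘 ≡ x
⊕-identityʳ x = trans (⊕-comm x 𝟘) (⊕-identityˡ x)

⊕-self : (x : Vec Bool n) → x ⊕ x ≡ 𝟘
⊕-self [] = refl
⊕-self (a ∷ x) = cong₂ _∷_ (xor-same a) (⊕-self x)

⊕≡𝟘⇒≡ : (x y : Vec Bool n) → x ⊕ y ≡ 𝟘 → x ≡ y
⊕≡𝟘⇒≡ [] [] _ = refl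
⊕≡𝟘⇒≡ (a ∷ x) (b ∷ y) h =
  cong₂ _∷_ (xor≡false⇒≡ (cong Vec.head h)) (⊕≡𝟘⇒≡ x y (cong Vec.tail h))

⁅⁆-self : (e : Fin n) → lookup ⁅ e ⁆ e ≡ true
⁅⁆-self zero    = refl
⁅⁆-self (suc e) = ⁅⁆-self e

⁅⁆-≡ : (e f : Fin n) → lookup ⁅ e ⁆ f ≡ true → e ≡ f
⁅⁆-≡ zero    zero    _ = refl
⁅⁆-≡ zero    (suc f) h with () ← trans (sym (𝟘-lookup f)) h
⁅⁆-≡ (suc e) (suc f) h = cong suc (⁅⁆-≡ e f h)

⁅⁆-≢ : (e f : Fin n) → e ≢ f → lookup ⁅ e ⁆ f ≡ false
⁅⁆-≢ e f e≢f = ¬-not λ h → e≢f (⁅⁆-≡ e f h)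

true≢false : ∀ {ℓ} {A : Set ℓ} {b} → b ≡ true → b ≡ false → A
true≢false refl ()

≡𝟘⊎∋ : (y : Vec Bool n) → y ≡ 𝟘 ⊎ ∃ λ e → lookup y e ≡ true
≡𝟘⊎∋ [] = inj₁ refl
≡𝟘⊎∋ (true ∷ y) = inj₂ (zero , refl)
≡𝟘⊎∋ (false ∷ y) with ≡𝟘⊎∋ y
... | inj₁ eq = inj₁ (cong (false ∷_) eq)
... | inj₂ (e , h) = inj₂ (suc e , h)

-- `y · z` is the parity of the common support, which therefore cannot consist of `e` alone. Applied
-- to the star of a vertex and an even edge set, this continues a path beyond the vertex.
another : (y : Vec Bool n) (z : Vec Bool n) (e : Fin n) → y · z ≡ false →
  lookup y e ≡ true → lookup z e ≡ true → ∃ λ f → f ≢ e × lookup y f ≡ true × lookup z f ≡ true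
another y z e yz ye ze with ≡𝟘⊎∋ (zipWith _∧_ y z ⊕ ⁅ e ⁆)
... | inj₂ (f , h) = f , f≢e , proj₁ both , proj₂ both
  where
  split : ∀ a b → a ∧ b ≡ true → a ≡ true × b ≡ true
  split true true _ = refl , refl
  h′ : (lookup y f ∧ lookup z f) xor lookup ⁅ e ⁆ f ≡ true
  h′ = trans (cong (_xor _) (sym (lookup-zipWith _∧_ f y z))) (trans (sym (⊕-lookup (zipWith _∧_ y z) ⁅ e ⁆ f)) h)
  f≢e : f ≢ e
  f≢e refl = true≢false h′ (cong₂ _xor_ (cong₂ _∧_ ye ze) (⁅⁆-self f))
  both : lookup y f ≡ true × lookup z f ≡ true
  both = split _ _ (trans (sym (trans (cong ((lookup y f ∧ lookup z f) xor_) (⁅⁆-≢ e f (f≢e ∘ sym))) (xor-identityʳ (lookup y f ∧ lookup z f)))) h′)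
... | inj₁ eq = true≢false odd yz
  where
  total : (x w : Vec Bool n) → x · w ≡ zipWith _∧_ x w · replicate _ true
  total [] [] = refl
  total (a ∷ x) (b ∷ w) = cong₂ _xor_ (sym (∧-true (a ∧ b))) (total x w)
    where
    ∧-true : ∀ c → c ∧ true ≡ c
    ∧-true true  = refl
    ∧-true false = refl
  odd : y · z ≡ true
  odd = trans (total y z) (trans (cong (_· _) (⊕≡𝟘⇒≡ _ _ eq))
    (trans (⁅⁆-· e _) (lookup-replicate e true)))

∈⇒true : {X : Subset n} {e : Fin n} → e ∈ X → lookup X e ≡ true
∈⇒true = []=⇒lookup

true⇒∈ : {X : Subset n} {e : Fin n} → lookup X e ≡ true → e ∈ X
true⇒∈ {X = X} {e} = lookup⇒[]= e X

∉⇒false : {X : Subset n} {e : Fin n} → e ∉ X → lookup X e ≡ false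
∉⇒false e∉X = ¬-not (e∉X ∘ true⇒∈)

false⇒∉ : {X : Subset n} {e : Fin n} → lookup X e ≡ false → e ∉ X
false⇒∉ h e∈X = true≢false (∈⇒true e∈X) h

support-outside : {Y X : Subset n} → Y ⊆ X → ∀ {e} → e ∉ X → lookup Y e ≡ false
support-outside Y⊆X e∉X = ∉⇒false (e∉X ∘ Y⊆X)

⊕-⊆ : {x y X : Subset n} → x ⊆ X → y ⊆ X → x ⊕ y ⊆ X
⊕-⊆ {x = x} {y} {X} x⊆ y⊆ {e} e∈ with e ∈? X
... | yes p = p
... | no e∉ = ⊥-elim (true≢false (∈⇒true e∈)
  (trans (⊕-lookup x y e) (cong₂ _xor_ (support-outside x⊆ e∉) (support-outside y⊆ e∉))))

-- Row spaces and kernels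

Ker : List (Vec Bool n) → Vec Bool n → Set
Ker R y = All (λ r → r · y ≡ false) R

Ker? : (R : List (Vec Bool n)) → Decidable (Ker R)
Ker? R y = All.all? (λ r → r · y Bool.≟ false) R

Span : List (Vec Bool n) → Vec Bool n → Set
Span []      y = y ≡ 𝟘
Span (r ∷ R) y = Span R y ⊎ Span R (r ⊕ y)

Ker-⊕ : (R : List (Vec Bool n)) {x y : Vec Bool n} → Ker R x → Ker R y → Ker R (x ⊕ y)
Ker-⊕ [] [] [] = []
Ker-⊕ (r ∷ R) {x} {y} (p ∷ ps) (q ∷ qs) = trans (·-⊕ʳ r x y) (cong₂ _xor_ p q) ∷ Ker-⊕ R ps qs

Ker-𝟘 : (R : List (Vec Bool n)) → Ker R 𝟘
Ker-𝟘 [] = []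
Ker-𝟘 (r ∷ R) = ·-𝟘 r ∷ Ker-𝟘 R

Span-⊥-Ker : (R : List (Vec Bool n)) {v y : Vec Bool n} → Span R v → Ker R y → v · y ≡ false
Span-⊥-Ker []      {y = y} refl _ = 𝟘-· y
Span-⊥-Ker (r ∷ R) (inj₁ s) (_ ∷ k) = Span-⊥-Ker R s k
Span-⊥-Ker (r ∷ R) {v} {y} (inj₂ s) (p ∷ k) =
  trans (sym (trans (·-⊕ˡ r v y) (cong (_xor v · y) p))) (Span-⊥-Ker R s k)

Span-𝟘 : (R : List (Vec Bool n)) → Span R 𝟘
Span-𝟘 [] = refl
Span-𝟘 (r ∷ R) = inj₁ (Span-𝟘 R)

Span-⊕ : (R : List (Vec Bool n)) {v w : Vec Bool n} → Span R v → Span R w → Span R (v ⊕ w)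
Span-⊕ [] refl refl = ⊕-self 𝟘
Span-⊕ (r ∷ R) (inj₁ s) (inj₁ t) = inj₁ (Span-⊕ R s t)
Span-⊕ (r ∷ R) {v} {w} (inj₂ s) (inj₁ t) =
  inj₂ (subst (Span R) (⊕-assoc r v w) (Span-⊕ R s t))
Span-⊕ (r ∷ R) {v} {w} (inj₁ s) (inj₂ t) =
  inj₂ (subst (Span R) eq (Span-⊕ R s t))
  where
  eq : v ⊕ (r ⊕ w) ≡ r ⊕ (v ⊕ w)
  eq = trans (sym (⊕-assoc v r w)) (trans (cong (_⊕ w) (⊕-comm v r)) (⊕-assoc r v w))
Span-⊕ (r ∷ R) {v} {w} (inj₂ s) (inj₂ t) =
  inj₁ (subst (Span R) eq (Span-⊕ R s t))
  where
  eq : (r ⊕ v) ⊕ (r ⊕ w) ≡ v ⊕ w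
  eq = trans (cong (_⊕ (r ⊕ w)) (⊕-comm r v))
    (trans (⊕-assoc v r (r ⊕ w)) (cong (v ⊕_) (⊕-cancel r w)))

Span-∋ : (R : List (Vec Bool n)) → All (Span R) R
Span-∋ [] = []
Span-∋ (r ∷ R) = inj₂ (subst (Span R) (sym (⊕-self r)) (Span-𝟘 R)) ∷ All.map inj₁ (Span-∋ R)

-- Constructive double orthogonality. If `r` does not vanish on the witness `z` for `R`, a second
-- witness `z′` is sought for `r ⊕ y`; exactly one of `r` and `y` is nonzero on `z′`, and if it is
-- `r`, then `z ⊕ z′` separates `y`.
span-or-separate : (R : List (Vec Bool n)) (y : Vec Bool n) →
  Span R y ⊎ ∃ λ z → Ker R z × y · z ≡ true
span-or-separate [] y with ≡𝟘⊎∋ y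
... | inj₁ eq = inj₁ eq
... | inj₂ (e , h) = inj₂ (⁅ e ⁆ , [] , trans (·-⁅⁆ e y) h)
span-or-separate (r ∷ R) y with span-or-separate R y
... | inj₁ s = inj₁ (inj₁ s)
... | inj₂ (z , k , yz) with r · z in rz
...   | false = inj₂ (z , rz ∷ k , yz)
...   | true with span-or-separate R (r ⊕ y)
...     | inj₁ s = inj₁ (inj₂ s)
...     | inj₂ (z′ , k′ , h) with r · z′ in rz′ | y · z′ in yz′
...       | false | true  = inj₂ (z′ , rz′ ∷ k′ , yz′)
...       | true  | false = inj₂ (z ⊕ z′
            , trans (·-⊕ʳ r z z′) (cong₂ _xor_ rz rz′) ∷ Ker-⊕ R k k′
            , trans (·-⊕ʳ y z z′) (cong₂ _xor_ yz yz′))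
...       | false | false = ⊥-elim (true≢false h (trans (·-⊕ˡ r y z′) (cong₂ _xor_ rz′ yz′)))
...       | true  | true  = ⊥-elim (true≢false h (trans (·-⊕ˡ r y z′) (cong₂ _xor_ rz′ yz′)))

⊥Ker⇒Span : (R : List (Vec Bool n)) (y : Vec Bool n) →
  (∀ z → Ker R z → y · z ≡ false) → Span R y
⊥Ker⇒Span R y h with span-or-separate R y
... | inj₁ s = s
... | inj₂ (z , k , yz) = ⊥-elim (true≢false yz (h z k))

Span? : (R : List (Vec Bool n)) → Decidable (Span R)
Span? R y with span-or-separate R y
... | inj₁ s = yes s
... | inj₂ (z , k , yz) = no λ s → true≢false yz (Span-⊥-Ker R s k)

-- The dependent sets determine a binary space

Dep : (Vec Bool n → Set) → Subset n → Set
Dep P X = ∃ λ Y → P Y × Y ⊆ X × Nonempty Y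

Dep? : {P : Vec Bool n → Set} → Decidable P → Decidable (Dep P)
Dep? P? X = anySubset? λ Y → P? Y ×-dec (Y ⊆? X) ×-dec nonempty? Y

⊕-shrink : {Z Y : Subset n} → Z ⊆ Y → Nonempty Z → ∣ Y ⊕ Z ∣ < ∣ Y ∣
⊕-shrink {Z = Z} {Y} Z⊆Y (e , e∈Z) = Sub.p⊂q⇒∣p∣<∣q∣
  (⊕-⊆ (λ x → x) Z⊆Y , e , Z⊆Y e∈Z , false⇒∉ (trans (⊕-lookup Y Z e) (cong₂ _xor_ (∈⇒true (Z⊆Y e∈Z)) (∈⇒true e∈Z))))

-- Induction on the size of Y, removing from Y a smaller member of the other space contained in it.
module _ {P Q : Vec Bool n → Set}
  (P-⊕ : ∀ {x y} → P x → P y → P (x ⊕ y)) (Q-⊕ : ∀ {x y} → Q x → Q y → Q (x ⊕ y))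
  (Q-𝟘 : Q 𝟘)
  (P⇒Q : ∀ X → Dep P X → Dep Q X) (Q⇒P : ∀ X → Dep Q X → Dep P X) where

  private
    same : ∀ k Y → ∣ Y ∣ < k → (P Y → Q Y) × (Q Y → P Y ⊎ Y ≡ 𝟘)
    same zero _ ()
    same (suc k) Y (s≤s ∣Y∣≤k) = go₁ , go₂
      where
      sum⇒ : ∀ Z → Y ⊕ (Y ⊕ Z) ≡ Z
      sum⇒ = ⊕-cancel Y
      back : ∀ Z → (Y ⊕ Z) ⊕ Z ≡ Y
      back Z = trans (⊕-assoc Y Z Z) (trans (cong (Y ⊕_) (⊕-self Z)) (⊕-identityʳ Y))
      go₁ : P Y → Q Y
      go₁ pY with ≡𝟘⊎∋ Y
      ... | inj₁ refl = Q-𝟘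
      ... | inj₂ (e , h) with P⇒Q Y (Y , pY , (λ x → x) , e , true⇒∈ h)
      ...   | Z , qZ , Z⊆Y , Z≠∅ with ≡𝟘⊎∋ (Y ⊕ Z)
      ...     | inj₁ eq = subst Q (sym (⊕≡𝟘⇒≡ Y Z eq)) qZ
      ...     | inj₂ (f , f∈) = subst Q (back Z) (Q-⊕ qR qZ)
        where
        ∣R∣ : ∣ Y ⊕ Z ∣ < k
        ∣R∣ = ℕ.<-≤-trans (⊕-shrink Z⊆Y Z≠∅) ∣Y∣≤k
        ∣Z∣ : ∣ Z ∣ < k
        ∣Z∣ = ℕ.<-≤-trans (subst (λ v → ∣ v ∣ < ∣ Y ∣) (sum⇒ Z)
                (⊕-shrink (⊕-⊆ (λ x → x) Z⊆Y) (f , true⇒∈ f∈))) ∣Y∣≤k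
        pZ : P Z
        pZ with proj₂ (same k Z ∣Z∣) qZ
        ... | inj₁ p = p
        ... | inj₂ refl = ⊥-elim (Sub.∉⊥ (proj₂ Z≠∅))
        qR : Q (Y ⊕ Z)
        qR = proj₁ (same k (Y ⊕ Z) ∣R∣) (P-⊕ pY pZ)
      go₂ : Q Y → P Y ⊎ Y ≡ 𝟘
      go₂ qY with ≡𝟘⊎∋ Y
      ... | inj₁ eq = inj₂ eq
      ... | inj₂ (e , h) with Q⇒P Y (Y , qY , (λ x → x) , e , true⇒∈ h)
      ...   | Z , pZ , Z⊆Y , Z≠∅ with ≡𝟘⊎∋ (Y ⊕ Z)
      ...     | inj₁ eq = inj₁ (subst P (sym (⊕≡𝟘⇒≡ Y Z eq)) pZ)
      ...     | inj₂ (f , f∈) = inj₁ (subst P (back Z) (P-⊕ pR pZ))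
        where
        ∣R∣ : ∣ Y ⊕ Z ∣ < k
        ∣R∣ = ℕ.<-≤-trans (⊕-shrink Z⊆Y Z≠∅) ∣Y∣≤k
        ∣Z∣ : ∣ Z ∣ < k
        ∣Z∣ = ℕ.<-≤-trans (subst (λ v → ∣ v ∣ < ∣ Y ∣) (sum⇒ Z)
                (⊕-shrink (⊕-⊆ (λ x → x) Z⊆Y) (f , true⇒∈ f∈))) ∣Y∣≤k
        qZ : Q Z
        qZ = proj₁ (same k Z ∣Z∣) pZ
        pR : P (Y ⊕ Z)
        pR with proj₂ (same k (Y ⊕ Z) ∣R∣) (Q-⊕ qY qZ)
        ... | inj₁ p = p
        ... | inj₂ eq = ⊥-elim (true≢false f∈ (trans (cong (λ v → lookup v f) eq) (𝟘-lookup f)))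

  same-dependent⇒⊆ : ∀ Y → P Y → Q Y
  same-dependent⇒⊆ Y = proj₁ (same (suc ∣ Y ∣) Y ℕ.≤-refl)

-- Cycles of a graph and edge sets of even degree

δ : Fin n → Fin n → Bool
δ u v = Relation.Nullary.does (u ≟ v)

δ-refl : (u : Fin n) → δ u u ≡ true
δ-refl u with u ≟ u
... | yes _ = refl
... | no u≢u = ⊥-elim (u≢u refl)

δ-≢ : {u v : Fin n} → u ≢ v → δ u v ≡ false
δ-≢ {u = u} {v} u≢v with u ≟ v
... | yes u≡v = ⊥-elim (u≢v u≡v)
... | no _ = refl

-- With `xor` a loop cancels at its vertex, so that a single loop counts as an even edge set.
star : (G : Graph) → Fin (nv G) → Vec Bool (ne G)
star G v = Vec.map (λ (a , b) → δ a v xor δ b v) (ends G)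

Even : (G : Graph) → Subset (ne G) → Set
Even G Y = ∀ v → star G v · Y ≡ false

lookup-star : ∀ G v e → lookup (star G v) e ≡
  δ (proj₁ (lookup (ends G) e)) v xor δ (proj₂ (lookup (ends G) e)) v
lookup-star G v e = lookup-map e _ (ends G)

Joins⇒star : ∀ G e u w v → Joins G e u w → lookup (star G v) e ≡ δ u v xor δ w v
Joins⇒star G e u w v j rewrite lookup-star G v e with lookup (ends G) e | j
... | a , b | inj₁ (refl , refl) = refl
... | a , b | inj₂ (refl , refl) = xor-comm (δ a v) (δ b v)

star⇒Joins : ∀ G e v → lookup (star G v) e ≡ true → ∃ λ w → w ≢ v × Joins G e w v
star⇒Joins G e v h rewrite lookup-star G v e with lookup (ends G) e
... | a , b with a ≟ v | b ≟ v
...   | yes refl | no b≢v = b , b≢v , inj₂ (refl , refl)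
...   | no a≢v | yes refl = a , a≢v , inj₁ (refl , refl)

Joins-ends : ∀ G e → Joins G e (proj₁ (lookup (ends G) e)) (proj₂ (lookup (ends G) e))
Joins-ends G e with lookup (ends G) e
... | a , b = inj₁ (refl , refl)

Joins-unique : ∀ G e {u w u′ w′} → Joins G e u w → Joins G e u′ w′ → u ≡ u′ ⊎ u ≡ w′
Joins-unique G e j j′ with lookup (ends G) e
Joins-unique G e (inj₁ (refl , refl)) (inj₁ (refl , refl)) | a , b = inj₁ refl
Joins-unique G e (inj₁ (refl , refl)) (inj₂ (refl , refl)) | a , b = inj₂ refl
Joins-unique G e (inj₂ (refl , refl)) (inj₁ (refl , refl)) | a , b = inj₂ refl
Joins-unique G e (inj₂ (refl , refl)) (inj₂ (refl , refl)) | a , b = inj₁ refl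

xorSum : (Fin k → Bool) → Bool
xorSum {zero}  g = false
xorSum {suc k} g = g zero xor xorSum (g ∘ suc)

xorSum-cong : {g h : Fin k → Bool} → (∀ i → g i ≡ h i) → xorSum g ≡ xorSum h
xorSum-cong {zero}  eq = refl
xorSum-cong {suc k} eq = cong₂ _xor_ (eq zero) (xorSum-cong (eq ∘ suc))

xorSum-last : (g : Fin (suc k) → Bool) → xorSum g ≡ xorSum (g ∘ inject₁) xor g (fromℕ k)
xorSum-last {zero}  g = xor-identityʳ (g zero)
xorSum-last {suc k} g = trans (cong (g zero xor_) (xorSum-last (g ∘ suc)))
  (sym (xor-assoc (g zero) (xorSum (g ∘ suc ∘ inject₁)) (g (fromℕ (suc k)))))

xorSum-telescope : (d : Fin (suc k) → Bool) →
  xorSum (λ i → d (inject₁ i) xor d (suc i)) ≡ d zero xor d (fromℕ k)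
xorSum-telescope {zero}  d = sym (xor-same (d zero))
xorSum-telescope {suc k} d = trans (cong ((d zero xor d (suc zero)) xor_) (xorSum-telescope (d ∘ suc)))
  (trans (xor-assoc (d zero) (d (suc zero)) _)
    (cong (d zero xor_) (xor-cancel (d (suc zero)) (d (fromℕ (suc k))))))

⨁⁅_⁆ : (Fin k → Fin n) → Vec Bool n
⨁⁅_⁆ {zero}  f = 𝟘
⨁⁅_⁆ {suc k} f = ⁅ f zero ⁆ ⊕ ⨁⁅ f ∘ suc ⁆

·-⨁ : (r : Vec Bool n) (f : Fin k → Fin n) → r · ⨁⁅ f ⁆ ≡ xorSum (lookup r ∘ f)
·-⨁ {k = zero}  r f = ·-𝟘 r
·-⨁ {k = suc k} r f = trans (·-⊕ʳ r ⁅ f zero ⁆ ⨁⁅ f ∘ suc ⁆) (cong₂ _xor_ (·-⁅⁆ (f zero) r) (·-⨁ r (f ∘ suc)))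

∈⨁⇒ : (f : Fin k → Fin n) (e : Fin n) → lookup ⨁⁅ f ⁆ e ≡ true → ∃ λ i → f i ≡ e
∈⨁⇒ {k = zero}  f e h = true≢false h (𝟘-lookup e)
∈⨁⇒ {k = suc k} f e h with f zero ≟ e
... | yes eq = zero , eq
... | no ne with ∈⨁⇒ (f ∘ suc) e (trans (sym (trans (⊕-lookup ⁅ f zero ⁆ ⨁⁅ f ∘ suc ⁆ e) (cong (_xor lookup ⨁⁅ f ∘ suc ⁆ e) (⁅⁆-≢ (f zero) e ne)))) h)
...   | i , eq = suc i , eq

-- At each vertex the incidences telescope around the cycle. Since the edges are distinct, the first
-- one is not cancelled in their sum, which is therefore nonempty.
Cycle⇒Dep : ∀ G X → Cycle G X → Dep (Even G) X
Cycle⇒Dep G X C = ⨁⁅ es ⁆ , even , sub , es zero , true⇒∈ first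
  where
  open Cycle C
  even : Even G ⨁⁅ es ⁆
  even v = begin
    star G v · ⨁⁅ es ⁆                              ≡⟨ ·-⨁ (star G v) es ⟩
    xorSum (lookup (star G v) ∘ es)                  ≡⟨ xorSum-last (lookup (star G v) ∘ es) ⟩
    xorSum (lookup (star G v) ∘ es ∘ inject₁) xor lookup (star G v) (es (fromℕ len))
      ≡⟨ cong₂ _xor_ (xorSum-cong λ i → Joins⇒star G _ _ _ v (step i)) (Joins⇒star G _ _ _ v close) ⟩
    xorSum (λ i → d (inject₁ i) xor d (suc i)) xor (d (fromℕ len) xor d zero)
      ≡⟨ cong₂ _xor_ (xorSum-telescope d) (xor-comm (d (fromℕ len)) (d zero)) ⟩
    (d zero xor d (fromℕ len)) xor (d zero xor d (fromℕ len)) ≡⟨ xor-same (d zero xor d (fromℕ len)) ⟩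
    false ∎
    where
    open ≡-Reasoning
    d : Fin (suc len) → Bool
    d i = δ (vs i) v
  sub : ⨁⁅ es ⁆ ⊆ X
  sub {e} e∈ with ∈⨁⇒ es e (∈⇒true e∈)
  ... | i , refl = es-in i
  first : lookup ⨁⁅ es ⁆ (es zero) ≡ true
  first with lookup ⨁⁅ es ∘ suc ⁆ (es zero) in eq
  ... | false = trans (⊕-lookup ⁅ es zero ⁆ ⨁⁅ es ∘ suc ⁆ (es zero)) (cong₂ _xor_ (⁅⁆-self (es zero)) eq)
  ... | true with ∈⨁⇒ (es ∘ suc) (es zero) eq
  ...   | i , h with () ← es-inj (suc i) zero h

snoc : ∀ {A : Set} → (Fin k → A) → A → Fin (suc k) → A
snoc {zero}  f a i       = a
snoc {suc k} f a zero    = f zero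
snoc {suc k} f a (suc i) = snoc (f ∘ suc) a i

snoc-inject₁ : ∀ {A : Set} (f : Fin k → A) a i → snoc f a (inject₁ i) ≡ f i
snoc-inject₁ f a zero    = refl
snoc-inject₁ f a (suc i) = snoc-inject₁ (f ∘ suc) a i

snoc-fromℕ : ∀ {A : Set} (f : Fin k → A) a → snoc f a (fromℕ k) ≡ a
snoc-fromℕ {zero}  f a = refl
snoc-fromℕ {suc k} f a = snoc-fromℕ (f ∘ suc) a

snoc-injective : ∀ {A : Set} (f : Fin k → A) a → (∀ i j → f i ≡ f j → i ≡ j) → (∀ i → f i ≢ a) →
  ∀ i j → snoc f a i ≡ snoc f a j → i ≡ j
snoc-injective f a inj f≢a i j eq with Top.view i | Top.view j
... | Top.‵fromℕ | Top.‵fromℕ = refl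
... | Top.‵fromℕ | Top.‵inject₁ j′ = ⊥-elim (f≢a j′ (trans (sym (snoc-inject₁ f a j′)) (trans (sym eq) (snoc-fromℕ f a))))
... | Top.‵inject₁ i′ | Top.‵fromℕ = ⊥-elim (f≢a i′ (trans (sym (snoc-inject₁ f a i′)) (trans eq (snoc-fromℕ f a))))
... | Top.‵inject₁ i′ | Top.‵inject₁ j′ = cong inject₁ (inj i′ j′
        (trans (sym (snoc-inject₁ f a i′)) (trans eq (snoc-inject₁ f a j′))))

module _ (G : Graph) (X : Subset (ne G)) where

  record Path (k : ℕ) : Set where
    field
      vs     : Fin (suc k) → Fin (nv G)
      es     : Fin k → Fin (ne G)
      vs-inj : ∀ i j → vs i ≡ vs j → i ≡ j
      es-inj : ∀ i j → es i ≡ es j → i ≡ j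
      es-in  : ∀ i → es i ∈ X
      step   : ∀ i → Joins G (es i) (vs (inject₁ i)) (vs (suc i))

  -- The part of the path beyond `j` is cut off, one vertex per recursive call, until `j` is the
  -- last vertex.
  closePath : ∀ {k} (p : Path k) (j : Fin (suc k)) e → e ∈ X →
    Joins G e (Path.vs p j) (Path.vs p zero) → (∀ i → Path.es p i ≢ e) → Cycle G X
  closePath {zero} p zero e e∈X j-e e∉ = record
    { len = zero ; vs = vs ; es = λ _ → e ; vs-inj = vs-inj
    ; es-inj = λ { zero zero _ → refl } ; es-in = λ _ → e∈X ; step = λ () ; close = j-e }
    where
    open Path p
  closePath {suc k} p j e e∈X j-e e∉ with Top.view j
  ... | Top.‵fromℕ = record
    { len = suc k ; vs = vs ; es = snoc es e ; vs-inj = vs-inj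
    ; es-inj = snoc-injective es e es-inj e∉
    ; es-in = in-X
    ; step = λ i → subst (λ f → Joins G f (vs (inject₁ i)) (vs (suc i))) (sym (snoc-inject₁ es e i)) (step i)
    ; close = subst (λ f → Joins G f (vs (fromℕ (suc k))) (vs zero)) (sym (snoc-fromℕ es e)) j-e }
    where
    open Path p
    in-X : ∀ i → snoc es e i ∈ X
    in-X i with Top.view i
    ... | Top.‵fromℕ = subst (_∈ X) (sym (snoc-fromℕ es e)) e∈X
    ... | Top.‵inject₁ i′ = subst (_∈ X) (sym (snoc-inject₁ es e i′)) (es-in i′)
  ... | Top.‵inject₁ j′ = closePath shorter j′ e e∈X j-e (e∉ ∘ inject₁)
    where
    open Path p
    shorter : Path k
    shorter = record
      { vs = vs ∘ inject₁ ; es = es ∘ inject₁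
      ; vs-inj = λ i i′ → Fin.inject₁-injective ∘ vs-inj (inject₁ i) (inject₁ i′)
      ; es-inj = λ i i′ → Fin.inject₁-injective ∘ es-inj (inject₁ i) (inject₁ i′)
      ; es-in = es-in ∘ inject₁ ; step = step ∘ inject₁ }

  -- The path grows at its start: evenness of `Y` at `vs zero` yields a second edge of `Y` there,
  -- whose other end either lies on the path and closes a cycle or is new. The vertices being
  -- distinct, `nv G` bounds the number of rounds.
  extendPath : (Y : Subset (ne G)) → Even G Y → Y ⊆ X → ∀ fuel {k} → nv G ≤ fuel + suc k →
    (p : Path (suc k)) → lookup Y (Path.es p zero) ≡ true → Cycle G X
  extendPath Y even Y⊆X zero {k} le p _ =
    ⊥-elim (ℕ.<-irrefl refl (ℕ.≤-trans (Fin.injective⇒≤ λ {i} {j} → Path.vs-inj p i j) le))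
  extendPath Y even Y⊆X (suc fuel) {k} le p Ye₀
    with another (star G (Path.vs p zero)) Y (Path.es p zero) (even (Path.vs p zero))
           (trans (Joins⇒star G _ _ _ _ (Path.step p zero))
             (cong₂ _xor_ (δ-refl (Path.vs p zero)) (δ-≢ λ eq → case0 (Path.vs-inj p _ _ eq)))) Ye₀
    where
    case0 : suc zero ≡ zero {n = suc k} → ⊥
    case0 ()
  ... | e , e≢e₀ , at-e , Ye with star⇒Joins G e (Path.vs p zero) at-e
  ...   | w , w≢v₀ , j-e with any? (λ j → Path.vs p j ≟ w)
  ...     | yes (j , refl) = closePath p j e (Y⊆X (true⇒∈ Ye)) j-e fresh
    where
    open Path p
    fresh : ∀ i → es i ≢ e
    fresh zero    eq = e≢e₀ (sym eq)
    fresh (suc i) refl with Joins-unique G e (Joins-swap G e j-e) (step (suc i))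
      where
      Joins-swap : ∀ G e {u w} → Joins G e u w → Joins G e w u
      Joins-swap G e j with lookup (ends G) e
      Joins-swap G e (inj₁ h) | _ = inj₂ h
      Joins-swap G e (inj₂ h) | _ = inj₁ h
    ... | inj₁ eq with () ← vs-inj _ _ eq
    ... | inj₂ eq with () ← vs-inj _ _ eq
  ...     | no w∉ = extendPath Y even Y⊆X fuel (subst (nv G ≤_) (sym (ℕ.+-suc fuel (suc k))) le) longer Ye
    where
    open Path p
    vs′ : Fin (suc (suc (suc k))) → Fin (nv G)
    vs′ zero    = w
    vs′ (suc i) = vs i
    es′ : Fin (suc (suc k)) → Fin (ne G)
    es′ zero    = e
    es′ (suc i) = es i
    vs′-inj : ∀ i j → vs′ i ≡ vs′ j → i ≡ j
    vs′-inj zero    zero    _  = refl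
    vs′-inj zero    (suc j) eq = ⊥-elim (w∉ (j , sym eq))
    vs′-inj (suc i) zero    eq = ⊥-elim (w∉ (i , eq))
    vs′-inj (suc i) (suc j) eq = cong suc (vs-inj i j eq)
    fresh : ∀ i → es i ≢ e
    fresh zero    eq = e≢e₀ (sym eq)
    fresh (suc i) refl with Joins-unique G e j-e (step (suc i))
    ... | inj₁ eq = w∉ (_ , sym eq)
    ... | inj₂ eq = w∉ (_ , sym eq)
    es′-inj : ∀ i j → es′ i ≡ es′ j → i ≡ j
    es′-inj zero    zero    _  = refl
    es′-inj zero    (suc j) eq = ⊥-elim (fresh j (sym eq))
    es′-inj (suc i) zero    eq = ⊥-elim (fresh i eq)
    es′-inj (suc i) (suc j) eq = cong suc (es-inj i j eq)
    longer : Path (suc (suc k))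
    longer = record
      { vs = vs′ ; es = es′ ; vs-inj = vs′-inj ; es-inj = es′-inj
      ; es-in = λ { zero → Y⊆X (true⇒∈ Ye) ; (suc i) → es-in i }
      ; step = λ { zero → j-e ; (suc i) → step i } }

  Dep⇒Cycle : Dep (Even G) X → Cycle G X
  Dep⇒Cycle (Y , even , Y⊆X , e , e∈Y) with proj₁ (lookup (ends G) e) ≟ proj₂ (lookup (ends G) e)
  ... | yes eq = closePath {k = zero} (record
        { vs = λ _ → proj₂ (lookup (ends G) e) ; es = λ () ; vs-inj = λ { zero zero _ → refl }
        ; es-inj = λ () ; es-in = λ () ; step = λ () })
        zero e (Y⊆X e∈Y) (subst (λ u → Joins G e u (proj₂ (lookup (ends G) e))) eq (Joins-ends G e)) λ ()
  ... | no a≢b = extendPath Y even Y⊆X (nv G) {k = zero} (ℕ.m≤m+n (nv G) 1) (record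
        { vs = λ { zero → proj₁ (lookup (ends G) e) ; (suc _) → proj₂ (lookup (ends G) e) }
        ; es = λ _ → e
        ; vs-inj = λ { zero zero _ → refl ; zero (suc zero) eq → ⊥-elim (a≢b eq)
                     ; (suc zero) zero eq → ⊥-elim (a≢b (sym eq)) ; (suc zero) (suc zero) _ → refl }
        ; es-inj = λ { zero zero _ → refl } ; es-in = λ _ → Y⊆X e∈Y
        ; step = λ { zero → Joins-ends G e } }) (∈⇒true e∈Y)

-- Matroids represented by subspaces

Represented : (M : Matroid) → (Vec Bool (size M) → Set) → Set
Represented M K = ∀ X → Indep M X ⇔ (¬ Dep K X)

BinIndep⇔ : (A : Mat ρ n) (X : Subset n) → BinIndep A X ⇔ (¬ Dep (Ker (Vec.toList A)) X)
BinIndep⇔ A X = mk⇔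
  (λ ind → λ { (Y , k , Y⊆X , ne) → any⇒¬ker A Y (ind Y Y⊆X ne) k })
  (λ ¬dep Y Y⊆X ne → ¬ker⇒any A Y λ k → ¬dep (Y , k , Y⊆X , ne))
  where
  any⇒¬ker : ∀ {ρ} (A : Mat ρ n) Y → Any (λ r → rowSum r Y ≡ true) A → ¬ Ker (Vec.toList A) Y
  any⇒¬ker (r ∷ A) Y (here p)  (q ∷ _) = true≢false p q
  any⇒¬ker (r ∷ A) Y (there p) (_ ∷ k) = any⇒¬ker A Y p k
  ¬ker⇒any : ∀ {ρ} (A : Mat ρ n) Y → ¬ Ker (Vec.toList A) Y → Any (λ r → rowSum r Y ≡ true) A
  ¬ker⇒any [] Y ¬k = ⊥-elim (¬k [])
  ¬ker⇒any (r ∷ A) Y ¬k with r · Y in eq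
  ... | true  = here eq
  ... | false = there (¬ker⇒any A Y λ k → ¬k (eq ∷ k))

Represents⇒Represented : ∀ {M} {A : Mat ρ (size M)} → Represents M A → Represented M (Ker (Vec.toList A))
Represents⇒Represented {A = A} rep X = mk⇔
  (to (BinIndep⇔ A X) ∘ to (rep X)) (from (rep X) ∘ from (BinIndep⇔ A X))

cycleM-represented : ∀ G → Represented (cycleM G) (Even G)
cycleM-represented G X = mk⇔ (_∘ Dep⇒Cycle G X) (_∘ Cycle⇒Dep G X)

-- Uniqueness of binary representations: `InC` ranges over all matrices that represent a matroid,
-- and this allows a single one to be studied.
Ker-unique : ∀ {M} (R R′ : List (Vec Bool (size M))) →
  Represented M (Ker R) → Represented M (Ker R′) → ∀ y → Ker R y → Ker R′ y
Ker-unique R R′ rep rep′ = same-dependent⇒⊆ (Ker-⊕ R) (Ker-⊕ R′) (Ker-𝟘 R′)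
  (transfer R R′ rep rep′) (transfer R′ R rep′ rep)
  where
  transfer : ∀ {M} (R R′ : List (Vec Bool (size M))) →
    Represented M (Ker R) → Represented M (Ker R′) → ∀ X → Dep (Ker R) X → Dep (Ker R′) X
  transfer R R′ rep rep′ X d with Dep? (Ker? R′) X
  ... | yes d′ = d′
  ... | no ¬d′ = ⊥-elim (to (rep X) (from (rep′ X) ¬d′) d)

-- Images and pull-backs along an injection

push : (Fin m → Fin n) → Vec Bool m → Vec Bool n
push f []      = 𝟘
push f (b ∷ w) = (if b then ⁅ f zero ⁆ else 𝟘) ⊕ push (f ∘ suc) w

pull : (Fin m → Fin n) → Vec Bool n → Vec Bool m
pull f y = tabulate (lookup y ∘ f)

·-push : (f : Fin m → Fin n) (r : Vec Bool n) (w : Vec Bool m) → r · push f w ≡ pull f r · w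
·-push f r []          = ·-𝟘 r
·-push f r (b ∷ w) = trans (·-⊕ʳ r (if b then ⁅ f zero ⁆ else 𝟘) (push (f ∘ suc) w))
  (cong₂ _xor_ (head b) (·-push (f ∘ suc) r w))
  where
  head : ∀ b → r · (if b then ⁅ f zero ⁆ else 𝟘) ≡ lookup r (f zero) ∧ b
  head true  = trans (·-⁅⁆ (f zero) r) (sym (Bool.∧-identityʳ (lookup r (f zero))))
  head false = trans (·-𝟘 r) (sym (∧-zeroʳ (lookup r (f zero))))

lookup-pull : (f : Fin m → Fin n) (y : Vec Bool n) (i : Fin m) → lookup (pull f y) i ≡ lookup y (f i)
lookup-pull f y i = lookup∘tabulate (lookup y ∘ f) i

push⇒ : (f : Fin m → Fin n) (w : Vec Bool m) (e : Fin n) → lookup (push f w) e ≡ true →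
  ∃ λ i → f i ≡ e × lookup w i ≡ true
push⇒ f [] e h = true≢false h (𝟘-lookup e)
push⇒ f (b ∷ w) e h with lookup (push (f ∘ suc) w) e in eq
... | true with push⇒ (f ∘ suc) w e eq
...   | i , p , q = suc i , p , q
push⇒ f (true ∷ w) e h | false = zero , ⁅⁆-≡ (f zero) e
  (trans (sym (trans (⊕-lookup ⁅ f zero ⁆ (push (f ∘ suc) w) e)
    (trans (cong (lookup ⁅ f zero ⁆ e xor_) eq) (xor-identityʳ (lookup ⁅ f zero ⁆ e))))) h) , refl
push⇒ f (false ∷ w) e h | false =
  true≢false h (trans (⊕-lookup 𝟘 (push (f ∘ suc) w) e) (cong₂ _xor_ (𝟘-lookup e) eq))

module _ {f : Fin m → Fin n} (inj : ∀ i j → f i ≡ f j → i ≡ j) where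
  lookup-push : (w : Vec Bool m) (i : Fin m) → lookup (push f w) (f i) ≡ lookup w i
  lookup-push w i with lookup (push f w) (f i) in eq
  lookup-push w i | true with push⇒ f w (f i) eq
  ... | j , fj≡fi , wj with refl ← inj j i fj≡fi = sym wj
  lookup-push w i | false = sym (¬-not λ wi → true≢false
    (trans (sym (⁅⁆-· (f i) (push f w))) (trans (·-push f ⁅ f i ⁆ w) (unit wi))) eq)
    where
    unit : lookup w i ≡ true → pull f ⁅ f i ⁆ · w ≡ true
    unit wi = trans (cong (_· w) (lookup-ext {x = pull f ⁅ f i ⁆} {y = ⁅ i ⁆} pointwise)) (trans (⁅⁆-· i w) wi)
      where
      pointwise : ∀ j → lookup (pull f ⁅ f i ⁆) j ≡ lookup ⁅ i ⁆ j
      pointwise j with i ≟ j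
      ... | yes refl = trans (lookup-pull f ⁅ f i ⁆ i) (trans (⁅⁆-self (f i)) (sym (⁅⁆-self i)))
      ... | no i≢j = trans (lookup-pull f ⁅ f i ⁆ j)
        (trans (⁅⁆-≢ (f i) (f j) (i≢j ∘ inj i j)) (sym (⁅⁆-≢ i j i≢j)))

  push-pull : (y : Vec Bool n) → (∀ e → lookup y e ≡ true → ∃ λ i → f i ≡ e) → push f (pull f y) ≡ y
  push-pull y supp = lookup-ext pointwise
    where
    pointwise : ∀ e → lookup (push f (pull f y)) e ≡ lookup y e
    pointwise e with lookup y e in ye
    pointwise e | true with supp e ye
    ... | i , refl = trans (lookup-push (pull f y) i) (trans (lookup-pull f y i) ye)
    pointwise e | false = ¬-not λ h → let (i , fi , p) = push⇒ f (pull f y) e h in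
      true≢false (trans (sym (trans (lookup-pull f y i) (cong (lookup y) fi))) p) ye

∈image⇒ : (f : Fin m → Fin n) (X : Subset m) {e : Fin n} → e ∈ image f X → ∃ λ i → f i ≡ e × i ∈ X
∈image⇒ {m = zero}  f []      e∈ = ⊥-elim (Sub.∉⊥ e∈)
∈image⇒ {m = suc m} f (b ∷ X) {e} e∈ with Sub.x∈p∪q⁻ (if b then ⁅ f zero ⁆ else Sub.⊥) (image (f ∘ suc) X) e∈
... | inj₂ h with ∈image⇒ (f ∘ suc) X h
...   | i , eq , i∈ = suc i , eq , Vec.there i∈
∈image⇒ {m = suc m} f (true ∷ X)  {e} e∈ | inj₁ h = zero , sym (Sub.x∈⁅y⁆⇒x≡y (f zero) h) , Vec.here
∈image⇒ {m = suc m} f (false ∷ X) {e} e∈ | inj₁ h = ⊥-elim (Sub.∉⊥ h)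

∈image : (f : Fin m → Fin n) (X : Subset m) {i : Fin m} → i ∈ X → f i ∈ image f X
∈image f (true ∷ X) Vec.here = Sub.x∈p∪q⁺ (inj₁ (Sub.x∈⁅x⁆ (f zero)))
∈image f (b ∷ X) (Vec.there i∈) = Sub.x∈p∪q⁺ (inj₂ (∈image (f ∘ suc) X i∈))

image-id : (X : Subset n) → image id X ≡ X
image-id X = Sub.⊆-antisym
  (λ e∈ → let (i , eq , i∈) = ∈image⇒ id X e∈ in subst (_∈ X) eq i∈) (∈image id X)

⟪_⟫ : {P : Fin n → Set} → Decidable P → Subset n
⟪ P? ⟫ = tabulate λ e → Relation.Nullary.does (P? e)

∈⟪⟫⇒ : {P : Fin n → Set} (P? : Decidable P) {e : Fin n} → lookup ⟪ P? ⟫ e ≡ true → P e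
∈⟪⟫⇒ P? {e} h rewrite lookup∘tabulate (λ e → Relation.Nullary.does (P? e)) e with P? e
... | yes p = p

⇒∈⟪⟫ : {P : Fin n → Set} (P? : Decidable P) {e : Fin n} → P e → lookup ⟪ P? ⟫ e ≡ true
⇒∈⟪⟫ P? {e} p rewrite lookup∘tabulate (λ e → Relation.Nullary.does (P? e)) e with P? e
... | yes _ = refl
... | no ¬p = ⊥-elim (¬p p)

-- Minors of represented matroids: G is contracted, the complement of the image of f and G deleted

record MinorVec (K : Vec Bool n → Set) (N : Vec Bool m → Set) : Set where
  field
    f     : Fin m → Fin n
    inj   : ∀ i j → f i ≡ f j → i ≡ j
    G     : Subset n
    f∉G   : ∀ i → f i ∉ G
    lift  : ∀ Y → N Y → ∃ λ y → K y × pull f y ≡ Y ×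
              (∀ e → lookup y e ≡ true → e ∉ G → ∃ λ i → f i ≡ e)
    drop  : ∀ y → K y → (∀ e → lookup y e ≡ true → e ∉ G → ∃ λ i → f i ≡ e) → N (pull f y)
    indep : ∀ y → K y → y ⊆ G → y ≡ 𝟘

MinorVec⇒IsMinor : ∀ {M N} {K : Vec Bool (size M) → Set} {L : Vec Bool (size N) → Set} →
  Represented M K → Represented N L → MinorVec K L → IsMinor N M
MinorVec⇒IsMinor {M} {N} {K} {L} repM repN minor = G , D , record
  { f = f ; f-inj = inj
  ; disj = λ x x∈G x∈D → proj₁ (∈D⇒ x∈D) x∈G
  ; f-avoid = λ i → f∉G i , λ fi∈D → proj₂ (∈D⇒ fi∈D) i refl
  ; f-cover = cover
  ; indep = λ X → mk⇔ (indep⇒ X) (indep⇐ X) }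
  where
  open MinorVec minor
  Inside : Fin (size M) → Set
  Inside e = e ∉ G × (∀ i → f i ≢ e)
  inside? : ∀ e → Dec (Inside e)
  inside? e = ¬? (e ∈? G) ×-dec Fin.all? (λ i → ¬? (f i ≟ e))
  D : Subset (size M)
  D = ⟪ inside? ⟫
  ∈D⇒ : ∀ {e} → e ∈ D → Inside e
  ∈D⇒ = ∈⟪⟫⇒ inside? ∘ ∈⇒true
  cover : ∀ e → e ∉ G → e ∉ D → ∃ λ i → f i ≡ e
  cover e e∉G e∉D with any? (λ i → f i ≟ e)
  ... | yes p = p
  ... | no ¬p = ⊥-elim (e∉D (true⇒∈ (⇒∈⟪⟫ inside? (e∉G , λ i fi≡e → ¬p (i , fi≡e)))))
  G-indep : Indep M G
  G-indep = from (repM G) λ { (y , ky , y⊆G , e , e∈y) →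
    Sub.∉⊥ (subst (e ∈_) (indep y ky y⊆G) e∈y) }
  indep⇒ : ∀ X → Indep N X → ContrIndep M G (image f X)
  indep⇒ X iX = G , ((λ x → x) , G-indep , λ x x∈ x∉ → ⊥-elim (x∉ x∈)) , from (repM _) ¬dep
    where
    ¬dep : ¬ Dep K (image f X ∪ G)
    ¬dep (y , ky , y⊆ , e , e∈y) = to (repN X) iX
      (pull f y , drop y ky supp , sub , nonempty)
      where
      supp′ : ∀ e → lookup y e ≡ true → e ∉ G → ∃ λ i → f i ≡ e × i ∈ X
      supp′ e ye e∉G with Sub.x∈p∪q⁻ (image f X) G (y⊆ (true⇒∈ ye))
      ... | inj₁ e∈ = ∈image⇒ f X e∈
      ... | inj₂ e∈G = ⊥-elim (e∉G e∈G)
      supp : ∀ e → lookup y e ≡ true → e ∉ G → ∃ λ i → f i ≡ e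
      supp e ye e∉G = let (i , eq , _) = supp′ e ye e∉G in i , eq
      sub : pull f y ⊆ X
      sub {i} i∈ with supp′ (f i) (trans (sym (lookup-pull f y i)) (∈⇒true i∈)) (f∉G i)
      ... | j , eq , j∈X = subst (_∈ X) (inj j i eq) j∈X
      nonempty : Nonempty (pull f y)
      nonempty with ≡𝟘⊎∋ (pull f y)
      ... | inj₂ (i , h) = i , true⇒∈ h
      ... | inj₁ eq = ⊥-elim (Sub.∉⊥ (subst (e ∈_) (indep y ky y⊆G) e∈y))
        where
        y⊆G : y ⊆ G
        y⊆G {x} x∈y with x ∈? G
        ... | yes p = p
        ... | no x∉G with supp x (∈⇒true x∈y) x∉G
        ...   | i , refl = true≢false (∈⇒true x∈y)
          (trans (sym (lookup-pull f y i)) (trans (cong (λ v → lookup v i) eq) (𝟘-lookup i)))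
  indep⇐ : ∀ X → ContrIndep M G (image f X) → Indep N X
  indep⇐ X (B , (B⊆G , iB , max) , iXB) = from (repN X) ¬dep
    where
    -- Since `G` is independent, a maximal independent subset of `G` is all of `G`.
    G⊆B : G ⊆ B
    G⊆B {x} x∈G with x ∈? B
    ... | yes p = p
    ... | no x∉B = ⊥-elim (max x x∈G x∉B (from (repM _) λ { (y , ky , y⊆ , ne) →
      to (repM G) G-indep (y , ky , (λ e∈ → [ B⊆G , (λ e∈x → subst (_∈ G) (sym (Sub.x∈⁅y⁆⇒x≡y x e∈x)) x∈G) ]′
        (Sub.x∈p∪q⁻ B ⁅ x ⁆ (y⊆ e∈))) , ne) }))
    ¬dep : ¬ Dep L X
    ¬dep (Y , nY , Y⊆X , i , i∈Y) with lift Y nY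
    ... | y , ky , refl , supp = to (repM _) iXB (y , ky , sub , f i , true⇒∈ (trans (sym (lookup-pull f y i)) (∈⇒true i∈Y)))
      where
      sub : y ⊆ image f X ∪ B
      sub {e} e∈y with e ∈? G
      ... | yes e∈G = Sub.x∈p∪q⁺ (inj₂ (G⊆B e∈G))
      ... | no e∉G with supp e (∈⇒true e∈y) e∉G
      ...   | j , refl = Sub.x∈p∪q⁺ (inj₁ (∈image f X (Y⊆X (true⇒∈ (trans (lookup-pull f y j) (∈⇒true e∈y))))))

-- Sparse row lists are graphic.

weight : Fin n → List (Vec Bool n) → ℕ
weight e []      = 0
weight e (r ∷ R) = (if lookup r e then 1 else 0) + weight e R

Sparse : List (Vec Bool n) → Set
Sparse R = ∀ e → weight e R ≤ 2

-- Renumbering of the vertices when a row is put in front: the new row becomes vertex `suc zero`,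
-- the other rows move up by one, and the extra vertex `zero` stays.
skip : Fin (suc k) → Fin (suc (suc k))
skip zero    = zero
skip (suc i) = suc (suc i)

-- The end of an edge that lies in no row is the extra vertex zero.
endsOf : (R : List (Vec Bool n)) → Fin n → Fin (suc (List.length R)) × Fin (suc (List.length R))
endsOf []      e = zero , zero
endsOf (r ∷ R) e = (if lookup r e then suc zero else skip (proj₁ (endsOf R e)))
                 , skip (if lookup r e then proj₁ (endsOf R e) else proj₂ (endsOf R e))

-- The first end is used up before the second, so an end claimed by no row stays at `zero`.
endsOf-weight≤1 : (R : List (Vec Bool n)) (e : Fin n) → weight e R ≤ 1 → proj₂ (endsOf R e) ≡ zero
endsOf-weight≤0 : (R : List (Vec Bool n)) (e : Fin n) → weight e R ≤ 0 → proj₁ (endsOf R e) ≡ zero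
endsOf-weight≤0 [] e _ = refl
endsOf-weight≤0 (r ∷ R) e le with lookup r e
... | false = cong skip (endsOf-weight≤0 R e le)
endsOf-weight≤1 [] e _ = refl
endsOf-weight≤1 (r ∷ R) e le with lookup r e
... | true  = cong skip (endsOf-weight≤0 R e (s≤s⁻¹ le))
... | false = cong skip (endsOf-weight≤1 R e le)

δ-skip : (i : Fin (suc k)) (j : Fin k) → δ (skip i) (suc (suc j)) ≡ δ i (suc j)
δ-skip zero    j = refl
δ-skip (suc i) j with i ≟ j
... | yes _ = refl
... | no _ = refl

endsOf-row : (R : List (Vec Bool n)) (e : Fin n) → weight e R ≤ 2 → ∀ i →
  δ (proj₁ (endsOf R e)) (suc i) xor δ (proj₂ (endsOf R e)) (suc i) ≡ lookup (List.lookup R i) e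
endsOf-row (r ∷ R) e le zero with lookup r e | endsOf R e | endsOf-weight≤1 R e
... | true  | zero  , b | _ = refl
... | true  | suc a , b | _ = refl
... | false | zero  , zero  | _ = refl
... | false | zero  , suc b | _ = refl
... | false | suc a , zero  | _ = refl
... | false | suc a , suc b | _ = refl
endsOf-row (r ∷ R) e le (suc i) with lookup r e | endsOf-row R e
... | false | ih = trans (cong₂ _xor_ (δ-skip (proj₁ (endsOf R e)) i) (δ-skip (proj₂ (endsOf R e)) i)) (ih le i)
... | true  | ih = trans (δ-skip (proj₁ (endsOf R e)) i) (trans (sym (trans
  (cong (λ v → δ (proj₁ (endsOf R e)) (suc i) xor δ v (suc i)) (endsOf-weight≤1 R e (s≤s⁻¹ le)))
  (xor-identityʳ (δ (proj₁ (endsOf R e)) (suc i))))) (ih (ℕ.≤-trans (s≤s⁻¹ le) (s≤s z≤n)) i))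

⨁ : List (Vec Bool n) → Vec Bool n
⨁ = List.foldr _⊕_ 𝟘

Ker-⨁ : (R : List (Vec Bool n)) {y : Vec Bool n} → Ker R y → ⨁ R · y ≡ false
Ker-⨁ []      {y} []      = 𝟘-· y
Ker-⨁ (r ∷ R) {y} (p ∷ k) = trans (·-⊕ˡ r (⨁ R) y) (cong₂ _xor_ p (Ker-⨁ R k))

δ-zero-skip : (i : Fin (suc k)) → δ (skip i) zero ≡ δ i zero
δ-zero-skip zero    = refl
δ-zero-skip (suc i) = refl

-- Every edge has two ends, so the star of the extra vertex is the sum of all rows; evenness there
-- follows from the rows.
endsOf-zero : (R : List (Vec Bool n)) (e : Fin n) → weight e R ≤ 2 →
  δ (proj₁ (endsOf R e)) zero xor δ (proj₂ (endsOf R e)) zero ≡ lookup (⨁ R) e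
endsOf-zero [] e le = sym (𝟘-lookup e)
endsOf-zero (r ∷ R) e le rewrite ⊕-lookup r (⨁ R) e with lookup r e | endsOf-zero R e
... | false | ih = trans (cong₂ _xor_ (δ-zero-skip (proj₁ (endsOf R e))) (δ-zero-skip (proj₂ (endsOf R e)))) (ih le)
... | true  | ih with endsOf R e | endsOf-weight≤1 R e (s≤s⁻¹ le) | ih (ℕ.≤-trans (s≤s⁻¹ le) (s≤s z≤n))
...   | a , zero | _ | h = trans (δ-zero-skip a) (trans (flip (δ a zero)) (cong not h))
  where
  flip : ∀ b → b ≡ not (b xor true)
  flip true  = refl
  flip false = refl

sparseGraph : (R : List (Vec Bool n)) → Graph
sparseGraph {n} R = mkG (suc (List.length R)) n (tabulate (endsOf R))

module _ (R : List (Vec Bool n)) (sparse : Sparse R) where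
  private
    G = sparseGraph R

    star-entry : ∀ v e → lookup (star G v) e ≡ δ (proj₁ (endsOf R e)) v xor δ (proj₂ (endsOf R e)) v
    star-entry v e = trans (lookup-star G v e)
      (cong (λ p → δ (proj₁ p) v xor δ (proj₂ p) v) (lookup∘tabulate (endsOf R) e))

    star-zero : star G zero ≡ ⨁ R
    star-zero = lookup-ext λ e → trans (star-entry zero e) (endsOf-zero R e (sparse e))

    star-suc : ∀ i → star G (suc i) ≡ List.lookup R i
    star-suc i = lookup-ext λ e → trans (star-entry (suc i) e) (endsOf-row R e (sparse e) i)

  Ker⇒Even : ∀ y → Ker R y → Even G y
  Ker⇒Even y k zero    = trans (cong (_· y) star-zero) (Ker-⨁ R k)
  Ker⇒Even y k (suc i) = trans (cong (_· y) (star-suc i)) (lookup⁻ R k i)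
    where
    lookup⁻ : ∀ R → Ker R y → ∀ i → List.lookup R i · y ≡ false
    lookup⁻ (r ∷ R) (p ∷ k) zero    = p
    lookup⁻ (r ∷ R) (p ∷ k) (suc i) = lookup⁻ R k i

  Even⇒Ker : ∀ y → Even G y → Ker R y
  Even⇒Ker y even = lookup⁺ R λ i → trans (cong (_· y) (sym (star-suc i))) (even (suc i))
    where
    lookup⁺ : ∀ R → (∀ i → List.lookup R i · y ≡ false) → Ker R y
    lookup⁺ []      h = []
    lookup⁺ (r ∷ R) h = h zero ∷ lookup⁺ R (h ∘ suc)

SparseKernel : (Vec Bool n → Set) → Set
SparseKernel K = ∃ λ R → Sparse R × ∀ y → K y ⇔ Ker R y

Dep-map : {K L : Vec Bool n → Set} → (∀ y → K y → L y) → ∀ {X} → Dep K X → Dep L X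
Dep-map h (y , ky , rest) = y , h y ky , rest

SparseKernel⇒Graphic : ∀ {M} {K : Vec Bool (size M) → Set} → Represented M K → SparseKernel K → Graphic M
SparseKernel⇒Graphic {M} {K} rep (R , sparse , eq) = sparseGraph R , id , (λ i j h → h) , (λ y → y , refl) , λ X → 
  subst (λ Z → Indep M X ⇔ (¬ Cycle (sparseGraph R) Z)) (sym (image-id X)) (mk⇔
    (λ i → from (cycleM-represented (sparseGraph R) X) (to (rep X) i ∘ Dep-map λ y → from (eq y) ∘ Even⇒Ker R sparse y))
    (λ i → from (rep X) (to (cycleM-represented (sparseGraph R) X) i ∘ Dep-map λ y → Ker⇒Even R sparse y ∘ to (eq y))))

-- K is the cut space of the graph on n edges with ends a and b.
record CutSpace (K : Vec Bool n → Set) : Set where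
  field
    {order} : ℕ
    a b     : Fin n → Fin order
    cut⇒    : ∀ y → K y → ∃ λ (X : Fin order → Bool) → ∀ e → lookup y e ≡ X (a e) xor X (b e)
    ⇒cut    : ∀ y (X : Fin order → Bool) → (∀ e → lookup y e ≡ X (a e) xor X (b e)) → K y

disjoint-· : (v y : Vec Bool n) → (∀ e → lookup v e ≡ true → lookup y e ≡ false) → v · y ≡ false
disjoint-· [] [] h = refl
disjoint-· (false ∷ v) (c ∷ y) h = disjoint-· v y (h ∘ suc)
disjoint-· (true ∷ v) (c ∷ y) h rewrite h zero refl = disjoint-· v y (h ∘ suc)

-- Adjoining the unit vectors of `L` to the rows amounts to disregarding the coordinates in `L`.
Span-units : (R : List (Vec Bool n)) (P : Fin n → Set) (L : List (Fin n)) {y : Vec Bool n} → (∀ e → P e → All (_≢ e) L) →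
  Span (List.map ⁅_⁆ L ++ R) y → ∃ λ w → Span R w × ∀ e → P e → lookup w e ≡ lookup y e
Span-units R P [] h s = _ , s , λ _ _ → refl
Span-units R P (x ∷ L) h (inj₁ s) = Span-units R P L (λ e pe → All.tail (h e pe)) s
Span-units R P (x ∷ L) {y} h (inj₂ s) with Span-units R P L (λ e pe → All.tail (h e pe)) s
... | w , sw , eq = w , sw , λ e pe → trans (eq e pe) (trans (⊕-lookup ⁅ x ⁆ y e)
  (cong (_xor lookup y e) (⁅⁆-≢ x e (All.head (h e pe)))))

-- Bases and the dual matroid

module _ {M : Matroid} (R : List (Vec Bool (size M))) (rep : Represented M (Ker R)) where
  private E = Fin (size M)

  Indep? : Decidable (Indep M)
  Indep? X with Dep? (Ker? R) X
  ... | yes d = no λ i → to (rep X) i d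
  ... | no ¬d = yes (from (rep X) ¬d)

  dep : ∀ {X} → ¬ Indep M X → Dep (Ker R) X
  dep {X} ¬i with Dep? (Ker? R) X
  ... | yes d = d
  ... | no ¬d = ⊥-elim (¬i (from (rep X) ¬d))

  private
    ∁∣∣< : ∀ (B : Subset (size M)) x → x ∉ B → ∣ ∁ (B ∪ ⁅ x ⁆) ∣ < ∣ ∁ B ∣
    ∁∣∣< B x x∉B = Sub.p⊂q⇒∣p∣<∣q∣ (Sub.p⊆q⇒∁p⊇∁q (Sub.p⊆p∪q ⁅ x ⁆) , x , Sub.x∉p⇒x∈∁p x∉B
      , Sub.x∈p⇒x∉∁p (Sub.x∈p∪q⁺ (inj₂ (Sub.x∈⁅x⁆ x))))

    grow : ∀ fuel C B → ∣ ∁ B ∣ < fuel → B ⊆ C → Indep M B → ∃ (MaxIndepIn M C)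
    grow (suc fuel) C B (s≤s le) B⊆C iB
      with any? (λ x → (x ∈? C) ×-dec ¬? (x ∈? B) ×-dec Indep? (B ∪ ⁅ x ⁆))
    ... | no ¬ext = B , B⊆C , iB , λ x x∈C x∉B i → ¬ext (x , x∈C , x∉B , i)
    ... | yes (x , x∈C , x∉B , i) = grow fuel C (B ∪ ⁅ x ⁆) (ℕ.<-≤-trans (∁∣∣< B x x∉B) le)
      (λ e∈ → [ B⊆C , (λ e∈x → subst (_∈ C) (sym (Sub.x∈⁅y⁆⇒x≡y x e∈x)) x∈C) ]′ (Sub.x∈p∪q⁻ B ⁅ x ⁆ e∈)) i

  maximal : ∀ C → ∃ (MaxIndepIn M C)
  maximal C = grow (suc ∣ ∁ {size M} Sub.⊥ ∣) C Sub.⊥ ℕ.≤-refl (⊥-elim ∘ Sub.∉⊥)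
    (from (rep Sub.⊥) λ { (y , _ , y⊆ , e , e∈) → Sub.∉⊥ (y⊆ e∈) })

  -- A member of the kernel inside `B ∪ ⁅ x ⁆` must use `x`, because `B` is independent. It meets
  -- the support of `v` at most in `x`, and orthogonality forbids an intersection of size one.
  vanishes-on-closure : ∀ {v B x} → Span R v → (∀ e → e ∈ B → lookup v e ≡ false) → Indep M B →
    Dep (Ker R) (B ∪ ⁅ x ⁆) → lookup v x ≡ false
  vanishes-on-closure {v} {B} {x} sv vB iB (y , ky , y⊆ , e , e∈y) with lookup y x in yx
  ... | false = ⊥-elim (to (rep B) iB (y , ky , y⊆B , e , e∈y))
    where
    y⊆B : y ⊆ B
    y⊆B {f} f∈ with Sub.x∈p∪q⁻ B ⁅ x ⁆ (y⊆ f∈)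
    ... | inj₁ f∈B = f∈B
    ... | inj₂ f∈x with refl ← Sub.x∈⁅y⁆⇒x≡y x f∈x = true≢false (∈⇒true f∈) yx
  ... | true = begin
    lookup v x                 ≡⟨ ⁅⁆-· x v ⟨
    ⁅ x ⁆ · v                  ≡⟨ ·-comm ⁅ x ⁆ v ⟩
    v · ⁅ x ⁆                  ≡⟨ xor-identityʳ (v · ⁅ x ⁆) ⟨
    v · ⁅ x ⁆ xor false        ≡⟨ cong (v · ⁅ x ⁆ xor_) rest ⟨
    v · ⁅ x ⁆ xor v · (⁅ x ⁆ ⊕ y) ≡⟨ ·-⊕ʳ v ⁅ x ⁆ (⁅ x ⁆ ⊕ y) ⟨
    v · (⁅ x ⁆ ⊕ (⁅ x ⁆ ⊕ y))  ≡⟨ cong (v ·_) (⊕-cancel ⁅ x ⁆ y) ⟩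
    v · y                      ≡⟨ Span-⊥-Ker R sv ky ⟩
    false                      ∎
    where
    open ≡-Reasoning
    rest : v · (⁅ x ⁆ ⊕ y) ≡ false
    rest = disjoint-· v (⁅ x ⁆ ⊕ y) λ f vf → trans (⊕-lookup ⁅ x ⁆ y f) (entry f vf)
      where
      entry : ∀ f → lookup v f ≡ true → lookup ⁅ x ⁆ f xor lookup y f ≡ false
      entry f vf with x ≟ f
      ... | yes refl = cong₂ _xor_ (⁅⁆-self x) yx
      ... | no x≢f = cong₂ _xor_ (⁅⁆-≢ x f x≢f) (¬-not λ yf →
        [ (λ f∈B → true≢false vf (vB f f∈B)) , (λ f∈x → x≢f (sym (Sub.x∈⁅y⁆⇒x≡y x f∈x))) ]′
          (Sub.x∈p∪q⁻ B ⁅ x ⁆ (y⊆ (true⇒∈ yf))))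

  -- With the coordinates outside `B ∪ ⁅ x ⁆` disregarded, either the unit vector at `x` is a
  -- combination of rows, or some kernel vector supported on `B ∪ ⁅ x ⁆` contains `x`, contrary to
  -- independence.
  separate : ∀ B x → ¬ Dep (Ker R) (B ∪ ⁅ x ⁆) →
    ∃ λ v → Span R v × lookup v x ≡ true × (∀ e → e ∈ B → e ≢ x → lookup v e ≡ false)
  separate B x ¬d with span-or-separate (List.map ⁅_⁆ outside ++ R) ⁅ x ⁆
    where
    outside : List E
    outside = List.filter (λ e → ¬? (e ∈? (B ∪ ⁅ x ⁆))) (List.allFin (size M))
  ... | inj₁ s with Span-units R (_∈ (B ∪ ⁅ x ⁆)) _
      (λ e e∈ → All.map (λ { f∉ refl → f∉ e∈ }) (All.all-filter _ (List.allFin (size M)))) s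
  ...   | v , sv , eq = v , sv , trans (eq x (Sub.x∈p∪q⁺ (inj₂ (Sub.x∈⁅x⁆ x)))) (⁅⁆-self x)
        , λ e e∈B e≢x → trans (eq e (Sub.x∈p∪q⁺ (inj₁ e∈B))) (⁅⁆-≢ x e (e≢x ∘ sym))
  separate B x ¬d | inj₂ (z , k , xz) = ⊥-elim (¬d (z , All.++⁻ʳ _ k , z⊆ , x , true⇒∈ (trans (sym (⁅⁆-· x z)) xz)))
    where
    units : All (λ e → ⁅ e ⁆ · z ≡ false) (List.filter (λ e → ¬? (e ∈? (B ∪ ⁅ x ⁆))) (List.allFin (size M)))
    units = All.map⁻ (All.++⁻ˡ _ k)
    z⊆ : z ⊆ B ∪ ⁅ x ⁆
    z⊆ {e} e∈z with e ∈? (B ∪ ⁅ x ⁆)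
    ... | yes p = p
    ... | no e∉ = ⊥-elim (true≢false (∈⇒true e∈z) (trans (sym (⁅⁆-· e z))
      (All.lookup units (Mem.∈-filter⁺ (λ e → ¬? (e ∈? (B ∪ ⁅ x ⁆))) (Mem.∈-allFin e) e∉))))

  -- A row vector supported in `X` vanishes on a basis that avoids `X`, hence on the closure of this
  -- basis, which is everything.
  Span-dep⇒¬dualIndep : ∀ {X} → Dep (Span R) X → ¬ Indep (dual M) X
  Span-dep⇒¬dualIndep {X} (v , sv , v⊆X , e , e∈v) (B , (_ , iB , max) , X⊆∁B) = true≢false (∈⇒true e∈v) (zero-at e)
    where
    vB : ∀ e → e ∈ B → lookup v e ≡ false
    vB e e∈B = support-outside v⊆X λ e∈X → Sub.x∈∁p⇒x∉p (X⊆∁B e∈X) e∈B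
    zero-at : ∀ e → lookup v e ≡ false
    zero-at e with e ∈? B
    ... | yes e∈B = vB e e∈B
    ... | no e∉B = vanishes-on-closure sv vB iB (dep (max e Sub.∈⊤ e∉B))

  -- A maximal independent subset `B` of the complement of `X` is a basis of the matroid: if `x`
  -- extended it, the row vector separating `x` from `B` would vanish on the closure of `B`, so
  -- outside `X`, and `X` would contain its support.
  ¬Span-dep⇒dualIndep : ∀ {X} → ¬ Dep (Span R) X → Indep (dual M) X
  ¬Span-dep⇒dualIndep {X} ¬d with maximal (∁ X)
  ... | B , B⊆∁X , iB , max = B , ((λ _ → Sub.∈⊤) , iB , λ x _ x∉B i → ¬d (witness x x∉B i)) , λ x∈X →
      Sub.x∉p⇒x∈∁p λ x∈B → Sub.x∈∁p⇒x∉p (B⊆∁X x∈B) x∈X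
    where
    witness : ∀ x → x ∉ B → Indep M (B ∪ ⁅ x ⁆) → Dep (Span R) X
    witness x x∉B i with separate B x (to (rep (B ∪ ⁅ x ⁆)) i)
    ... | v , sv , vx , vB = v , sv , v⊆X , x , true⇒∈ vx
      where
      vB′ : ∀ e → e ∈ B → lookup v e ≡ false
      vB′ e e∈B = vB e e∈B λ { refl → x∉B e∈B }
      v⊆X : v ⊆ X
      v⊆X {e} e∈v with e ∈? X
      ... | yes p = p
      ... | no e∉X with e ∈? B
      ...   | yes e∈B = true≢false (∈⇒true e∈v) (vB′ e e∈B)
      ...   | no e∉B = true≢false (∈⇒true e∈v)
        (vanishes-on-closure sv vB′ iB (dep (max e (Sub.x∉p⇒x∈∁p e∉X) e∉B)))

-- If the dual of M is the cycle matroid of H then the row space of M is the cycle space of H,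
-- so its orthogonal complement is the cut space of H.
  module _ (cographic : Cographic M) where
    private
      H = proj₁ cographic
      τ = proj₁ (proj₂ cographic)
      τ-inj = proj₁ (proj₂ (proj₂ cographic))
      τ-surj = proj₁ (proj₂ (proj₂ (proj₂ cographic)))
      τ-indep = proj₂ (proj₂ (proj₂ (proj₂ cographic)))

      row : Fin (nv H) → Vec Bool (size M)
      row v = pull τ (star H v)

      Flow : Vec Bool (size M) → Set
      Flow w = Even H (push τ w)

      Flow-⊕ : ∀ {x y} → Flow x → Flow y → Flow (x ⊕ y)
      Flow-⊕ {x} {y} p q v = trans (·-push τ (star H v) (x ⊕ y)) (trans (·-⊕ʳ (row v) x y)
        (cong₂ _xor_ (trans (sym (·-push τ (star H v) x)) (p v)) (trans (sym (·-push τ (star H v) y)) (q v))))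

      Flow-𝟘 : Flow 𝟘
      Flow-𝟘 v = trans (·-push τ (star H v) 𝟘) (·-𝟘 (row v))

      Flow? : Decidable Flow
      Flow? w = Fin.all? λ v → star H v · push τ w Bool.≟ false

      Flow⇒cycle : ∀ X → Dep Flow X → Cycle H (image τ X)
      Flow⇒cycle X (w , qw , w⊆X , e , e∈w) = Dep⇒Cycle H (image τ X) (push τ w , qw , sub , τ e , true⇒∈ (trans (lookup-push τ-inj w e) (∈⇒true e∈w)))
        where
        sub : push τ w ⊆ image τ X
        sub {x} x∈ with push⇒ τ w x (∈⇒true x∈)
        ... | i , refl , wi = ∈image τ X (w⊆X (true⇒∈ wi))

      cycle⇒Flow : ∀ X → Cycle H (image τ X) → Dep Flow X
      cycle⇒Flow X c with Cycle⇒Dep H (image τ X) c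
      ... | y , even , y⊆ , e , e∈y with τ-surj e
      ...   | i , refl = pull τ y , subst (Even H) (sym (push-pull τ-inj y λ e _ → τ-surj e)) even , sub
          , i , true⇒∈ (trans (lookup-pull τ y i) (∈⇒true e∈y))
        where
        sub : pull τ y ⊆ X
        sub {j} j∈ with ∈image⇒ τ X (y⊆ (true⇒∈ (trans (sym (lookup-pull τ y j)) (∈⇒true j∈))))
        ... | l , eq , l∈X = subst (_∈ X) (τ-inj l j eq) l∈X

      span⇒Flow : ∀ X → Dep (Span R) X → Dep Flow X
      span⇒Flow X d with Dep? Flow? X
      ... | yes q = q
      ... | no ¬q = ⊥-elim (Span-dep⇒¬dualIndep d (from (τ-indep X) (¬q ∘ cycle⇒Flow X)))

      Flow⇒span : ∀ X → Dep Flow X → Dep (Span R) X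
      Flow⇒span X q with Dep? (Span? R) X
      ... | yes d = d
      ... | no ¬d = ⊥-elim (to (τ-indep X) (¬Span-dep⇒dualIndep ¬d) (Flow⇒cycle X q))

      Span⊆Flow : ∀ y → Span R y → Flow y
      Span⊆Flow = same-dependent⇒⊆ (Span-⊕ R) (λ {x} {y} → Flow-⊕ {x} {y}) Flow-𝟘 span⇒Flow Flow⇒span

      Flow⊆Span : ∀ y → Flow y → Span R y
      Flow⊆Span = same-dependent⇒⊆ (λ {x} {y} → Flow-⊕ {x} {y}) (Span-⊕ R) (Span-𝟘 R) Flow⇒span span⇒Flow

      endA endB : E → Fin (nv H)
      endA e = proj₁ (lookup (ends H) (τ e))
      endB e = proj₂ (lookup (ends H) (τ e))

      lookup-row : ∀ v e → lookup (row v) e ≡ δ (endA e) v xor δ (endB e) v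
      lookup-row v e = trans (lookup-pull τ (star H v) e) (lookup-star H v (τ e))

      potential : ∀ L y → Span (List.map row L) y →
        ∃ λ (X : Fin (nv H) → Bool) → ∀ e → lookup y e ≡ X (endA e) xor X (endB e)
      potential [] y refl = (λ _ → false) , 𝟘-lookup
      potential (v ∷ L) y (inj₁ s) = potential L y s
      potential (v ∷ L) y (inj₂ s) with potential L (row v ⊕ y) s
      ... | X , eq = (λ u → δ u v xor X u) , λ e → begin
        lookup y e                                        ≡⟨ xor-cancel (lookup (row v) e) (lookup y e) ⟨
        lookup (row v) e xor (lookup (row v) e xor lookup y e)
          ≡⟨ cong₂ _xor_ (lookup-row v e) (trans (sym (⊕-lookup (row v) y e)) (eq e)) ⟩
        (δ (endA e) v xor δ (endB e) v) xor (X (endA e) xor X (endB e))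
          ≡⟨ xor-interchange (δ (endA e) v) (δ (endB e) v) (X (endA e)) (X (endB e)) ⟩
        _ ∎
        where
        open ≡-Reasoning

      Ker⇒Flow : ∀ z → Ker (List.map row (List.allFin (nv H))) z → Flow z
      Ker⇒Flow z k v = trans (·-push τ (star H v) z) (All.lookup (All.map⁻ k) (Mem.∈-allFin v))

      -- For `F` the stars of a graph, this is the cut defined by the vertex set `X`.
      weighted : (Fin k → Vec Bool n) → (Fin k → Bool) → Vec Bool n
      weighted {k = zero}  F X = 𝟘
      weighted {k = suc k} F X = (if X zero then F zero else 𝟘) ⊕ weighted (F ∘ suc) (X ∘ suc)

      ·-weighted : (r : Vec Bool n) (F : Fin k → Vec Bool n) (X : Fin k → Bool) →
        (∀ v → r · F v ≡ false) → r · weighted F X ≡ false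
      ·-weighted {k = zero}  r F X h = ·-𝟘 r
      ·-weighted {k = suc k} r F X h = trans (·-⊕ʳ r (if X zero then F zero else 𝟘) (weighted (F ∘ suc) (X ∘ suc)))
        (cong₂ _xor_ (first (X zero)) (·-weighted r (F ∘ suc) (X ∘ suc) (h ∘ suc)))
        where
        first : ∀ b → r · (if b then F zero else 𝟘) ≡ false
        first true  = h zero
        first false = ·-𝟘 r

      lookup-weighted : (F : Fin k → Vec Bool n) (X : Fin k → Bool) (e : Fin n) →
        lookup (weighted F X) e ≡ xorSum λ v → X v ∧ lookup (F v) e
      lookup-weighted {k = zero}  F X e = 𝟘-lookup e
      lookup-weighted {k = suc k} F X e = trans (⊕-lookup (if X zero then F zero else 𝟘) _ e)
        (cong₂ _xor_ (first (X zero)) (lookup-weighted (F ∘ suc) (X ∘ suc) e))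
        where
        first : ∀ b → lookup (if b then F zero else 𝟘) e ≡ b ∧ lookup (F zero) e
        first true  = refl
        first false = 𝟘-lookup e

      xorSum-xor : (g h : Fin k → Bool) → xorSum (λ i → g i xor h i) ≡ xorSum g xor xorSum h
      xorSum-xor {k = zero}  g h = refl
      xorSum-xor {k = suc k} g h = trans (cong ((g zero xor h zero) xor_) (xorSum-xor (g ∘ suc) (h ∘ suc)))
        (xor-interchange (g zero) (h zero) (xorSum (g ∘ suc)) (xorSum (h ∘ suc)))

      xorSum-δ : (X : Fin k → Bool) (u : Fin k) → xorSum (λ v → X v ∧ δ u v) ≡ X u
      xorSum-δ {k = suc k} X zero = trans (cong₂ _xor_ (Bool.∧-identityʳ (X zero))
        (trans (xorSum-cong {h = λ _ → false} λ i → ∧-zeroʳ (X (suc i))) (constant k))) (xor-identityʳ (X zero))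
        where
        constant : ∀ k → xorSum {k} (λ _ → false) ≡ false
        constant zero    = refl
        constant (suc k) = constant k
      xorSum-δ {k = suc k} X (suc u) = trans (cong (_xor xorSum (λ v → X (suc v) ∧ δ (suc u) (suc v))) (∧-zeroʳ (X zero)))
        (trans (xorSum-cong λ v → cong (X (suc v) ∧_) (δ-suc v)) (xorSum-δ (X ∘ suc) u))
        where
        δ-suc : ∀ v → δ (suc u) (suc v) ≡ δ u v
        δ-suc v with u ≟ v
        ... | yes _ = refl
        ... | no _ = refl

    cutSpace : CutSpace (Ker R)
    cutSpace = record
      { a = endA ; b = endB
      ; cut⇒ = λ y k → potential (List.allFin (nv H)) y
          (⊥Ker⇒Span (List.map row (List.allFin (nv H))) y λ z kz →
            trans (·-comm y z) (Span-⊥-Ker R (Flow⊆Span z (Ker⇒Flow z kz)) k))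
      ; ⇒cut = λ y X eq → All.map (λ {r} s → trans (cong (r ·_) (y≡ y X eq))
          (·-weighted r row X λ v → trans (·-comm r (row v)) (trans (sym (·-push τ (star H v) r)) (Span⊆Flow r s v)))) (Span-∋ R) }
      where
      y≡ : ∀ y X → (∀ e → lookup y e ≡ X (endA e) xor X (endB e)) → y ≡ weighted row X
      y≡ y X eq = lookup-ext λ e → trans (eq e) (sym (begin
        lookup (weighted row X) e                     ≡⟨ lookup-weighted row X e ⟩
        xorSum (λ v → X v ∧ lookup (row v) e)         ≡⟨ xorSum-cong (λ v → trans (cong (X v ∧_) (lookup-row v e)) (Bool.∧-distribˡ-xor (X v) (δ (endA e) v) (δ (endB e) v))) ⟩
        xorSum (λ v → (X v ∧ δ (endA e) v) xor (X v ∧ δ (endB e) v)) ≡⟨ xorSum-xor (λ v → X v ∧ δ (endA e) v) (λ v → X v ∧ δ (endB e) v) ⟩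
        _ ≡⟨ cong₂ _xor_ (xorSum-δ X (endA e)) (xorSum-δ X (endB e)) ⟩
        X (endA e) xor X (endB e) ∎))
        where
        open ≡-Reasoning

-- Matroids whose dual is not graphic

module _ {σ : ℕ} where
  private
    V = Vec Bool (suc σ)

    pivot : (R : List V) → All (λ r → Vec.head r ≡ false) R ⊎
      (∃ λ r → ∃ λ R′ → Vec.head r ≡ true × List.length R ≡ suc (List.length R′) ×
        (∀ x → r · x ≡ false → Ker R′ x → Ker R x))
    pivot [] = inj₁ []
    pivot ((true ∷ r) ∷ R) = inj₂ (true ∷ r , R , refl , refl , λ _ p k → p ∷ k)
    pivot ((false ∷ r) ∷ R) with pivot R
    ... | inj₁ h = inj₁ (refl ∷ h)
    ... | inj₂ (s , R′ , hs , len , back) = inj₂ (s , (false ∷ r) ∷ R′ , hs , cong suc len ,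
      λ { x p (q ∷ k) → q ∷ back x p k })

    eliminate : Vec Bool σ → V → Vec Bool σ
    eliminate r (true ∷ s)  = s ⊕ r
    eliminate r (false ∷ s) = s

    eliminate-Ker : ∀ r (R : List V) x → Ker (List.map (eliminate r) R) x → Ker R (r · x ∷ x)
    eliminate-Ker r [] x [] = []
    eliminate-Ker r ((true ∷ s) ∷ R) x (p ∷ k) =
      trans (xor-comm (r · x) (s · x)) (trans (sym (·-⊕ˡ s r x)) p) ∷ eliminate-Ker r R x k
    eliminate-Ker r ((false ∷ s) ∷ R) x (p ∷ k) = p ∷ eliminate-Ker r R x k

  nullStep : (∀ (R : List (Vec Bool σ)) → List.length R < σ → ∃ λ x → x ≢ 𝟘 × Ker R x) →
    (R : List V) → List.length R < suc σ → ∃ λ x → x ≢ 𝟘 × Ker R x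
  nullStep ih R lt with pivot R
  ... | inj₁ h = true ∷ 𝟘 , (λ ()) , All.map (λ {r} → zero-head r) h
    where
    zero-head : ∀ (r : V) → Vec.head r ≡ false → r · (true ∷ 𝟘) ≡ false
    zero-head (false ∷ r) refl = ·-𝟘 r
  ... | inj₂ (true ∷ r , R′ , refl , len , back)
    with ih (List.map (eliminate r) R′) (subst (_< σ) (sym (List.length-map (eliminate r) R′)) (s≤s⁻¹ (subst (_< suc σ) len lt)))
  ...   | x , x≢𝟘 , k = r · x ∷ x , (λ eq → x≢𝟘 (cong Vec.tail eq)) , back (r · x ∷ x) (xor-same (r · x)) (eliminate-Ker r R′ x k)

nullVector : (R : List (Vec Bool σ)) → List.length R < σ → ∃ λ x → x ≢ 𝟘 × Ker R x
nullVector {suc σ} = nullStep nullVector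

module _ {A : Set} (_≟ᴬ_ : (x y : A) → Dec (x ≡ y)) where

  count : A → List A → ℕ
  count q []       = 0
  count q (x ∷ xs) = (if Relation.Nullary.does (q ≟ᴬ x) then 1 else 0) + count q xs

  private
    remove : A → List A → List A
    remove q []       = []
    remove q (x ∷ xs) = if Relation.Nullary.does (q ≟ᴬ x) then remove q xs else x ∷ remove q xs

    count-remove : ∀ q xs → count q xs + List.length (remove q xs) ≡ List.length xs
    count-remove q [] = refl
    count-remove q (x ∷ xs) with q ≟ᴬ x
    ... | yes _ = cong suc (count-remove q xs)
    ... | no _ = trans (ℕ.+-suc (count q xs) _) (cong suc (count-remove q xs))

    remove-other : ∀ q r xs → r ≢ q → count r (remove q xs) ≡ count r xs
    remove-other q r [] r≢q = refl
    remove-other q r (x ∷ xs) r≢q with q ≟ᴬ x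
    ... | no _ = cong (_ +_) (remove-other q r xs r≢q)
    ... | yes refl with r ≟ᴬ x
    ...   | yes eq = ⊥-elim (r≢q eq)
    ...   | no _ = remove-other q r xs r≢q

    remove-∈ : ∀ q {x} xs → x ∈ₗ xs → x ≡ q ⊎ x ∈ₗ remove q xs
    remove-∈ q (x ∷ xs) (Anyₗ.here refl) with q ≟ᴬ x
    ... | yes eq = inj₁ (sym eq)
    ... | no _ = inj₂ (Anyₗ.here refl)
    remove-∈ q (y ∷ xs) (Anyₗ.there x∈) with q ≟ᴬ y | remove-∈ q xs x∈
    ... | _ | inj₁ eq = inj₁ eq
    ... | yes _ | inj₂ h = inj₂ h
    ... | no _ | inj₂ h = inj₂ (Anyₗ.there h)

    ∈-remove : ∀ q {x} xs → x ∈ₗ remove q xs → x ≢ q × x ∈ₗ xs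
    ∈-remove q (y ∷ xs) x∈ with q ≟ᴬ y
    ... | yes _ = let (ne , h) = ∈-remove q xs x∈ in ne , Anyₗ.there h
    ∈-remove q (y ∷ xs) (Anyₗ.here refl) | no q≢y = (λ eq → q≢y (sym eq)) , Anyₗ.here refl
    ∈-remove q (y ∷ xs) (Anyₗ.there x∈) | no _ = let (ne , h) = ∈-remove q xs x∈ in ne , Anyₗ.there h

  -- Each round removes all copies of one entry, at least `g` of them, which bounds the number of
  -- distinct entries.
  representatives : ∀ g fuel xs → List.length xs < fuel → (∀ {x} → x ∈ₗ xs → g ≤ count x xs) →
    ∃ λ D → List.length D * g ≤ List.length xs × (∀ {x} → x ∈ₗ xs → x ∈ₗ D)
  representatives g (suc fuel) [] lt h = [] , z≤n , id
  representatives g (suc fuel) (q ∷ xs) (s≤s lt) h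
    with representatives g fuel (remove q (q ∷ xs)) (ℕ.≤-trans shorter lt)
      (λ x∈ → let (x≢q , x∈′) = ∈-remove q (q ∷ xs) x∈ in
        subst (g ≤_) (sym (remove-other q _ (q ∷ xs) x≢q)) (h x∈′))
    where
    shorter : suc (List.length (remove q (q ∷ xs))) ≤ suc (List.length xs)
    shorter = ℕ.≤-trans (ℕ.+-monoˡ-≤ (List.length (remove q (q ∷ xs))) positive) (ℕ.≤-reflexive (count-remove q (q ∷ xs)))
      where
      positive : 1 ≤ count q (q ∷ xs)
      positive with q ≟ᴬ q
      ... | yes _ = s≤s z≤n
      ... | no ne = ⊥-elim (ne refl)
  ... | D , le , cover = q ∷ D
      , ℕ.≤-trans (ℕ.+-mono-≤ (h (Anyₗ.here refl)) le) (ℕ.≤-reflexive (count-remove q (q ∷ xs)))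
      , λ x∈ → [ (λ { refl → Anyₗ.here refl }) , Anyₗ.there ∘ cover ]′ (remove-∈ q (q ∷ xs) x∈)

column : Vec (Vec Bool k) σ → Fin k → Vec Bool σ
column B i = Vec.map (λ Y → lookup Y i) B

-- Vertices with the same potential with respect to a basis of N are identified, which leaves a graph
-- on GF(2)^σ with k edges. Each of its non-isolated vertices has degree at least g, so there are at
-- most σ of these, which is too few for a graph of rank σ.
module NotCographic {K : Vec Bool n → Set} {N : Vec Bool k → Set}
  (cut : CutSpace K) (minor : MinorVec K N) (g : ℕ)
  (B : Vec (Vec Bool k) σ) (B⊆N : ∀ j → N (lookup B j))
  (B-indep : ∀ x → (∀ i → column B i · x ≡ false) → x ≡ 𝟘)
  (no-coloop : ∀ i → column B i ≢ 𝟘)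
  (girth : ∀ z → N z → z ≢ 𝟘 → g ≤ ∣ z ∣)
  (large : k + k < suc σ * g) where

  open CutSpace cut
  open MinorVec minor
  private
    y : Fin σ → Vec Bool n
    y j = proj₁ (lift (lookup B j) (B⊆N j))

    X : Fin σ → Fin order → Bool
    X j = proj₁ (cut⇒ (y j) (proj₁ (proj₂ (lift (lookup B j) (B⊆N j)))))

    X-eq : ∀ j e → lookup (y j) e ≡ X j (a e) xor X j (b e)
    X-eq j = proj₂ (cut⇒ (y j) (proj₁ (proj₂ (lift (lookup B j) (B⊆N j)))))

    p : Fin order → Vec Bool σ
    p v = tabulate λ j → X j v

    _≟ᵛ_ : (q r : Vec Bool σ) → Dec (q ≡ r)
    _≟ᵛ_ = Vec.≡-dec Bool._≟_

    is : Vec Bool σ → Vec Bool σ → Bool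
    is q r = Relation.Nullary.does (q ≟ᵛ r)

    difference : ∀ e j → lookup (p (a e) ⊕ p (b e)) j ≡ lookup (y j) e
    difference e j = trans (⊕-lookup (p (a e)) (p (b e)) j) (trans
      (cong₂ _xor_ (lookup∘tabulate (λ j → X j (a e)) j) (lookup∘tabulate (λ j → X j (b e)) j)) (sym (X-eq j e)))

    edge : ∀ i → p (a (f i)) ⊕ p (b (f i)) ≡ column B i
    edge i = lookup-ext λ j → trans (difference (f i) j)
      (trans (sym (lookup-pull f (y j) i))
        (trans (cong (λ v → lookup v i) (proj₁ (proj₂ (proj₂ (lift (lookup B j) (B⊆N j))))))
          (sym (lookup-map j (λ Y → lookup Y i) B))))

    endpoints≢ : ∀ i → p (a (f i)) ≢ p (b (f i))
    endpoints≢ i eq = no-coloop i (trans (sym (edge i)) (trans (cong (_⊕ p (b (f i))) eq) (⊕-self (p (b (f i))))))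

    cutAt : Vec Bool σ → Vec Bool n
    cutAt q = tabulate λ e → is q (p (a e)) xor is q (p (b e))

    cutAt-entry : ∀ q e → lookup (cutAt q) e ≡ is q (p (a e)) xor is q (p (b e))
    cutAt-entry q = lookup∘tabulate λ e → is q (p (a e)) xor is q (p (b e))

    -- The lifted basis vectors vanish on the deleted elements, so the two ends of a deleted element
    -- have the same potential and the cut at `q` avoids it.
    cutAt-support : ∀ q e → lookup (cutAt q) e ≡ true → e ∉ G → ∃ λ i → f i ≡ e
    cutAt-support q e h e∉G with ≡𝟘⊎∋ (p (a e) ⊕ p (b e))
    ... | inj₂ (j , h′) = proj₂ (proj₂ (proj₂ (lift (lookup B j) (B⊆N j)))) e (trans (sym (difference e j)) h′) e∉G
    ... | inj₁ eq = true≢false h (trans (cutAt-entry q e)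
      (trans (cong (λ v → is q v xor is q (p (b e))) (⊕≡𝟘⇒≡ (p (a e)) (p (b e)) eq)) (xor-same (is q (p (b e))))))

    vertexStar : Vec Bool σ → Vec Bool k
    vertexStar q = pull f (cutAt q)

    vertexStar∈N : ∀ q → N (vertexStar q)
    vertexStar∈N q = drop (cutAt q) (⇒cut (cutAt q) (λ v → is q (p v)) (cutAt-entry q)) (cutAt-support q)

    endpoints : ∀ {l} → (Fin l → Fin k) → List (Vec Bool σ)
    endpoints {zero}  h = []
    endpoints {suc l} h = p (a (f (h zero))) ∷ p (b (f (h zero))) ∷ endpoints (h ∘ suc)

    length-endpoints : ∀ {l} (h : Fin l → Fin k) → List.length (endpoints h) ≡ l + l
    length-endpoints {zero}  h = refl
    length-endpoints {suc l} h = cong suc (trans (cong suc (length-endpoints (h ∘ suc))) (sym (ℕ.+-suc l l)))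

    a∈ : ∀ {l} (h : Fin l → Fin k) i → p (a (f (h i))) ∈ₗ endpoints h
    a∈ h zero    = Anyₗ.here refl
    a∈ h (suc i) = Anyₗ.there (Anyₗ.there (a∈ (h ∘ suc) i))

    b∈ : ∀ {l} (h : Fin l → Fin k) i → p (b (f (h i))) ∈ₗ endpoints h
    b∈ h zero    = Anyₗ.there (Anyₗ.here refl)
    b∈ h (suc i) = Anyₗ.there (Anyₗ.there (b∈ (h ∘ suc) i))

    ∈endpoints : ∀ {l} (h : Fin l → Fin k) {q} → q ∈ₗ endpoints h → ∃ λ i → q ≡ p (a (f i)) ⊎ q ≡ p (b (f i))
    ∈endpoints {suc l} h (Anyₗ.here refl) = h zero , inj₁ refl
    ∈endpoints {suc l} h (Anyₗ.there (Anyₗ.here refl)) = h zero , inj₂ refl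
    ∈endpoints {suc l} h (Anyₗ.there (Anyₗ.there q∈)) = ∈endpoints (h ∘ suc) q∈

    is-refl : ∀ q → is q q ≡ true
    is-refl q with q ≟ᵛ q
    ... | yes _ = refl
    ... | no ne = ⊥-elim (ne refl)

    is-≢ : ∀ {q r} → q ≢ r → is q r ≡ false
    is-≢ {q} {r} ne with q ≟ᵛ r
    ... | yes eq = ⊥-elim (ne eq)
    ... | no _ = refl

    vertexStar≢𝟘 : ∀ {q} → q ∈ₗ endpoints id → vertexStar q ≢ 𝟘
    vertexStar≢𝟘 {q} q∈ eq with ∈endpoints id q∈
    ... | i , at = true≢false (on at) (trans (sym (trans (lookup-pull f (cutAt q) i) (cutAt-entry q (f i))))
        (trans (cong (λ v → lookup v i) eq) (𝟘-lookup i)))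
      where
      on : q ≡ p (a (f i)) ⊎ q ≡ p (b (f i)) → is q (p (a (f i))) xor is q (p (b (f i))) ≡ true
      on (inj₁ refl) = cong₂ _xor_ (is-refl q) (is-≢ (endpoints≢ i))
      on (inj₂ refl) = cong₂ _xor_ (is-≢ (endpoints≢ i ∘ sym)) (is-refl q)

    degree-bound : ∀ {l} (q : Vec Bool σ) (h : Fin l → Fin k) (z : Vec Bool l) →
      (∀ i → lookup z i ≡ is q (p (a (f (h i)))) xor is q (p (b (f (h i))))) → ∣ z ∣ ≤ count _≟ᵛ_ q (endpoints h)
    degree-bound q h [] eq = z≤n
    degree-bound q h (c ∷ z) eq with degree-bound q (h ∘ suc) z (eq ∘ suc) | eq zero
    ... | ih | refl with q ≟ᵛ p (a (f (h zero))) | q ≟ᵛ p (b (f (h zero)))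
    ...   | yes _ | yes _ = ℕ.≤-trans ih (ℕ.m≤n+m (count _≟ᵛ_ q (endpoints (h ∘ suc))) 2)
    ...   | yes _ | no _ = s≤s ih
    ...   | no _ | yes _ = s≤s ih
    ...   | no _ | no _ = ih

    -- Only the differences from one fixed point matter, and these are fewer than `σ` vectors.
    few-points : (D : List (Vec Bool σ)) → List.length D ≤ σ → 0 < σ → ∃ λ x → x ≢ 𝟘 × ∀ {q r} → q ∈ₗ D → r ∈ₗ D → (q ⊕ r) · x ≡ false
    few-points [] le pos with nullVector [] pos
    ... | x , ne , _ = x , ne , λ ()
    few-points (q₀ ∷ D) le pos with nullVector (List.map (q₀ ⊕_) D) (subst (_< σ) (sym (List.length-map (q₀ ⊕_) D)) le)
    ... | x , ne , k = x , ne , λ {q} {r} q∈ r∈ → trans (·-⊕ˡ q r x) (≡⇒xor≡false (trans (same q∈) (sym (same r∈))))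
      where
      same : ∀ {q} → q ∈ₗ (q₀ ∷ D) → q · x ≡ q₀ · x
      same (Anyₗ.here refl) = refl
      same {q} (Anyₗ.there q∈) = sym (xor≡false⇒≡ (trans (sym (·-⊕ˡ q₀ q x)) (All.lookup (All.map⁻ k) q∈)))

  contradictory : 0 < σ → ⊥
  contradictory pos with representatives _≟ᵛ_ g _ (endpoints id) ℕ.≤-refl (λ {q} q∈ → ℕ.≤-trans
      (girth (vertexStar q) (vertexStar∈N q) (vertexStar≢𝟘 q∈))
      (degree-bound q id (vertexStar q) λ i → trans (lookup-pull f (cutAt q) i) (cutAt-entry q (f i))))
  ... | D , le , cover with List.length D ℕ.≤? σ
  ...   | no D>σ = ℕ.<-irrefl refl (ℕ.<-≤-trans large (ℕ.≤-trans (ℕ.*-monoˡ-≤ g (ℕ.≰⇒> D>σ))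
        (ℕ.≤-trans le (ℕ.≤-reflexive (length-endpoints id)))))
  ...   | yes D≤σ with few-points D D≤σ pos
  ...     | x , ne , eq = ne (B-indep x λ i → subst (λ v → v · x ≡ false) (edge i) (eq (cover (a∈ id i)) (cover (b∈ id i))))

-- Spaces in standard form: on the live elements the space is the kernel of the rows u, and every
-- other element e is the linear combination d e of live ones. Contracting all elements that are not
-- live leaves the matroid represented by u.

combine : (Fin m → Vec Bool n) → Vec Bool m → Vec Bool n
combine {zero}  F []      = 𝟘
combine {suc m} F (b ∷ r) = (if b then F zero else 𝟘) ⊕ combine (F ∘ suc) r

·-combine : (F : Fin m → Vec Bool n) (r : Vec Bool m) (x : Vec Bool n) →
  combine F r · x ≡ r · tabulate (λ e → F e · x)
·-combine {zero}  F []      x = 𝟘-· x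
·-combine {suc m} F (b ∷ r) x = trans (·-⊕ˡ (if b then F zero else 𝟘) (combine (F ∘ suc) r) x)
  (cong₂ _xor_ (first b) (·-combine (F ∘ suc) r x))
  where
  first : ∀ b → (if b then F zero else 𝟘) · x ≡ b ∧ (F zero · x)
  first true  = refl
  first false = 𝟘-· x

combine-support : (F : Fin m → Vec Bool n) (r : Vec Bool m) (i : Fin n) →
  (∀ e → lookup (F e) i ≡ false) → lookup (combine F r) i ≡ false
combine-support {zero}  F []      i h = 𝟘-lookup i
combine-support {suc m} F (b ∷ r) i h = trans (⊕-lookup (if b then F zero else 𝟘) (combine (F ∘ suc) r) i)
  (cong₂ _xor_ (first b) (combine-support (F ∘ suc) r i (h ∘ suc)))
  where
  first : ∀ b → lookup (if b then F zero else 𝟘) i ≡ false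
  first true  = h zero
  first false = 𝟘-lookup i

KerV : Vec (Vec Bool n) ρ → Vec Bool n → Set
KerV u = Ker (Vec.toList u)

·-agree : (v x y : Vec Bool n) → (∀ i → lookup v i ≡ true → lookup x i ≡ lookup y i) → v · x ≡ v · y
·-agree []          []      []      h = refl
·-agree (false ∷ v) (a ∷ x) (b ∷ y) h = ·-agree v x y (h ∘ suc)
·-agree (true ∷ v)  (a ∷ x) (b ∷ y) h = cong₂ _xor_ (h zero refl) (·-agree v x y (h ∘ suc))

KerV-agree : (u : Vec (Vec Bool n) ρ) (x y : Vec Bool n) →
  (∀ i → column u i ≢ 𝟘 → lookup x i ≡ lookup y i) → KerV u x → KerV u y
KerV-agree [] x y h [] = []
KerV-agree (r ∷ u) x y h (p ∷ k) =
  trans (sym (·-agree r x y λ i ri → h i λ eq → true≢false ri (cong Vec.head eq))) p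
  ∷ KerV-agree u x y (λ i ne → h i (ne ∘ cong Vec.tail)) k

record State (K : Vec Bool n → Set) (u : Vec (Vec Bool n) ρ) : Set where
  field
    live   : Fin n → Bool
    d      : Fin n → Vec Bool n
    d-live : ∀ e → live e ≡ true → d e ≡ ⁅ e ⁆
    d-supp : ∀ e i → live i ≡ false → lookup (d e) i ≡ false
    u-supp : ∀ i → live i ≡ false → column u i ≡ 𝟘
    K⇒u    : ∀ y → K y → KerV u y
    K⇒d    : ∀ y → K y → ∀ e → lookup y e ≡ d e · y
    ⇒K     : ∀ y → KerV u y → (∀ e → lookup y e ≡ d e · y) → K y

  column≢𝟘⇒live : ∀ {i} → column u i ≢ 𝟘 → live i ≡ true
  column≢𝟘⇒live {i} ne with live i in eq
  ... | true  = refl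
  ... | false = ⊥-elim (ne (u-supp i eq))

  d⇒live : ∀ e {i} → lookup (d e) i ≡ true → live i ≡ true
  d⇒live e {i} h with live i in eq
  ... | true  = refl
  ... | false = true≢false h (d-supp e i eq)

unit-free : (u : Vec (Vec Bool n) ρ) (x : Fin n) → KerV u ⁅ x ⁆ → column u x ≡ 𝟘
unit-free []      x []      = refl
unit-free (r ∷ u) x (p ∷ k) = cong₂ _∷_ (trans (sym (·-⁅⁆ x r)) p) (unit-free u x k)

-- The row `w` is the only one containing `x`, so it expresses `x` by other live elements;
-- substituting this in every `d e` that involves `x` removes `x` from the live elements.
contract : {K : Vec Bool n → Set} {w : Vec Bool n} {u : Vec (Vec Bool n) ρ} (s : State K (w ∷ u)) (x : Fin n) →
  State.live s x ≡ true → lookup w x ≡ true → column u x ≡ 𝟘 → State K u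
contract {K = K} {w} {u} s x lx wx ux = record
  { live = live′ ; d = d′ ; d-live = d′-live ; d-supp = d′-supp
  ; u-supp = u′-supp
  ; K⇒u = λ y k → All.tail (K⇒u y k)
  ; K⇒d = λ y k e → trans (K⇒d y k e) (sym (d′≡d y (All.head (K⇒u y k)) e))
  ; ⇒K = λ y ku kd → let wy = w·y y kd in ⇒K y (wy ∷ ku) λ e → trans (kd e) (d′≡d y wy e) }
  where
  open State s
  live′ : _ → Bool
  live′ e = live e ∧ not (δ x e)
  add-w : Bool → Vec Bool _ → Vec Bool _
  add-w true  v = v ⊕ w
  add-w false v = v
  d′ : _ → Vec Bool _
  d′ e = add-w (lookup (d e) x) (d e)
  live′⇒ : ∀ e → live′ e ≡ true → live e ≡ true × x ≢ e
  live′⇒ e h with live e | x ≟ e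
  ... | true | no ne = refl , ne
  ¬live′⇒ : ∀ e → live′ e ≡ false → live e ≡ false ⊎ x ≡ e
  ¬live′⇒ e h with live e | x ≟ e
  ... | true  | yes eq = inj₂ eq
  ... | false | _ = inj₁ refl
  d′-live : ∀ e → live′ e ≡ true → d′ e ≡ ⁅ e ⁆
  d′-live e h with live′⇒ e h
  ... | le , x≢e = trans (cong (λ b → add-w b (d e)) (trans (cong (λ v → lookup v x) (d-live e le)) (⁅⁆-≢ e x (x≢e ∘ sym)))) (d-live e le)
  d′-supp : ∀ e i → live′ i ≡ false → lookup (d′ e) i ≡ false
  d′-supp e i h with ¬live′⇒ i h
  ... | inj₁ ¬li = entry (lookup (d e) x)
    where
    entry : ∀ b → lookup (add-w b (d e)) i ≡ false
    entry true  = trans (⊕-lookup (d e) w i) (cong₂ _xor_ (d-supp e i ¬li) (cong Vec.head (u-supp i ¬li)))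
    entry false = d-supp e i ¬li
  ... | inj₂ refl with lookup (d e) x in eq
  ...   | true  = trans (⊕-lookup (d e) w x) (cong₂ _xor_ eq wx)
  ...   | false = eq
  u′-supp : ∀ i → live′ i ≡ false → column u i ≡ 𝟘
  u′-supp i h with ¬live′⇒ i h
  ... | inj₁ ¬li = cong Vec.tail (u-supp i ¬li)
  ... | inj₂ refl = ux
  d′≡d : ∀ y → w · y ≡ false → ∀ e → d′ e · y ≡ d e · y
  d′≡d y wy e = entry (lookup (d e) x)
    where
    entry : ∀ b → add-w b (d e) · y ≡ d e · y
    entry true  = trans (·-⊕ˡ (d e) w y) (trans (cong (d e · y xor_) wy) (xor-identityʳ (d e · y)))
    entry false = refl
  -- The row `w` that was dropped comes back from the new equation for `x` itself, whose right-hand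
  -- side is `⁅ x ⁆ ⊕ w`.
  w·y : ∀ y → (∀ e → lookup y e ≡ d′ e · y) → w · y ≡ false
  w·y y kd = xor-self (lookup y x) (w · y) (trans (kd x) (trans (cong (λ v → v · y) d′x)
    (trans (·-⊕ˡ ⁅ x ⁆ w y) (cong (_xor w · y) (⁅⁆-· x y)))))
    where
    d′x : d′ x ≡ ⁅ x ⁆ ⊕ w
    d′x = trans (cong (λ b → add-w b (d x)) (trans (cong (λ v → lookup v x) (d-live x lx)) (⁅⁆-self x)))
      (cong (_⊕ w) (d-live x lx))
    xor-self : ∀ a b → a ≡ a xor b → b ≡ false
    xor-self true  false _ = refl
    xor-self false false _ = refl

-- Every element is a combination of live ones, so on the space each functional can be rewritten in
-- live coordinates.
reduced : {K : Vec Bool n → Set} {u : Vec (Vec Bool n) ρ} (s : State K u) (r : Vec Bool n) →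
  ∃ λ r′ → (∀ i → State.live s i ≡ false → lookup r′ i ≡ false) ×
    (∀ y → (∀ e → lookup y e ≡ State.d s e · y) → r′ · y ≡ r · y)
reduced s r = combine d r , (λ i ¬li → combine-support d r i λ e → d-supp e i ¬li) , λ y kd →
  trans (·-combine d r y) (cong (r ·_) (lookup-ext λ e → trans (lookup∘tabulate (λ e → d e · y) e) (sym (kd e))))
  where
  open State s

restrict : {K : Vec Bool n → Set} {u : Vec (Vec Bool n) ρ} (s : State K u) (r r′ : Vec Bool n) →
  (∀ i → State.live s i ≡ false → lookup r′ i ≡ false) →
  (∀ y → (∀ e → lookup y e ≡ State.d s e · y) → r′ · y ≡ r · y) →
  State (λ y → K y × r · y ≡ false) (r′ ∷ u)
restrict s r r′ supp eq = record
  { live = live ; d = d ; d-live = d-live ; d-supp = d-supp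
  ; u-supp = λ i ¬li → cong₂ _∷_ (supp i ¬li) (u-supp i ¬li)
  ; K⇒u = λ { y (k , ry) → trans (eq y (K⇒d y k)) ry ∷ K⇒u y k }
  ; K⇒d = λ { y (k , _) → K⇒d y k }
  ; ⇒K = λ { y (ry ∷ ku) kd → ⇒K y ku kd , trans (sym (eq y kd)) ry } }
  where
  open State s

-- As `⁅ x ⁆` lies in `K`, the element `x` is live and occurs in no row of `u`. The new equation is
-- solved for it at once, and the minor represented by `u` stays the same.
solve-for : {K : Vec Bool n → Set} {u : Vec (Vec Bool n) ρ} → State K u → (x : Fin n) (r : Vec Bool n) →
  K ⁅ x ⁆ → lookup r x ≡ true → State (λ y → K y × r · y ≡ false) u
solve-for {K = K} {u} s x r kx rx with reduced s r
... | r′ , supp , eq = contract (restrict s r r′ supp eq) x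
    (d⇒live x (trans (sym (·-⁅⁆ x (d x))) (trans (sym (K⇒d ⁅ x ⁆ kx x)) (⁅⁆-self x))))
    (trans (sym (·-⁅⁆ x r′)) (trans (eq ⁅ x ⁆ (K⇒d ⁅ x ⁆ kx)) (trans (·-⁅⁆ x r) rx)))
    (unit-free u x (K⇒u ⁅ x ⁆ kx))
  where
  open State s

-- The converse of `contract`: the equation for `x` becomes a row again. Any `r` that agrees with
-- `d x` on the kernel of `u` will do, which leaves room for normalising it.
uncontract : {K : Vec Bool n → Set} {u : Vec (Vec Bool n) ρ} (s : State K u) (x : Fin n) →
  State.live s x ≡ false → (r : Vec Bool n) → (∀ i → State.live s i ≡ false → lookup r i ≡ false) →
  (∀ y → KerV u y → State.d s x · y ≡ r · y) → State K ((r ⊕ ⁅ x ⁆) ∷ u)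
uncontract {u = u} s x ¬lx r r-supp r-eq = record
  { live = live′ ; d = d′ ; d-live = d′-live ; d-supp = d′-supp
  ; u-supp = u′-supp
  ; K⇒u = λ y k → row y (trans (K⇒d y k x) (r-eq y (K⇒u y k))) ∷ K⇒u y k
  ; K⇒d = K′⇒d
  ; ⇒K = λ { y (p ∷ ku) kd → ⇒K y ku (back y p ku kd) } }
  where
  open State s
  live′ : _ → Bool
  live′ e = live e ∨ δ x e
  d′ : _ → Vec Bool _
  d′ e = if δ x e then ⁅ e ⁆ else d e
  d′-live : ∀ e → live′ e ≡ true → d′ e ≡ ⁅ e ⁆
  d′-live e h with x ≟ e
  ... | yes _ = refl
  ... | no _ = d-live e (trans (sym (Bool.∨-identityʳ (live e))) h)
  ¬live′⇒ : ∀ i → live′ i ≡ false → live i ≡ false × x ≢ i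
  ¬live′⇒ i h with live i | x ≟ i
  ... | false | no ne = refl , ne
  d′-supp : ∀ e i → live′ i ≡ false → lookup (d′ e) i ≡ false
  d′-supp e i h with ¬live′⇒ i h | x ≟ e
  ... | ¬li , x≢i | yes refl = ⁅⁆-≢ e i x≢i
  ... | ¬li , x≢i | no _ = d-supp e i ¬li
  u′-supp : ∀ i → live′ i ≡ false → column ((r ⊕ ⁅ x ⁆) ∷ u) i ≡ 𝟘
  u′-supp i h with ¬live′⇒ i h
  ... | ¬li , x≢i = cong₂ _∷_ (trans (⊕-lookup r ⁅ x ⁆ i) (cong₂ _xor_ (r-supp i ¬li) (⁅⁆-≢ x i x≢i))) (u-supp i ¬li)
  expand : ∀ y → (r ⊕ ⁅ x ⁆) · y ≡ r · y xor lookup y x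
  expand y = trans (·-⊕ˡ r ⁅ x ⁆ y) (cong (r · y xor_) (⁅⁆-· x y))
  row : ∀ y → lookup y x ≡ r · y → (r ⊕ ⁅ x ⁆) · y ≡ false
  row y eq = trans (expand y) (≡⇒xor≡false (sym eq))
  K′⇒d : ∀ y → _ → ∀ e → lookup y e ≡ d′ e · y
  K′⇒d y k e with x ≟ e
  ... | yes _ = sym (⁅⁆-· e y)
  ... | no _ = K⇒d y k e
  back : ∀ y → (r ⊕ ⁅ x ⁆) · y ≡ false → KerV u y → (∀ e → lookup y e ≡ d′ e · y) → ∀ e → lookup y e ≡ d e · y
  back y p ku kd e with x ≟ e | kd e
  ... | yes refl | _ = trans (sym (xor≡false⇒≡ (trans (sym (expand y)) p))) (sym (r-eq y ku))
  ... | no _ | h = h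

redefine : {K : Vec Bool n → Set} {u : Vec (Vec Bool n) ρ} (s : State K u) (x : Fin n) (v : Vec Bool n) →
  State.live s x ≡ false → (∀ i → State.live s i ≡ false → lookup v i ≡ false) →
  (∀ y → KerV u y → State.d s x · y ≡ v · y) → State K u
redefine s x v ¬lx supp eq = record
  { live = live ; d = d′ ; d-live = d′-live ; d-supp = d′-supp ; u-supp = u-supp ; K⇒u = K⇒u
  ; K⇒d = λ y k e → trans (K⇒d y k e) (same y (K⇒u y k) e)
  ; ⇒K = λ y ku kd → ⇒K y ku λ e → trans (kd e) (sym (same y ku e)) }
  where
  open State s
  d′ : _ → Vec Bool _
  d′ e = if δ x e then v else d e
  d′-live : ∀ e → live e ≡ true → d′ e ≡ ⁅ e ⁆
  d′-live e le with x ≟ e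
  ... | yes refl = true≢false le ¬lx
  ... | no _ = d-live e le
  d′-supp : ∀ e i → live i ≡ false → lookup (d′ e) i ≡ false
  d′-supp e i ¬li with x ≟ e
  ... | yes _ = supp i ¬li
  ... | no _ = d-supp e i ¬li
  same : ∀ y → KerV _ y → ∀ e → d e · y ≡ d′ e · y
  same y ku e with x ≟ e
  ... | yes refl = eq y ku
  ... | no _ = refl

rebase : {K : Vec Bool n → Set} {u : Vec (Vec Bool n) ρ} {v : Vec (Vec Bool n) σ} (s : State K u) →
  (∀ y → KerV u y → KerV v y) → (∀ y → KerV v y → KerV u y) →
  (∀ i → column u i ≡ 𝟘 → column v i ≡ 𝟘) → State K v
rebase s u⇒v v⇒u zero-col = record
  { live = live ; d = d ; d-live = d-live ; d-supp = d-supp ; u-supp = λ i → zero-col i ∘ u-supp i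
  ; K⇒u = λ y → u⇒v y ∘ K⇒u y ; K⇒d = K⇒d ; ⇒K = λ y → ⇒K y ∘ v⇒u y }
  where
  open State s

-- The elements f i are kept, the remaining live elements deleted and all others contracted.
State⇒MinorVec : {K : Vec Bool n → Set} {u : Vec (Vec Bool n) ρ} (s : State K u) (B : Vec (Vec Bool k) ρ)
  (f : Fin k → Fin n) → (∀ i j → f i ≡ f j → i ≡ j) → (∀ i → State.live s (f i) ≡ true) →
  (∀ i → column u (f i) ≡ column B i) → MinorVec K (KerV B)
State⇒MinorVec {n = n} {u = u} s B f f-inj f-live f-col = record
  { f = f ; inj = f-inj ; G = G ; f∉G = λ i i∈G → true≢false (f-live i) (∈G⇒ (∈⇒true i∈G))
  ; lift = lift′ ; drop = drop′ ; indep = indep′ }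
  where
  open State s
  G : Subset n
  G = ⟪ (λ e → live e Bool.≟ false) ⟫
  ∈G⇒ : ∀ {e} → lookup G e ≡ true → live e ≡ false
  ∈G⇒ = ∈⟪⟫⇒ (λ e → live e Bool.≟ false)
  ∉G⇒ : ∀ {e} → e ∉ G → live e ≡ true
  ∉G⇒ {e} e∉G with live e in eq
  ... | true  = refl
  ... | false = ⊥-elim (e∉G (true⇒∈ (⇒∈⟪⟫ (λ e → live e Bool.≟ false) eq)))
  live⇒∉G : ∀ {e} → live e ≡ true → e ∉ G
  live⇒∉G le e∈G = true≢false le (∈G⇒ (∈⇒true e∈G))
  pull-row : ∀ {ρ} (u : Vec (Vec Bool n) ρ) B → (∀ i → column u (f i) ≡ column B i) →
    ∀ z → (KerV B z → KerV u (push f z)) × (KerV u (push f z) → KerV B z)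
  pull-row [] [] h z = (λ _ → []) , λ _ → []
  pull-row (r ∷ u) (b ∷ B) h z =
    (λ { (p ∷ k) → trans eq p ∷ proj₁ ih k }) , λ { (p ∷ k) → trans (sym eq) p ∷ proj₂ ih k }
    where
    ih = pull-row u B (cong Vec.tail ∘ h) z
    eq : r · push f z ≡ b · z
    eq = trans (·-push f r z) (cong (_· z) (lookup-ext {x = pull f r} {y = b} λ i → trans (lookup-pull f r i) (cong Vec.head (h i))))
  lift′ : ∀ z → KerV B z → ∃ λ y → _ × pull f y ≡ z × (∀ e → lookup y e ≡ true → e ∉ G → ∃ λ i → f i ≡ e)
  lift′ z kz = y , ⇒K y (KerV-agree u y₀ y (λ i ne → sym (on-live i (column≢𝟘⇒live ne))) (proj₁ (pull-row u B f-col z) kz))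
      (λ e → trans (entry e) (sym (d·y e)))
    , lookup-ext (λ i → trans (lookup-pull f y i) (trans (on-live (f i) (f-live i)) (lookup-push f-inj z i)))
    , λ e ye e∉G → let (i , fi , _) = push⇒ f z e (trans (sym (on-live e (∉G⇒ e∉G))) ye) in i , fi
    where
    y₀ y : Vec Bool n
    y₀ = push f z
    y = tabulate λ e → d e · y₀
    entry : ∀ e → lookup y e ≡ d e · y₀
    entry = lookup∘tabulate λ e → d e · y₀
    on-live : ∀ e → live e ≡ true → lookup y e ≡ lookup y₀ e
    on-live e le = trans (entry e) (trans (cong (_· y₀) (d-live e le)) (⁅⁆-· e y₀))
    d·y : ∀ e → d e · y ≡ d e · y₀
    d·y e = ·-agree (d e) y y₀ λ i di → on-live i (d⇒live e di)
  drop′ : ∀ y → _ → (∀ e → lookup y e ≡ true → e ∉ G → ∃ λ i → f i ≡ e) → KerV B (pull f y)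
  drop′ y k supp = proj₂ (pull-row u B f-col (pull f y)) (KerV-agree u y (push f (pull f y)) agree (K⇒u y k))
    where
    agree : ∀ i → column u i ≢ 𝟘 → lookup y i ≡ lookup (push f (pull f y)) i
    agree e ne with lookup y e in ye | lookup (push f (pull f y)) e in pe
    ... | true  | true  = refl
    ... | false | false = refl
    ... | true  | false with supp e ye (live⇒∉G (column≢𝟘⇒live ne))
    ...   | i , refl = true≢false ye (trans (sym (trans (lookup-push f-inj (pull f y) i) (lookup-pull f y i))) pe)
    agree e ne | false | true with push⇒ f (pull f y) e pe
    ...   | i , refl , h = true≢false (trans (sym (lookup-pull f y i)) h) ye
  indep′ : ∀ y → _ → y ⊆ G → y ≡ 𝟘
  indep′ y k y⊆G = lookup-ext λ e → trans (K⇒d y k e) (trans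
    (disjoint-· (d e) y λ i di → support-outside y⊆G (live⇒∉G (d⇒live e di))) (sym (𝟘-lookup e)))

-- Multiplicities 0, 1 and at least 2

data Cap : Set where
  none one many : Cap

-- As an upper bound `many` says nothing, so that large parallel classes are never counted exactly.
AtLeast AtMost : Cap → (Fin n → Set) → Set
AtLeast none P = ⊤
AtLeast one  P = ∃ P
AtLeast many P = ∃ λ e → ∃ λ f → e ≢ f × P e × P f
AtMost none P = ∀ e → ¬ P e
AtMost one  P = ∀ e f → P e → P f → e ≡ f
AtMost many P = ⊤

_≼_ : Cap → Cap → Bool
none ≼ _    = true
one  ≼ none = false
one  ≼ _    = true
many ≼ many = true
many ≼ _    = false

_⊞_ : Cap → Cap → Cap
none ⊞ c    = c
one  ⊞ none = one
one  ⊞ _    = many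
many ⊞ _    = many

AtLeast-map : ∀ c {P Q : Fin n → Set} → (∀ {e} → P e → Q e) → AtLeast c P → AtLeast c Q
AtLeast-map none h _ = tt
AtLeast-map one  h (e , p) = e , h p
AtLeast-map many h (e , f , ne , p , q) = e , f , ne , h p , h q

AtMost-map : ∀ c {P Q : Fin n → Set} → (∀ {e} → Q e → P e) → AtMost c P → AtMost c Q
AtMost-map none h ¬p e q = ¬p e (h q)
AtMost-map one  h uniq e f p q = uniq e f (h p) (h q)
AtMost-map many h _ = tt

AtLeast-⊞ : ∀ c c′ {P Q S : Fin n → Set} → (∀ {e} → P e → S e) → (∀ {e} → Q e → S e) →
  (∀ {e} → P e → Q e → ⊥) → AtLeast c P → AtLeast c′ Q → AtLeast (c ⊞ c′) S
AtLeast-⊞ none c′ P⇒ Q⇒ disj _ q = AtLeast-map c′ Q⇒ q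
AtLeast-⊞ one none P⇒ Q⇒ disj (e , p) q = e , P⇒ p
AtLeast-⊞ one one P⇒ Q⇒ disj (e , p) (f , q) = e , f , (λ { refl → disj p q }) , P⇒ p , Q⇒ q
AtLeast-⊞ one many P⇒ Q⇒ disj _ q = AtLeast-map many Q⇒ q
AtLeast-⊞ many c′ P⇒ Q⇒ disj p _ = AtLeast-map many P⇒ p

AtMost-⊞ : ∀ c c′ {P Q S : Fin n → Set} → (∀ {e} → S e → P e ⊎ Q e) →
  AtMost c P → AtMost c′ Q → AtMost (c ⊞ c′) S
AtMost-⊞ none c′ S⇒ ¬p q = AtMost-map c′ (λ s → [ (λ p → ⊥-elim (¬p _ p)) , id ]′ (S⇒ s)) q
AtMost-⊞ one none S⇒ p ¬q = AtMost-map one (λ s → [ id , (λ q → ⊥-elim (¬q _ q)) ]′ (S⇒ s)) p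
AtMost-⊞ one one S⇒ p q = tt
AtMost-⊞ one many S⇒ p q = tt
AtMost-⊞ many c′ S⇒ p q = tt

multiplicity : {P : Fin n → Set} → Decidable P → ∃ λ c → AtLeast c P × AtMost c P
multiplicity P? with any? P?
... | no ¬p = none , tt , λ e p → ¬p (e , p)
... | yes (e , p) with any? (λ f → ¬? (e ≟ f) ×-dec P? f)
...   | yes (f , ne , q) = many , (e , f , ne , p , q) , tt
...   | no ¬q = one , (e , p) , λ f g pf pg → trans (sym (same f pf)) (same g pg)
  where
  same : ∀ f → _ → e ≡ f
  same f pf with e ≟ f
  ... | yes eq = eq
  ... | no ne = ⊥-elim (¬q (f , ne , pf))

-- Functions on GF(2)^ρ as binary trees

Tree : Set → ℕ → Set
Tree A zero    = A
Tree A (suc ρ) = Tree A ρ × Tree A ρ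

get : Tree A ρ → Vec Bool ρ → A
get {ρ = zero}  a       []          = a
get {ρ = suc ρ} (S , T) (false ∷ p) = get S p
get {ρ = suc ρ} (S , T) (true ∷ p)  = get T p

grow : (Vec Bool ρ → A) → Tree A ρ
grow {ρ = zero}  f = f []
grow {ρ = suc ρ} f = grow (f ∘ (false ∷_)) , grow (f ∘ (true ∷_))

get-grow : (f : Vec Bool ρ → A) (p : Vec Bool ρ) → get (grow f) p ≡ f p
get-grow f []          = refl
get-grow f (false ∷ p) = get-grow (f ∘ (false ∷_)) p
get-grow f (true ∷ p)  = get-grow (f ∘ (true ∷_)) p

∧-true : ∀ {a b} → a ∧ b ≡ true → a ≡ true × b ≡ true
∧-true {true} {true} _ = refl , refl

allPoints : ∀ ρ → (Vec Bool ρ → Bool) → Bool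
allPoints zero    f = f []
allPoints (suc ρ) f = allPoints ρ (f ∘ (false ∷_)) ∧ allPoints ρ (f ∘ (true ∷_))

allPoints⇒ : ∀ ρ f → allPoints ρ f ≡ true → ∀ p → f p ≡ true
allPoints⇒ zero    f h []          = h
allPoints⇒ (suc ρ) f h (false ∷ p) = allPoints⇒ ρ _ (proj₁ (∧-true h)) p
allPoints⇒ (suc ρ) f h (true ∷ p)  = allPoints⇒ ρ _ (proj₂ (∧-true {allPoints ρ (f ∘ (false ∷_))} h)) p

translate : Vec Bool ρ → Tree A ρ → Tree A ρ
translate []          T       = T
translate (false ∷ m) (S , T) = translate m S , translate m T
translate (true ∷ m)  (S , T) = translate m T , translate m S

get-translate : (m : Vec Bool ρ) (T : Tree A ρ) (p : Vec Bool ρ) → get (translate m T) p ≡ get T (p ⊕ m)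
get-translate []          T       []          = refl
get-translate (false ∷ m) (S , T) (false ∷ p) = get-translate m S p
get-translate (false ∷ m) (S , T) (true ∷ p)  = get-translate m T p
get-translate (true ∷ m)  (S , T) (false ∷ p) = get-translate m T p
get-translate (true ∷ m)  (S , T) (true ∷ p)  = get-translate m S p

-- Generators of the general linear group, acting on rows, on columns and on trees

data Op : ℕ → Set where
  swap  : Op (suc (suc ρ))
  shear : Vec Bool ρ → Op (suc ρ)
  under : Op ρ → Op (suc ρ)

actC : Op ρ → Vec Bool ρ → Vec Bool ρ
actC swap      (a ∷ b ∷ p) = b ∷ a ∷ p
actC (shear m) (h ∷ p)     = h ∷ (if h then p ⊕ m else p)
actC (under o) (h ∷ p)     = h ∷ actC o p

actT : Op ρ → Tree A ρ → Tree A ρ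
actT swap      ((S , T) , (U , V)) = (S , U) , (T , V)
actT (shear m) (S , T)             = S , translate m T
actT (under o) (S , T)             = actT o S , actT o T

addTo : Vec Bool ρ → Vec Bool n → Vec (Vec Bool n) ρ → Vec (Vec Bool n) ρ
addTo []      r []      = []
addTo (b ∷ m) r (s ∷ u) = (if b then s ⊕ r else s) ∷ addTo m r u

actR : Op ρ → Vec (Vec Bool n) ρ → Vec (Vec Bool n) ρ
actR swap      (r ∷ s ∷ u) = s ∷ r ∷ u
actR (shear m) (r ∷ u)     = r ∷ addTo m r u
actR (under o) (r ∷ u)     = r ∷ actR o u

actC-involutive : (o : Op ρ) (p : Vec Bool ρ) → actC o (actC o p) ≡ p
actC-involutive swap      (a ∷ b ∷ p)  = refl
actC-involutive (shear m) (false ∷ p)  = refl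
actC-involutive (shear m) (true ∷ p)   = cong (true ∷_)
  (trans (⊕-assoc p m m) (trans (cong (p ⊕_) (⊕-self m)) (⊕-identityʳ p)))
actC-involutive (under o) (h ∷ p)      = cong (h ∷_) (actC-involutive o p)

actC-𝟘 : (o : Op ρ) → actC o 𝟘 ≡ 𝟘
actC-𝟘 swap      = refl
actC-𝟘 (shear m) = refl
actC-𝟘 (under o) = cong (false ∷_) (actC-𝟘 o)

-- The multiplicity at `p` after the operation is the one at the preimage of `p`; this is `actC o p`
-- because each generator is an involution.
get-act : (o : Op ρ) (T : Tree A ρ) (p : Vec Bool ρ) → get (actT o T) p ≡ get T (actC o p)
get-act swap      ((S , T) , (U , V)) (false ∷ false ∷ p) = refl
get-act swap      ((S , T) , (U , V)) (false ∷ true ∷ p)  = refl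
get-act swap      ((S , T) , (U , V)) (true ∷ false ∷ p)  = refl
get-act swap      ((S , T) , (U , V)) (true ∷ true ∷ p)   = refl
get-act (shear m) (S , T) (false ∷ p) = refl
get-act (shear m) (S , T) (true ∷ p)  = get-translate m T p
get-act (under o) (S , T) (false ∷ p) = get-act o S p
get-act (under o) (S , T) (true ∷ p)  = get-act o T p

column-addTo : (m : Vec Bool ρ) (r : Vec Bool n) (u : Vec (Vec Bool n) ρ) (e : Fin n) →
  column (addTo m r u) e ≡ (if lookup r e then column u e ⊕ m else column u e)
column-addTo [] r [] e with lookup r e
... | true  = refl
... | false = refl
column-addTo (b ∷ m) r (s ∷ u) e = trans (cong₂ _∷_ (first b) (column-addTo m r u e)) (join (lookup r e))
  where
  first : ∀ b → lookup (if b then s ⊕ r else s) e ≡ lookup s e xor (lookup r e ∧ b)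
  first true  = trans (⊕-lookup s r e) (cong (lookup s e xor_) (sym (Bool.∧-identityʳ (lookup r e))))
  first false = sym (trans (cong (lookup s e xor_) (∧-zeroʳ (lookup r e))) (xor-identityʳ (lookup s e)))
  join : ∀ c → (lookup s e xor (c ∧ b)) ∷ (if c then column u e ⊕ m else column u e)
    ≡ (if c then (lookup s e ∷ column u e) ⊕ (b ∷ m) else lookup s e ∷ column u e)
  join true  = refl
  join false = cong (_∷ column u e) (xor-identityʳ (lookup s e))

column-act : (o : Op ρ) (u : Vec (Vec Bool n) ρ) (e : Fin n) → column (actR o u) e ≡ actC o (column u e)
column-act swap      (r ∷ s ∷ u) e = refl
column-act (shear m) (r ∷ u)     e = cong (lookup r e ∷_) (column-addTo m r u e)
column-act (under o) (r ∷ u)     e = cong (lookup r e ∷_) (column-act o u e)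

addTo-involutive : (m : Vec Bool ρ) (r : Vec Bool n) (u : Vec (Vec Bool n) ρ) → addTo m r (addTo m r u) ≡ u
addTo-involutive [] r [] = refl
addTo-involutive (true ∷ m) r (s ∷ u)  = cong₂ _∷_
  (trans (⊕-assoc s r r) (trans (cong (s ⊕_) (⊕-self r)) (⊕-identityʳ s))) (addTo-involutive m r u)
addTo-involutive (false ∷ m) r (s ∷ u) = cong (s ∷_) (addTo-involutive m r u)

actR-involutive : (o : Op ρ) (u : Vec (Vec Bool n) ρ) → actR o (actR o u) ≡ u
actR-involutive swap      (r ∷ s ∷ u) = refl
actR-involutive (shear m) (r ∷ u)     = cong (r ∷_) (addTo-involutive m r u)
actR-involutive (under o) (r ∷ u)     = cong (r ∷_) (actR-involutive o u)

KerV-addTo : (m : Vec Bool ρ) (r : Vec Bool n) (u : Vec (Vec Bool n) ρ) {y : Vec Bool n} →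
  r · y ≡ false → KerV u y → KerV (addTo m r u) y
KerV-addTo [] r [] p [] = []
KerV-addTo (true ∷ m)  r (s ∷ u) {y} p (q ∷ k) = trans (·-⊕ˡ s r y) (cong₂ _xor_ q p) ∷ KerV-addTo m r u p k
KerV-addTo (false ∷ m) r (s ∷ u) p (q ∷ k) = q ∷ KerV-addTo m r u p k

KerV-act : (o : Op ρ) (u : Vec (Vec Bool n) ρ) (y : Vec Bool n) → KerV u y → KerV (actR o u) y
KerV-act swap      (r ∷ s ∷ u) y (p ∷ q ∷ k) = q ∷ p ∷ k
KerV-act (shear m) (r ∷ u)     y (p ∷ k)     = p ∷ KerV-addTo m r u p k
KerV-act (under o) (r ∷ u)     y (p ∷ k)     = p ∷ KerV-act o u y k

KerV-act⁻ : (o : Op ρ) (u : Vec (Vec Bool n) ρ) (y : Vec Bool n) → KerV (actR o u) y → KerV u y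
KerV-act⁻ o u y k = subst (λ v → KerV v y) (actR-involutive o u) (KerV-act o (actR o u) y k)

act : {K : Vec Bool n → Set} {u : Vec (Vec Bool n) ρ} (o : Op ρ) → State K u → State K (actR o u)
act {u = u} o s = rebase s (KerV-act o u) (KerV-act⁻ o u)
  λ i eq → trans (column-act o u i) (trans (cong (actC o) eq) (actC-𝟘 o))

-- Multiplicities of the columns of a state

At : (Fin n → Bool) → Vec (Vec Bool n) ρ → Vec Bool ρ → Fin n → Set
At live u p e = live e ≡ true × column u e ≡ p

Lower Upper : (Fin n → Bool) → Vec (Vec Bool n) ρ → Tree Cap ρ → Set
Lower live u T = ∀ p → AtLeast (get T p) (At live u p)
Upper live u T = ∀ p → AtMost (get T p) (At live u p)

table : (live : Fin n → Bool) (u : Vec (Vec Bool n) ρ) → ∃ λ T → Lower live u T × Upper live u T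
table live u = grow (proj₁ ∘ count-at)
  , (λ p → subst (λ c → AtLeast c (At live u p)) (sym (get-grow (proj₁ ∘ count-at) p)) (proj₁ (proj₂ (count-at p))))
  , (λ p → subst (λ c → AtMost c (At live u p)) (sym (get-grow (proj₁ ∘ count-at) p)) (proj₂ (proj₂ (count-at p))))
  where
  count-at : ∀ p → ∃ λ c → AtLeast c (At live u p) × AtMost c (At live u p)
  count-at p = multiplicity λ e → (live e Bool.≟ true) ×-dec Vec.≡-dec Bool._≟_ (column u e) p

At-act : (o : Op ρ) (live : Fin n → Bool) (u : Vec (Vec Bool n) ρ) (p : Vec Bool ρ) {e : Fin n} →
  (At live u (actC o p) e → At live (actR o u) p e) × (At live (actR o u) p e → At live u (actC o p) e)
At-act o live u p {e} =
  (λ { (l , eq) → l , trans (column-act o u e) (trans (cong (actC o) eq) (actC-involutive o p)) }) ,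
  (λ { (l , eq) → l , trans (sym (actC-involutive o (column u e))) (cong (actC o) (trans (sym (column-act o u e)) eq)) })

Lower-act : ∀ (o : Op ρ) {live : Fin n → Bool} {u : Vec (Vec Bool n) ρ} {T} → Lower live u T → Lower live (actR o u) (actT o T)
Lower-act o {live} {u} {T} low p rewrite get-act o T p =
  AtLeast-map (get T (actC o p)) (proj₁ (At-act o live u p)) (low (actC o p))

Upper-act : ∀ (o : Op ρ) {live : Fin n → Bool} {u : Vec (Vec Bool n) ρ} {T} → Upper live u T → Upper live (actR o u) (actT o T)
Upper-act o {live} {u} {T} up p rewrite get-act o T p =
  AtMost-map (get T (actC o p)) (proj₂ (At-act o live u p)) (up (actC o p))

actsT : List (Op ρ) → Tree A ρ → Tree A ρ
actsT []       T = T
actsT (o ∷ os) T = actsT os (actT o T)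

actsR : List (Op ρ) → Vec (Vec Bool n) ρ → Vec (Vec Bool n) ρ
actsR []       u = u
actsR (o ∷ os) u = actsR os (actR o u)

acts : {K : Vec Bool n → Set} {u : Vec (Vec Bool n) ρ} (os : List (Op ρ)) (s : State K u) →
  ∃ λ (s′ : State K (actsR os u)) → State.live s′ ≡ State.live s × State.d s′ ≡ State.d s
acts []       s = s , refl , refl
acts (o ∷ os) s = acts os (act o s)

Lower-acts : ∀ (os : List (Op ρ)) {live : Fin n → Bool} {u : Vec (Vec Bool n) ρ} {T} →
  Lower live u T → Lower live (actsR os u) (actsT os T)
Lower-acts []       low = low
Lower-acts (o ∷ os) {u = u} {T} low = Lower-acts os (Lower-act o {u = u} {T} low)

Upper-acts : ∀ (os : List (Op ρ)) {live : Fin n → Bool} {u : Vec (Vec Bool n) ρ} {T} →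
  Upper live u T → Upper live (actsR os u) (actsT os T)
Upper-acts []       up = up
Upper-acts (o ∷ os) {u = u} {T} up = Upper-acts os (Upper-act o {u = u} {T} up)

-- Contraction of an element whose column is the first unit vector

zipTree : (A → A → A) → Tree A ρ → Tree A ρ → Tree A ρ
zipTree {ρ = zero}  f a b = f a b
zipTree {ρ = suc ρ} f (S , T) (U , V) = zipTree f S U , zipTree f T V

get-zip : (f : A → A → A) (S T : Tree A ρ) (p : Vec Bool ρ) → get (zipTree f S T) p ≡ f (get S p) (get T p)
get-zip f S T []          = refl
get-zip f (S , T) (U , V) (false ∷ p) = get-zip f S U p
get-zip f (S , T) (U , V) (true ∷ p)  = get-zip f T V p

-- Of at least two elements at least one is left, and possibly more. The result is only a lower
-- bound, which is why contraction transports `Lower` but not `Upper`.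
decrease : Cap → Cap
decrease many = one
decrease _    = none

decreaseAt𝟘 : Tree Cap ρ → Tree Cap ρ
decreaseAt𝟘 {ρ = zero}  c       = decrease c
decreaseAt𝟘 {ρ = suc ρ} (S , T) = decreaseAt𝟘 S , T

get-decreaseAt𝟘 : (T : Tree Cap ρ) (p : Vec Bool ρ) →
  (p ≡ 𝟘 × get (decreaseAt𝟘 T) p ≡ decrease (get T p)) ⊎ (p ≢ 𝟘 × get (decreaseAt𝟘 T) p ≡ get T p)
get-decreaseAt𝟘 c [] = inj₁ (refl , refl)
get-decreaseAt𝟘 (S , T) (true ∷ p) = inj₂ ((λ ()) , refl)
get-decreaseAt𝟘 (S , T) (false ∷ p) with get-decreaseAt𝟘 S p
... | inj₁ (refl , eq) = inj₁ (refl , eq)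
... | inj₂ (ne , eq)   = inj₂ ((ne ∘ cong Vec.tail) , eq)

-- Points that differ only in the first coordinate become equal, and the contracted element is taken
-- away from the point `true ∷ 𝟘`.
contractT : Tree Cap (suc ρ) → Tree Cap ρ
contractT (S , T) = zipTree _⊞_ S (decreaseAt𝟘 T)

contract-state : {K : Vec Bool n → Set} {w : Vec Bool n} {u : Vec (Vec Bool n) ρ} (s : State K (w ∷ u)) (T : Tree Cap (suc ρ)) →
  Lower (State.live s) (w ∷ u) T → one ≼ get (proj₂ T) 𝟘 ≡ true →
  ∃ λ (s′ : State K u) → Lower (State.live s′) u (contractT T)
contract-state {n} {K = K} {w} {u} s (S , T) low h = go (get T 𝟘) refl h (low (true ∷ 𝟘))
  where
  open State s
  kept : Fin n → Vec Bool _ → Fin n → Set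
  kept x p e = (live e ∧ not (δ x e)) ≡ true × column u e ≡ p
  keep : ∀ {x e p} → x ≢ e → live e ≡ true → column u e ≡ p → kept x p e
  keep x≢e le eq = cong₂ _∧_ le (cong not (δ-≢ x≢e)) , eq
  others : Fin n → Fin n → Set
  others x e = x ≢ e × At live (w ∷ u) (true ∷ 𝟘) e
  result : ∀ x → At live (w ∷ u) (true ∷ 𝟘) x →
    AtLeast (decrease (get T 𝟘)) (others x) →
    ∃ λ (s′ : State K u) → Lower (State.live s′) u (contractT (S , T))
  result x (lx , eq) rest = contract s x lx (cong Vec.head eq) (cong Vec.tail eq) , λ p →
    subst (λ c → AtLeast c (kept x p)) (sym (get-zip _⊞_ S (decreaseAt𝟘 T) p))
      (AtLeast-⊞ (get S p) (get (decreaseAt𝟘 T) p)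
        {P = At live (w ∷ u) (false ∷ p)} {Q = λ e → x ≢ e × At live (w ∷ u) (true ∷ p) e}
        (λ { (le , eq′) → keep {x} (λ { refl → true≢false (cong Vec.head eq) (cong Vec.head eq′) }) le (cong Vec.tail eq′) })
        (λ { (ne , le , eq′) → keep {x} ne le (cong Vec.tail eq′) })
        (λ { (_ , eq₁) (_ , _ , eq₂) → true≢false (cong Vec.head eq₂) (cong Vec.head eq₁) })
        (low (false ∷ p)) (second p))
    where
    second : ∀ p → AtLeast (get (decreaseAt𝟘 T) p) (λ e → x ≢ e × At live (w ∷ u) (true ∷ p) e)
    second p with get-decreaseAt𝟘 T p
    ... | inj₁ (refl , eq′) = subst (λ c → AtLeast c _) (sym eq′) rest
    ... | inj₂ (ne , eq′) = subst (λ c → AtLeast c _) (sym eq′)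
      (AtLeast-map (get T p) (λ { (le , c) → (λ { refl → ne (cong Vec.tail (trans (sym c) eq)) }) , le , c }) (low (true ∷ p)))
  go : ∀ c → get T 𝟘 ≡ c → one ≼ c ≡ true → AtLeast c (At live (w ∷ u) (true ∷ 𝟘)) →
    ∃ λ (s′ : State K u) → Lower (State.live s′) u (contractT (S , T))
  go one  eq _ (x , at) = result x at (subst (λ c → AtLeast (decrease c) (others x)) (sym eq) tt)
  go many eq _ (x , y , ne , at , at′) = result x at (subst (λ c → AtLeast (decrease c) (others x)) (sym eq) (y , ne , at′))
  go none eq ()

-- Appending the row `S` to a matrix intersects its kernel with the orthogonal complement of `S`.
-- Thus `Good` means that every splitting is graphic, for sets of all sizes at once.
QMinor Good : (Vec Bool n → Set) → Set
QMinor K = ∃ λ i → MinorVec K (Even (Q i))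
Good K = ∀ S → SparseKernel (λ y → K y × S · y ≡ false)

-- Reference matrices: the elements marked second are the second ones with their column

record Reference : Set where
  field
    {rank width} : ℕ
    rows     : Vec (Vec Bool width) rank
    second   : Vec Bool width
    distinct : ∀ i j → column rows i ≡ column rows j → lookup second i ≡ lookup second j → i ≡ j

allFin : ∀ k → (Fin k → Bool) → Bool
allFin zero    f = true
allFin (suc k) f = f zero ∧ allFin k (f ∘ suc)

allFin⇒ : ∀ k f → allFin k f ≡ true → ∀ i → f i ≡ true
allFin⇒ (suc k) f h zero    = proj₁ (∧-true h)
allFin⇒ (suc k) f h (suc i) = allFin⇒ k _ (proj₂ (∧-true {f zero} h)) i

module _ (M : Reference) where
  open Reference M

  present : Tree Cap rank → Bool
  present T = allFin width λ i → (if lookup second i then many else one) ≼ get T (column rows i)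

  private
    -- Of the two elements guaranteed by `many`, one serves the first and the other the second
    -- member of a parallel pair of the reference.
    pick : ∀ c {P : Fin n → Set} b → (if b then many else one) ≼ c ≡ true → AtLeast c P → ∃ P
    pick one  false h (e , p) = e , p
    pick many false h (e , f , ne , p , q) = e , p
    pick many true  h (e , f , ne , p , q) = f , q

    pick-distinct : ∀ c {P : Fin n → Set} h h′ (a : AtLeast c P) →
      proj₁ (pick c {P} false h a) ≢ proj₁ (pick c {P} true h′ a)
    pick-distinct many h h′ (e , f , ne , p , q) = ne

  present⇒minor : {K : Vec Bool n → Set} {u : Vec (Vec Bool n) rank} (s : State K u) (T : Tree Cap rank) →
    Lower (State.live s) u T → present T ≡ true → MinorVec K (KerV rows)
  present⇒minor {n} {K} {u} s T low h = State⇒MinorVec s rows f f-inj (proj₁ ∘ at) (proj₂ ∘ at)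
    where
    ok : ∀ i → (if lookup second i then many else one) ≼ get T (column rows i) ≡ true
    ok = allFin⇒ width _ h
    choose : ∀ p b → (if b then many else one) ≼ get T p ≡ true → ∃ (At (State.live s) u p)
    choose p b ok = pick (get T p) b ok (low p)
    f : Fin width → Fin n
    f i = proj₁ (choose (column rows i) (lookup second i) (ok i))
    at : ∀ i → At (State.live s) u (column rows i) (f i)
    at i = proj₂ (choose (column rows i) (lookup second i) (ok i))
    clash : ∀ p q b c ok ok′ → p ≡ q → proj₁ (choose p b ok) ≡ proj₁ (choose q c ok′) → b ≡ c
    clash p .p false false ok ok′ refl eq = refl
    clash p .p true  true  ok ok′ refl eq = refl
    clash p .p false true  ok ok′ refl eq = ⊥-elim (pick-distinct (get T p) ok ok′ (low p) eq)
    clash p .p true  false ok ok′ refl eq = ⊥-elim (pick-distinct (get T p) ok′ ok (low p) (sym eq))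
    f-inj : ∀ i j → f i ≡ f j → i ≡ j
    f-inj i j eq = distinct i j same (clash _ _ _ _ (ok i) (ok j) same eq)
      where
      same : column rows i ≡ column rows j
      same = trans (sym (proj₂ (at i))) (trans (cong (column u) eq) (proj₂ (at j)))

-- Minor certificates: row operations and contractions

infixr 5 _»_
data Certificate : ℕ → ℕ → Set where
  stop : Certificate ρ ρ
  _»_  : List (Op ρ) → Certificate ρ σ → Certificate ρ σ
  con  : Certificate ρ σ → Certificate (suc ρ) σ

leadsTo : Certificate ρ σ → (Tree Cap σ → Bool) → Tree Cap ρ → Bool
leadsTo stop     f T = f T
leadsTo (os » c) f T = leadsTo c f (actsT os T)
leadsTo (con c)  f T = one ≼ get (proj₂ T) 𝟘 ∧ leadsTo c f (contractT T)

leadsTo⇒ : (c : Certificate ρ σ) (f : Tree Cap σ → Bool) {K : Vec Bool n → Set} {u : Vec (Vec Bool n) ρ} (s : State K u)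
  (T : Tree Cap ρ) → Lower (State.live s) u T → leadsTo c f T ≡ true →
  ∃ λ (v : Vec (Vec Bool n) σ) → ∃ λ (s′ : State K v) → ∃ λ T′ → Lower (State.live s′) v T′ × f T′ ≡ true
leadsTo⇒ stop f s T low h = _ , s , T , low , h
leadsTo⇒ (os » c) f {u = u} s T low h with acts os s
... | s′ , refl , _ = leadsTo⇒ c f s′ (actsT os T) (Lower-acts os {u = u} {T} low) h
leadsTo⇒ (con c) f {u = w ∷ u} s T low h with contract-state s T low (proj₁ (∧-true h))
... | s′ , low′ = leadsTo⇒ c f s′ (contractT T) low′ (proj₂ (∧-true {one ≼ get (proj₂ T) 𝟘} h))

-- Templates prescribe multiplicities; the points marked base or base₂ are the unit vectors.

data Spec : Set where
  absent single some double base base₂ : Spec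

isBase : Spec → Bool
isBase base  = true
isBase base₂ = true
isBase _     = false

Holds : Spec → (Fin n → Set) → Set
Holds absent P = AtMost none P
Holds single P = AtLeast one P × AtMost one P
Holds base   P = AtLeast one P × AtMost one P
Holds some   P = AtLeast one P
Holds double P = AtLeast many P
Holds base₂  P = AtLeast many P

fits : Spec → Cap → Bool
fits absent none = true
fits single one  = true
fits base   one  = true
fits some   one  = true
fits some   many = true
fits double many = true
fits base₂  many = true
fits _      _    = false

fits⇒Holds : ∀ sp c {P : Fin n → Set} → fits sp c ≡ true → AtLeast c P → AtMost c P → Holds sp P
fits⇒Holds absent none h lo hi = hi
fits⇒Holds single one  h lo hi = lo , hi
fits⇒Holds base   one  h lo hi = lo , hi
fits⇒Holds some   one  h lo hi = lo
fits⇒Holds some   many h (e , _ , _ , p , _) hi = e , p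
fits⇒Holds double many h lo hi = lo
fits⇒Holds base₂  many h lo hi = lo

-- The pair holds the capped multiplicities of the elements at a point on which a further functional
-- is 0 and 1, respectively. At a base point the functional is normalised to vanish on a chosen
-- element, so the first entry is not `none`; at the other points every distribution compatible with
-- the prescribed multiplicity is allowed.
splitOK : Spec → Cap × Cap → Bool
splitOK absent (none , none) = true
splitOK single (one , none)  = true
splitOK single (none , one)  = true
splitOK base   (one , none)  = true
splitOK some   (none , none) = false
splitOK some   (_ , _)       = true
splitOK double (a , b)       = many ≼ (a ⊞ b)
splitOK base₂  (a , b)       = one ≼ a ∧ many ≼ (a ⊞ b)
splitOK _      _             = false

module _ {P P₀ P₁ : Fin n → Set} (split : ∀ {e} → P e → P₀ e ⊎ P₁ e) (P₀⇒P : ∀ {e} → P₀ e → P e)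
  (P₁⇒P : ∀ {e} → P₁ e → P e) (disjoint : ∀ {e} → P₀ e → P₁ e → ⊥) where

  private
    none-impossible : ∀ {B : Set} → AtMost none P₀ → AtMost none P₁ → ∃ P → B
    none-impossible h₀ h₁ (e , p) = ⊥-elim ([ h₀ e , h₁ e ]′ (split p))

    nonempty : ∀ a → AtLeast (one ⊞ a) P₀ → ∃ P₀
    nonempty none (e , p) = e , p
    nonempty one  (e , _ , _ , p , _) = e , p
    nonempty many (e , _ , _ , p , _) = e , p

  Holds⇒splitOK : ∀ sp a b → Holds sp P → (isBase sp ≡ true → ∃ P₀) →
    AtLeast a P₀ → AtMost a P₀ → AtLeast b P₁ → AtMost b P₁ → splitOK sp (a , b) ≡ true
  Holds⇒splitOK absent none none hs _ la ha lb hb = refl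
  Holds⇒splitOK absent none one  hs _ la ha (e , p) hb = ⊥-elim (hs e (P₁⇒P p))
  Holds⇒splitOK absent none many hs _ la ha (e , _ , _ , p , _) hb = ⊥-elim (hs e (P₁⇒P p))
  Holds⇒splitOK absent one  b hs _ (e , p) ha lb hb = ⊥-elim (hs e (P₀⇒P p))
  Holds⇒splitOK absent many b hs _ (e , _ , _ , p , _) ha lb hb = ⊥-elim (hs e (P₀⇒P p))
  Holds⇒splitOK single none none hs _ la ha lb hb = none-impossible ha hb (proj₁ hs)
  Holds⇒splitOK single none one  hs _ la ha lb hb = refl
  Holds⇒splitOK single one  none hs _ la ha lb hb = refl
  Holds⇒splitOK single one  one  (_ , uniq) _ (e , p) ha (f , q) hb with refl ← uniq e f (P₀⇒P p) (P₁⇒P q) = ⊥-elim (disjoint p q)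
  Holds⇒splitOK single none many (_ , uniq) _ la ha (e , f , ne , p , q) hb = ⊥-elim (ne (uniq e f (P₁⇒P p) (P₁⇒P q)))
  Holds⇒splitOK single one  many (_ , uniq) _ la ha (e , f , ne , p , q) hb = ⊥-elim (ne (uniq e f (P₁⇒P p) (P₁⇒P q)))
  Holds⇒splitOK single many b (_ , uniq) _ (e , f , ne , p , q) ha lb hb = ⊥-elim (ne (uniq e f (P₀⇒P p) (P₀⇒P q)))
  Holds⇒splitOK base none b hs ex la ha lb hb = ⊥-elim (ha _ (proj₂ (ex refl)))
  Holds⇒splitOK base one none hs ex la ha lb hb = refl
  Holds⇒splitOK base one one  (_ , uniq) ex (e , p) ha (f , q) hb with refl ← uniq e f (P₀⇒P p) (P₁⇒P q) = ⊥-elim (disjoint p q)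
  Holds⇒splitOK base one many (_ , uniq) ex la ha (e , f , ne , p , q) hb = ⊥-elim (ne (uniq e f (P₁⇒P p) (P₁⇒P q)))
  Holds⇒splitOK base many b (_ , uniq) ex (e , f , ne , p , q) ha lb hb = ⊥-elim (ne (uniq e f (P₀⇒P p) (P₀⇒P q)))
  Holds⇒splitOK some none none hs _ la ha lb hb = none-impossible ha hb hs
  Holds⇒splitOK some none one  hs _ la ha lb hb = refl
  Holds⇒splitOK some none many hs _ la ha lb hb = refl
  Holds⇒splitOK some one  b    hs _ la ha lb hb = refl
  Holds⇒splitOK some many b    hs _ la ha lb hb = refl
  Holds⇒splitOK double none none (e , _ , _ , p , _) _ la ha lb hb = none-impossible ha hb (e , p)
  Holds⇒splitOK double none one (e , f , ne , p , q) _ la ha lb uniq with split p | split q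
  ... | inj₁ p₀ | _ = ⊥-elim (ha e p₀)
  ... | _ | inj₁ q₀ = ⊥-elim (ha f q₀)
  ... | inj₂ p₁ | inj₂ q₁ = ⊥-elim (ne (uniq e f p₁ q₁))
  Holds⇒splitOK double none many hs _ la ha lb hb = refl
  Holds⇒splitOK double one none (e , f , ne , p , q) _ la uniq lb hb with split p | split q
  ... | inj₂ p₁ | _ = ⊥-elim (hb e p₁)
  ... | _ | inj₂ q₁ = ⊥-elim (hb f q₁)
  ... | inj₁ p₀ | inj₁ q₀ = ⊥-elim (ne (uniq e f p₀ q₀))
  Holds⇒splitOK double one one  hs _ la ha lb hb = refl
  Holds⇒splitOK double one many hs _ la ha lb hb = refl
  Holds⇒splitOK double many b   hs _ la ha lb hb = refl
  Holds⇒splitOK base₂ none b hs ex la ha lb hb = ⊥-elim (ha _ (proj₂ (ex refl)))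
  Holds⇒splitOK base₂ one none (e , f , ne , p , q) ex la uniq lb hb with split p | split q
  ... | inj₂ p₁ | _ = ⊥-elim (hb e p₁)
  ... | _ | inj₂ q₁ = ⊥-elim (hb f q₁)
  ... | inj₁ p₀ | inj₁ q₀ = ⊥-elim (ne (uniq e f p₀ q₀))
  Holds⇒splitOK base₂ one one  hs ex la ha lb hb = refl
  Holds⇒splitOK base₂ one many hs ex la ha lb hb = refl
  Holds⇒splitOK base₂ many b   hs ex la ha lb hb = refl

-- Exhaustive checks over all trees with prescribed sets of values

every : List A → (A → Bool) → Bool
every []       f = true
every (x ∷ xs) f = f x ∧ every xs f

every⇒ : ∀ (xs : List A) f → every xs f ≡ true → ∀ {x} → x ∈ₗ xs → f x ≡ true
every⇒ (x ∷ xs) f h (Anyₗ.here refl) = proj₁ (∧-true h)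
every⇒ (x ∷ xs) f h (Anyₗ.there x∈) = every⇒ xs f (proj₂ (∧-true {f x} h)) x∈

everyTree : ∀ ρ → Tree (List A) ρ → (Tree A ρ → Bool) → Bool
everyTree zero    L f = every L f
everyTree (suc ρ) (L , M) f = everyTree ρ L λ S → everyTree ρ M λ T → f (S , T)

everyTree⇒ : ∀ ρ (L : Tree (List A) ρ) f → everyTree ρ L f ≡ true → ∀ T → (∀ (p : Vec Bool ρ) → get T p ∈ₗ get L p) → f T ≡ true
everyTree⇒ zero    L f h T T∈ = every⇒ L f h (T∈ [])
everyTree⇒ (suc ρ) (L , M) f h (S , T) T∈ =
  everyTree⇒ ρ M _ (everyTree⇒ ρ L _ h S (T∈ ∘ (false ∷_))) T (T∈ ∘ (true ∷_))

mapTree : ∀ {B : Set} ρ → (A → B) → Tree A ρ → Tree B ρ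
mapTree zero    f a       = f a
mapTree (suc ρ) f (S , T) = mapTree ρ f S , mapTree ρ f T

get-map : ∀ {B : Set} (f : A → B) (T : Tree A ρ) (p : Vec Bool ρ) → get (mapTree ρ f T) p ≡ f (get T p)
get-map f T []          = refl
get-map f (S , T) (false ∷ p) = get-map f S p
get-map f (S , T) (true ∷ p)  = get-map f T p

get-ext : ∀ ρ (S T : Tree A ρ) → (∀ (p : Vec Bool ρ) → get S p ≡ get T p) → S ≡ T
get-ext zero    a b h = h []
get-ext (suc ρ) (S , T) (U , V) h = cong₂ _,_ (get-ext ρ S U (h ∘ (false ∷_))) (get-ext ρ T V (h ∘ (true ∷_)))

caps : List Cap
caps = none ∷ one ∷ many ∷ []

∈caps : ∀ c → c ∈ₗ caps
∈caps none = Anyₗ.here refl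
∈caps one  = Anyₗ.there (Anyₗ.here refl)
∈caps many = Anyₗ.there (Anyₗ.there (Anyₗ.here refl))

splits : Spec → List (Cap × Cap)
splits sp = List.filter (λ c → splitOK sp c Bool.≟ true) (List.cartesianProduct caps caps)

everySplit : ∀ ρ → Tree Spec ρ → (Tree Cap (suc ρ) → Bool) → Bool
everySplit ρ D f = everyTree ρ (mapTree ρ splits D) λ T → f (mapTree ρ proj₁ T , mapTree ρ proj₂ T)

everySplit⇒ : ∀ ρ D f → everySplit ρ D f ≡ true → ∀ S T →
  (∀ (p : Vec Bool ρ) → splitOK (get D p) (get S p , get T p) ≡ true) → f (S , T) ≡ true
everySplit⇒ ρ D f h S T ok = subst (λ U → f U ≡ true)
  (cong₂ _,_ (get-ext ρ _ S λ p → trans (get-map proj₁ both p) (cong proj₁ (get-grow pair p)))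
             (get-ext ρ _ T λ p → trans (get-map proj₂ both p) (cong proj₂ (get-grow pair p))))
  (everyTree⇒ ρ (mapTree ρ splits D) _ h both λ p →
    subst₂ _∈ₗ_ (sym (get-grow pair p)) (sym (get-map splits D p))
      (Mem.∈-filter⁺ (λ c → splitOK (get D p) c Bool.≟ true)
        (Mem.∈-cartesianProduct⁺ (∈caps (get S p)) (∈caps (get T p))) (ok p)))
  where
  pair : Vec Bool ρ → Cap × Cap
  pair p = get S p , get T p
  both : Tree (Cap × Cap) ρ
  both = grow pair

-- The vector with binary digits m, least significant first
bits : ∀ ρ → ℕ → Vec Bool ρ
bits zero    m = []
bits (suc ρ) m = (m ℕ.% 2 ℕ.≡ᵇ 1) ∷ bits ρ (m ℕ./ 2)

-- Moves coordinate j to the front, respectively the first coordinate to the end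
front : ℕ → List (Op (suc ρ))
front {zero}  j       = []
front {suc ρ} zero    = []
front {suc ρ} (suc j) = List.map under (front j) ++ swap ∷ []

back : List (Op (suc ρ))
back {zero}  = []
back {suc ρ} = swap ∷ List.map under back

pivotAt : ℕ → ℕ → List (Op (suc ρ))
pivotAt {ρ} j m = front j ++ shear (bits ρ m) ∷ []

basis : List (ℕ × ℕ) → List (Op ρ)
basis {zero}  _              = []
basis {suc ρ} []             = []
basis {suc ρ} ((j , m) ∷ ps) = (pivotAt j m ++ back) ++ basis ps

certificate : Vec (ℕ × ℕ) k → List (ℕ × ℕ) → Certificate (k + σ) σ
certificate []             ps = basis ps » stop
certificate ((j , m) ∷ cs) ps = pivotAt j m » con (certificate cs ps)

secondCopies : Vec (Vec Bool k) ρ → Vec Bool k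
secondCopies B = tabulate λ i → Relation.Nullary.does (any? λ j →
  (j Fin.<? i) ×-dec Vec.≡-dec Bool._≟_ (column B j) (column B i))

distinct? : (B : Vec (Vec Bool k) ρ) (s : Vec Bool k) →
  Dec (∀ i j → column B i ≡ column B j → lookup s i ≡ lookup s j → i ≡ j)
distinct? B s = Fin.all? λ i → Fin.all? λ j →
  Vec.≡-dec Bool._≟_ (column B i) (column B j) →-dec (lookup s i Bool.≟ lookup s j) →-dec (i ≟ j)

reference-of : (B : Vec (Vec Bool k) ρ) {d : True (distinct? B (secondCopies B))} → Reference
reference-of B {d} = record { rows = B ; second = secondCopies B ; distinct = toWitness d }

starsBut0 : (v e : ℕ) (es : Vec (Fin (suc v) × Fin (suc v)) e) → Vec (Vec Bool e) v
starsBut0 v e es = tabulate λ i → star (mkG (suc v) e es) (suc i)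

data RefName : Set where
  q₁ q₂ q₃ q₄ q₆ f₇ f₇* k₃₃ : RefName

-- Column `i` is the binary expansion of `i + 1`, so that all seven nonzero points occur.
F₇-rows : Vec (Vec Bool 7) 3
F₇-rows = bits 7 120 ∷ bits 7 102 ∷ bits 7 85 ∷ []

-- A unit matrix followed by the columns 1110, 1101 and 1011. The kernel is the simplex code, all of
-- whose nonzero members have weight 4.
F₇*-rows : Vec (Vec Bool 7) 4
F₇*-rows = bits 7 113 ∷ bits 7 50 ∷ bits 7 84 ∷ bits 7 104 ∷ []

K₃₃-rows : Vec (Vec Bool 9) 5
K₃₃-rows = starsBut0 5 9
  ((# 0 , # 3) ∷ (# 0 , # 4) ∷ (# 0 , # 5) ∷ (# 1 , # 3) ∷ (# 1 , # 4) ∷ (# 1 , # 5) ∷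
   (# 2 , # 3) ∷ (# 2 , # 4) ∷ (# 2 , # 5) ∷ [])

ref : RefName → Reference
ref q₁  = reference-of (starsBut0 _ _ (ends Q₁))
ref q₂  = reference-of (starsBut0 _ _ (ends Q₂))
ref q₃  = reference-of (starsBut0 _ _ (ends Q₃))
ref q₄  = reference-of (starsBut0 _ _ (ends Q₄))
ref q₆  = reference-of (starsBut0 _ _ (ends Q₆))
ref f₇  = reference-of F₇-rows
ref f₇* = reference-of F₇*-rows
ref k₃₃ = reference-of K₃₃-rows

MinorVec-map : {K : Vec Bool n → Set} {N N′ : Vec Bool m → Set} → (∀ z → N z → N′ z) → (∀ z → N′ z → N z) →
  MinorVec K N → MinorVec K N′
MinorVec-map N⇒ N⇐ minor = record
  { f = f ; inj = inj ; G = G ; f∉G = f∉G ; lift = λ Y → lift Y ∘ N⇐ Y ; drop = λ y k s → N⇒ _ (drop y k s) ; indep = indep }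
  where
  open MinorVec minor

starsBut0⇒Even : (v e : ℕ) (es : Vec (Fin (suc v) × Fin (suc v)) e) →
  star (mkG (suc v) e es) zero ≡ ⨁ (Vec.toList (starsBut0 v e es)) → ∀ z → KerV (starsBut0 v e es) z → Even (mkG (suc v) e es) z
starsBut0⇒Even v e es eq z k zero    = trans (cong (_· z) eq) (Ker-⨁ (Vec.toList (starsBut0 v e es)) k)
starsBut0⇒Even v e es eq z k (suc i) = go (λ i → star (mkG (suc v) e es) (suc i)) k i
  where
  go : ∀ {v} (F : Fin v → Vec Bool e) → KerV (tabulate F) z → ∀ i → F i · z ≡ false
  go F (p ∷ k) zero    = p
  go F (p ∷ k) (suc i) = go (F ∘ suc) k i

Even⇒starsBut0 : (v e : ℕ) (es : Vec (Fin (suc v) × Fin (suc v)) e) → ∀ z → Even (mkG (suc v) e es) z → KerV (starsBut0 v e es) z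
Even⇒starsBut0 v e es z even = go (λ i → star (mkG (suc v) e es) (suc i)) (even ∘ suc)
  where
  go : ∀ {v} (F : Fin v → Vec Bool e) → (∀ i → F i · z ≡ false) → KerV (tabulate F) z
  go {zero}  F h = []
  go {suc v} F h = h zero ∷ go (F ∘ suc) (h ∘ suc)

-- Decision procedures for the hypotheses of NotCographic

zero? : Vec Bool n → Bool
zero? []      = true
zero? (b ∷ x) = not b ∧ zero? x

zero?⇒ : (x : Vec Bool n) → zero? x ≡ true → x ≡ 𝟘
zero?⇒ []          h = refl
zero?⇒ (false ∷ x) h = cong (false ∷_) (zero?⇒ x h)

⇒zero? : ∀ n → zero? (𝟘 {n}) ≡ true
⇒zero? zero    = refl
⇒zero? (suc n) = ⇒zero? n

kernel? : Vec (Vec Bool n) ρ → Vec Bool n → Bool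
kernel? []      y = true
kernel? (r ∷ u) y = not (r · y) ∧ kernel? u y

not-true : ∀ {b} → not b ≡ true → b ≡ false
not-true {false} _ = refl

kernel?⇒ : (u : Vec (Vec Bool n) ρ) (y : Vec Bool n) → kernel? u y ≡ true → KerV u y
kernel?⇒ []      y h = []
kernel?⇒ (r ∷ u) y h = not-true (proj₁ (∧-true h)) ∷ kernel?⇒ u y (proj₂ (∧-true {not (r · y)} h))

⇒kernel? : (u : Vec (Vec Bool n) ρ) (y : Vec Bool n) → KerV u y → kernel? u y ≡ true
⇒kernel? []      y []      = refl
⇒kernel? (r ∷ u) y (p ∷ k) = cong₂ _∧_ (cong not p) (⇒kernel? u y k)

infixr 5 _⊃_
_⊃_ : Bool → Bool → Bool
a ⊃ b = not a ∨ b

⊃-elim : ∀ {a b} → a ⊃ b ≡ true → a ≡ true → b ≡ true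
⊃-elim {true} h refl = h

allFin-intro : ∀ k f → (∀ i → f i ≡ true) → allFin k f ≡ true
allFin-intro zero    f h = refl
allFin-intro (suc k) f h = cong₂ _∧_ (h zero) (allFin-intro k (f ∘ suc) (h ∘ suc))

notCographic : (u : Vec (Vec Bool k) ρ) (B : Vec (Vec Bool k) σ) (g : ℕ) →
  allFin σ (λ j → kernel? u (lookup B j)) ≡ true →
  allPoints σ (λ x → allFin k (λ i → not (column B i · x)) ⊃ zero? x) ≡ true →
  allFin k (λ i → not (zero? (column B i))) ≡ true →
  allPoints k (λ z → kernel? u z ⊃ zero? z ∨ (g ℕ.≤ᵇ ∣ z ∣)) ≡ true →
  k + k < suc σ * g → 0 < σ → {K : Vec Bool n → Set} → CutSpace K → ¬ MinorVec K (KerV u)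
notCographic {k = k} {σ = σ} u B g inside indep coloop girth large pos cut minor = NotCographic.contradictory cut minor g B
  (λ j → kernel?⇒ u (lookup B j) (allFin⇒ σ _ inside j))
  (λ x h → zero?⇒ x (⊃-elim (allPoints⇒ σ _ indep x) (allFin-intro k _ λ i → cong not (h i))))
  (λ i eq → true≢false (trans (cong zero? eq) (⇒zero? σ)) (not-true (allFin⇒ k _ coloop i)))
  (λ z kz z≢𝟘 → bound z (⊃-elim (allPoints⇒ k _ girth z) (⇒kernel? u z kz)) z≢𝟘) large pos
  where
  bound : ∀ z → zero? z ∨ (g ℕ.≤ᵇ ∣ z ∣) ≡ true → z ≢ 𝟘 → g ≤ ∣ z ∣
  bound z h z≢𝟘 with zero? z in eq
  ... | true  = ⊥-elim (z≢𝟘 (zero?⇒ z eq))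
  ... | false = ℕ.≤ᵇ⇒≤ g ∣ z ∣ (subst Bool.T (sym h) tt)

conclude : {K : Vec Bool n → Set} → CutSpace K → ∀ r → MinorVec K (KerV (Reference.rows (ref r))) → QMinor K
conclude cut q₁ minor = # 0 , MinorVec-map (starsBut0⇒Even _ _ (ends Q₁) refl) (Even⇒starsBut0 _ _ (ends Q₁)) minor
conclude cut q₂ minor = # 1 , MinorVec-map (starsBut0⇒Even _ _ (ends Q₂) refl) (Even⇒starsBut0 _ _ (ends Q₂)) minor
conclude cut q₃ minor = # 2 , MinorVec-map (starsBut0⇒Even _ _ (ends Q₃) refl) (Even⇒starsBut0 _ _ (ends Q₃)) minor
conclude cut q₄ minor = # 3 , MinorVec-map (starsBut0⇒Even _ _ (ends Q₄) refl) (Even⇒starsBut0 _ _ (ends Q₄)) minor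
conclude cut q₆ minor = # 5 , MinorVec-map (starsBut0⇒Even _ _ (ends Q₆) refl) (Even⇒starsBut0 _ _ (ends Q₆)) minor
-- The degree count with nullity and girth: 2 · 7 < 5 · 3 for F₇, and in the next two cases 2 · 7 <
-- 4 · 4 for F₇* and 2 · 9 < 5 · 4 for K₃₃.
conclude cut f₇ minor = ⊥-elim (notCographic F₇-rows F₇-kernel 3 refl refl refl refl (ℕ.m≤m+n 15 0) (s≤s z≤n) cut minor)
  where
  F₇-kernel : Vec (Vec Bool 7) 4
  F₇-kernel = bits 7 7 ∷ bits 7 25 ∷ bits 7 42 ∷ bits 7 75 ∷ []
conclude cut f₇* minor = ⊥-elim (notCographic F₇*-rows F₇*-kernel 4 refl refl refl refl (ℕ.m≤m+n 15 1) (s≤s z≤n) cut minor)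
  where
  F₇*-kernel : Vec (Vec Bool 7) 3
  F₇*-kernel = bits 7 23 ∷ bits 7 43 ∷ bits 7 77 ∷ []
conclude cut k₃₃ minor = ⊥-elim (notCographic K₃₃-rows K₃₃-kernel 4 refl refl refl refl (ℕ.m≤m+n 19 1) (s≤s z≤n) cut minor)
  where
  -- The four cycles of length 4 through the edge `# 0 , # 3`; they form a basis of the cycle space.
  K₃₃-kernel : Vec (Vec Bool 9) 4
  K₃₃-kernel = bits 9 27 ∷ bits 9 45 ∷ bits 9 195 ∷ bits 9 325 ∷ []

-- The templates: K₃ with doubled edges, K₄ with a fat triangle, the wheel W₄ with two fat spokes, and K₅ minus an
-- edge with a fat triangle, where fat edges may be replaced by parallel classes

data Name : Set where
  doubledK₃ k₄ w₄ k₅∖e : Name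

rankOf : Name → ℕ
rankOf doubledK₃ = 2
rankOf k₄        = 3
rankOf w₄        = 4
rankOf k₅∖e      = 4

code : Vec Bool ρ → ℕ
code []      = 0
code (b ∷ p) = (if b then 1 else 0) + 2 * code p

specAt : List (ℕ × Spec) → ℕ → Spec
specAt []             c = absent
specAt ((d , s) ∷ ds) c = if c ℕ.≡ᵇ d then s else specAt ds c

points : Name → List (ℕ × Spec)
points doubledK₃ = (1 , base₂) ∷ (2 , base₂) ∷ (3 , double) ∷ []
points k₄ = (1 , base) ∷ (2 , base) ∷ (4 , base) ∷ (3 , some) ∷ (5 , some) ∷ (6 , some) ∷ []
points w₄ = (1 , base) ∷ (2 , base) ∷ (4 , base) ∷ (8 , base) ∷
  (7 , single) ∷ (13 , single) ∷ (3 , some) ∷ (15 , some) ∷ []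
points k₅∖e = (1 , base) ∷ (2 , base) ∷ (4 , base) ∷ (8 , base) ∷
  (11 , single) ∷ (13 , single) ∷ (3 , some) ∷ (5 , some) ∷ (6 , some) ∷ []

spec : (t : Name) → Tree Spec (rankOf t)
spec t = grow (specAt (points t) ∘ code)

-- The outcomes listed below were found by a computer search. A pair (j , m) stands for a pivot: coordinate j is
-- moved to the front and added to the coordinates in m; it is then contracted or moved to the end.
data Outcome : ℕ → Set where
  template  : (t : Name) → List (ℕ × ℕ) → Outcome (rankOf t)
  reference : (r : RefName) → Vec (ℕ × ℕ) k → List (ℕ × ℕ) → Outcome (k + Reference.rank (ref r))

outcomes : (t : Name) → List (Outcome (suc (rankOf t)))
outcomes doubledK₃ =
    template k₄ ((2 , 0) ∷ (0 , 0) ∷ (0 , 2) ∷ [])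
  ∷ template k₄ ((2 , 0) ∷ (1 , 0) ∷ (0 , 0) ∷ [])
  ∷ template k₄ ((1 , 0) ∷ (0 , 0) ∷ (0 , 2) ∷ [])
  ∷ template k₄ ((2 , 0) ∷ (1 , 2) ∷ (0 , 0) ∷ [])
  ∷ template k₄ ((0 , 0) ∷ (1 , 2) ∷ (0 , 2) ∷ [])
  ∷ template k₄ ((0 , 0) ∷ (1 , 2) ∷ (0 , 1) ∷ [])
  ∷ template k₄ ((1 , 0) ∷ (1 , 2) ∷ (0 , 0) ∷ [])
  ∷ template k₄ ((0 , 0) ∷ (0 , 2) ∷ (0 , 2) ∷ [])
  ∷ reference f₇ ([]) ([])
  ∷ reference q₂ ([]) ((2 , 0) ∷ (1 , 2) ∷ (0 , 0) ∷ [])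
  ∷ reference q₂ ([]) ((0 , 1) ∷ (0 , 3) ∷ (0 , 2) ∷ [])
  ∷ reference q₂ ([]) ((1 , 0) ∷ (1 , 0) ∷ (0 , 0) ∷ [])
  ∷ reference q₂ ([]) ((0 , 2) ∷ (0 , 0) ∷ (0 , 1) ∷ [])
  ∷ reference q₄ ([]) ((1 , 0) ∷ (1 , 2) ∷ (0 , 2) ∷ [])
  ∷ reference q₄ ([]) ((1 , 2) ∷ (0 , 2) ∷ (0 , 0) ∷ [])
  ∷ reference q₄ ([]) ((1 , 0) ∷ (1 , 2) ∷ (0 , 1) ∷ [])
  ∷ reference q₄ ([]) ((2 , 0) ∷ (0 , 2) ∷ (0 , 0) ∷ [])
  ∷ reference q₄ ([]) ((0 , 2) ∷ (1 , 0) ∷ (0 , 2) ∷ [])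
  ∷ reference q₄ ([]) ((0 , 2) ∷ (1 , 0) ∷ (0 , 1) ∷ [])
  ∷ reference q₄ ([]) ((1 , 0) ∷ (0 , 3) ∷ (0 , 2) ∷ [])
  ∷ reference q₄ ([]) ((0 , 1) ∷ (0 , 0) ∷ (0 , 0) ∷ []) ∷ []
outcomes k₄ =
    template w₄ ((3 , 0) ∷ (1 , 0) ∷ (0 , 3) ∷ (0 , 5) ∷ [])
  ∷ template w₄ ((3 , 0) ∷ (1 , 4) ∷ (1 , 0) ∷ (0 , 0) ∷ [])
  ∷ template w₄ ((3 , 0) ∷ (1 , 0) ∷ (0 , 0) ∷ (0 , 5) ∷ [])
  ∷ template w₄ ((3 , 0) ∷ (1 , 4) ∷ (1 , 0) ∷ (0 , 5) ∷ [])
  ∷ template w₄ ((3 , 0) ∷ (2 , 0) ∷ (0 , 3) ∷ (0 , 5) ∷ [])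
  ∷ template w₄ ((3 , 0) ∷ (2 , 4) ∷ (1 , 0) ∷ (0 , 0) ∷ [])
  ∷ template w₄ ((2 , 0) ∷ (2 , 0) ∷ (0 , 3) ∷ (0 , 5) ∷ [])
  ∷ template k₅∖e ((3 , 0) ∷ (2 , 0) ∷ (1 , 0) ∷ (0 , 5) ∷ [])
  ∷ template w₄ ((2 , 0) ∷ (2 , 4) ∷ (1 , 0) ∷ (0 , 0) ∷ [])
  ∷ template w₄ ((3 , 0) ∷ (2 , 0) ∷ (0 , 0) ∷ (0 , 5) ∷ [])
  ∷ template w₄ ((2 , 0) ∷ (2 , 0) ∷ (0 , 0) ∷ (0 , 5) ∷ [])
  ∷ template k₅∖e ((3 , 0) ∷ (2 , 0) ∷ (1 , 0) ∷ (0 , 3) ∷ [])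
  ∷ template k₅∖e ((3 , 0) ∷ (2 , 0) ∷ (1 , 0) ∷ (0 , 0) ∷ [])
  ∷ template w₄ ((3 , 0) ∷ (2 , 4) ∷ (1 , 0) ∷ (0 , 5) ∷ [])
  ∷ template w₄ ((2 , 0) ∷ (2 , 4) ∷ (1 , 0) ∷ (0 , 5) ∷ [])
  ∷ reference q₁ ((0 , 5) ∷ []) ((1 , 2) ∷ (1 , 0) ∷ (0 , 2) ∷ [])
  ∷ reference q₁ ((0 , 6) ∷ []) ((1 , 0) ∷ (1 , 0) ∷ (0 , 0) ∷ [])
  ∷ reference f₇* ([]) ((0 , 6) ∷ (0 , 5) ∷ (0 , 0) ∷ (0 , 5) ∷ [])
  ∷ reference q₁ ((0 , 3) ∷ []) ((1 , 0) ∷ (0 , 0) ∷ (0 , 0) ∷ [])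
  ∷ reference q₄ ((1 , 0) ∷ []) ((1 , 2) ∷ (1 , 0) ∷ (0 , 1) ∷ [])
  ∷ reference q₄ ((3 , 0) ∷ []) ((1 , 2) ∷ (0 , 2) ∷ (0 , 1) ∷ [])
  ∷ reference q₄ ((2 , 0) ∷ []) ((2 , 0) ∷ (1 , 2) ∷ (0 , 2) ∷ [])
  ∷ reference q₄ ((3 , 0) ∷ []) ((1 , 2) ∷ (1 , 0) ∷ (0 , 1) ∷ [])
  ∷ reference q₄ ((2 , 0) ∷ []) ((1 , 2) ∷ (0 , 2) ∷ (0 , 1) ∷ [])
  ∷ reference q₄ ((3 , 0) ∷ []) ((1 , 2) ∷ (0 , 1) ∷ (0 , 0) ∷ [])
  ∷ reference q₄ ((1 , 0) ∷ []) ((1 , 0) ∷ (1 , 2) ∷ (0 , 1) ∷ [])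
  ∷ reference q₄ ((3 , 0) ∷ []) ((1 , 2) ∷ (0 , 3) ∷ (0 , 1) ∷ [])
  ∷ reference q₄ ((1 , 0) ∷ []) ((2 , 0) ∷ (1 , 2) ∷ (0 , 1) ∷ [])
  ∷ reference q₄ ((1 , 0) ∷ []) ((1 , 0) ∷ (0 , 3) ∷ (0 , 1) ∷ [])
  ∷ reference q₄ ((2 , 0) ∷ []) ((0 , 2) ∷ (1 , 0) ∷ (0 , 2) ∷ [])
  ∷ reference q₄ ((2 , 0) ∷ []) ((0 , 1) ∷ (0 , 1) ∷ (0 , 2) ∷ []) ∷ []
outcomes w₄ =
    reference f₇ ((1 , 0) ∷ (3 , 0) ∷ []) ([])
  ∷ reference q₁ ((4 , 0) ∷ (0 , 7) ∷ []) ((1 , 0) ∷ (0 , 0) ∷ (0 , 2) ∷ [])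
  ∷ reference f₇ ((0 , 13) ∷ (2 , 0) ∷ []) ([])
  ∷ reference q₁ ((3 , 0) ∷ (0 , 3) ∷ []) ((2 , 0) ∷ (0 , 0) ∷ (0 , 2) ∷ [])
  ∷ reference k₃₃ ([]) ((0 , 2) ∷ (0 , 10) ∷ (1 , 8) ∷ (0 , 2) ∷ (0 , 2) ∷ [])
  ∷ reference q₆ ([]) ((0 , 13) ∷ (0 , 6) ∷ (2 , 8) ∷ (0 , 0) ∷ (0 , 4) ∷ [])
  ∷ reference q₆ ([]) ((0 , 13) ∷ (3 , 8) ∷ (2 , 8) ∷ (1 , 0) ∷ (0 , 0) ∷ []) ∷ []
outcomes k₅∖e =
    reference f₇ ((4 , 0) ∷ (3 , 0) ∷ []) ([])
  ∷ reference q₁ ((1 , 10) ∷ (0 , 3) ∷ []) ((0 , 3) ∷ (1 , 0) ∷ (0 , 1) ∷ [])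
  ∷ reference f₇ ((4 , 0) ∷ (2 , 0) ∷ []) ([])
  ∷ reference q₁ ((0 , 3) ∷ (3 , 0) ∷ []) ((1 , 0) ∷ (0 , 0) ∷ (0 , 0) ∷ [])
  ∷ reference q₁ ((1 , 0) ∷ (1 , 0) ∷ []) ((0 , 1) ∷ (0 , 2) ∷ (0 , 2) ∷ [])
  ∷ reference q₁ ((0 , 5) ∷ (3 , 0) ∷ []) ((2 , 0) ∷ (0 , 2) ∷ (0 , 1) ∷ [])
  ∷ reference k₃₃ ([]) ((0 , 4) ∷ (0 , 12) ∷ (2 , 8) ∷ (0 , 2) ∷ (0 , 1) ∷ [])
  ∷ reference k₃₃ ([]) ((0 , 8) ∷ (0 , 4) ∷ (1 , 8) ∷ (0 , 4) ∷ (0 , 0) ∷ [])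
  ∷ reference f₇ ((2 , 0) ∷ (0 , 7) ∷ []) ([])
  ∷ reference k₃₃ ([]) ((0 , 2) ∷ (0 , 12) ∷ (2 , 8) ∷ (0 , 2) ∷ (0 , 1) ∷ []) ∷ []

-- Bases of the row space after a splitting in which all columns that occur have at most two ones.
-- All points possible after splitting `doubledK₃` lie in one K₄, and after splitting `k₄` in one
-- K₅, so there one basis serves for every split; the templates of rank 4 need several.
finishes : Name → List (List (ℕ × ℕ))
finishes doubledK₃ =
    ((2 , 0) ∷ (1 , 0) ∷ (0 , 3) ∷ []) ∷ []
finishes k₄ =
    ((3 , 0) ∷ (2 , 0) ∷ (1 , 0) ∷ (0 , 7) ∷ []) ∷ []
finishes w₄ =
    ((4 , 0) ∷ (3 , 0) ∷ (2 , 0) ∷ (1 , 4) ∷ (0 , 15) ∷ [])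
  ∷ ((4 , 0) ∷ (3 , 0) ∷ (1 , 8) ∷ (1 , 8) ∷ (0 , 2) ∷ [])
  ∷ ((4 , 0) ∷ (3 , 0) ∷ (1 , 8) ∷ (1 , 8) ∷ (0 , 11) ∷ [])
  ∷ ((4 , 0) ∷ (3 , 0) ∷ (2 , 0) ∷ (1 , 2) ∷ (0 , 15) ∷ [])
  ∷ ((4 , 0) ∷ (3 , 0) ∷ (2 , 4) ∷ (1 , 4) ∷ (0 , 15) ∷ [])
  ∷ ((4 , 0) ∷ (3 , 0) ∷ (2 , 4) ∷ (1 , 4) ∷ (0 , 13) ∷ [])
  ∷ ((4 , 0) ∷ (3 , 0) ∷ (2 , 4) ∷ (1 , 2) ∷ (0 , 14) ∷ [])
  ∷ ((4 , 0) ∷ (3 , 0) ∷ (1 , 4) ∷ (1 , 8) ∷ (0 , 3) ∷ [])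
  ∷ ((4 , 0) ∷ (3 , 0) ∷ (1 , 4) ∷ (1 , 8) ∷ (0 , 11) ∷ [])
  ∷ ((4 , 0) ∷ (3 , 0) ∷ (2 , 8) ∷ (1 , 0) ∷ (0 , 15) ∷ [])
  ∷ ((4 , 0) ∷ (3 , 0) ∷ (2 , 8) ∷ (1 , 8) ∷ (0 , 14) ∷ [])
  ∷ ((4 , 0) ∷ (3 , 0) ∷ (2 , 8) ∷ (1 , 8) ∷ (0 , 11) ∷ [])
  ∷ ((4 , 0) ∷ (3 , 0) ∷ (2 , 4) ∷ (1 , 8) ∷ (0 , 15) ∷ [])
  ∷ ((4 , 0) ∷ (3 , 0) ∷ (2 , 4) ∷ (1 , 8) ∷ (0 , 11) ∷ []) ∷ []
finishes k₅∖e =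
    ((4 , 0) ∷ (1 , 0) ∷ (2 , 8) ∷ (1 , 4) ∷ (0 , 12) ∷ [])
  ∷ ((4 , 0) ∷ (3 , 0) ∷ (2 , 8) ∷ (1 , 4) ∷ (0 , 12) ∷ [])
  ∷ ((4 , 0) ∷ (2 , 0) ∷ (2 , 8) ∷ (1 , 4) ∷ (0 , 12) ∷ [])
  ∷ ((4 , 0) ∷ (1 , 0) ∷ (0 , 10) ∷ (0 , 9) ∷ (0 , 8) ∷ [])
  ∷ ((4 , 0) ∷ (3 , 0) ∷ (0 , 14) ∷ (0 , 9) ∷ (0 , 8) ∷ [])
  ∷ ((4 , 0) ∷ (0 , 6) ∷ (0 , 9) ∷ (0 , 9) ∷ (0 , 8) ∷ []) ∷ []

entries₂ : List (Outcome 2)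
entries₂ =
    template doubledK₃ ((1 , 0) ∷ (0 , 0) ∷ [])
  ∷ reference q₃ ([]) ((1 , 0) ∷ (0 , 0) ∷ []) ∷ []

-- A loop gives Q₁ and the seventh point gives F₇. Of the edges of K₄, two opposite fat ones give Q₃
-- by contracting an edge of one of the parallel pairs, and three fat ones at a vertex give Q₄.
-- Otherwise the fat edges lie in one of the four triangles, and the basis is chosen so that this
-- triangle is the fat one of the template.
entries₃ : List (Outcome 3)
entries₃ =
    template k₄ ((2 , 0) ∷ (1 , 0) ∷ (0 , 0) ∷ [])
  ∷ template k₄ ((2 , 0) ∷ (1 , 2) ∷ (0 , 1) ∷ [])
  ∷ template k₄ ((1 , 0) ∷ (1 , 2) ∷ (0 , 1) ∷ [])
  ∷ template k₄ ((0 , 0) ∷ (1 , 2) ∷ (0 , 1) ∷ [])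
  ∷ reference f₇ ([]) ([])
  ∷ reference q₄ ([]) ((0 , 0) ∷ (1 , 2) ∷ (0 , 1) ∷ [])
  ∷ reference q₃ ((1 , 2) ∷ []) ((1 , 0) ∷ (0 , 0) ∷ [])
  ∷ reference q₃ ((1 , 0) ∷ []) ((1 , 0) ∷ (0 , 0) ∷ [])
  ∷ reference q₄ ([]) ((1 , 0) ∷ (1 , 2) ∷ (0 , 1) ∷ [])
  ∷ reference q₃ ((2 , 0) ∷ []) ((1 , 0) ∷ (0 , 0) ∷ [])
  ∷ reference q₄ ([]) ((2 , 0) ∷ (1 , 2) ∷ (0 , 1) ∷ [])
  ∷ reference q₄ ([]) ((2 , 0) ∷ (1 , 0) ∷ (0 , 0) ∷ [])
  ∷ reference q₁ ([]) ((2 , 0) ∷ (1 , 0) ∷ (0 , 0) ∷ []) ∷ []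

fitsTree : ∀ ρ → Tree Spec ρ → Tree Cap ρ → Bool
fitsTree zero    s c = fits s c
fitsTree (suc ρ) (D , E) (S , T) = fitsTree ρ D S ∧ fitsTree ρ E T

fitsTree⇒ : ∀ ρ D T → fitsTree ρ D T ≡ true → ∀ (p : Vec Bool ρ) → fits (get D p) (get T p) ≡ true
fitsTree⇒ zero    s c h [] = h
fitsTree⇒ (suc ρ) (D , E) (S , T) h (false ∷ p) = fitsTree⇒ ρ D S (proj₁ (∧-true h)) p
fitsTree⇒ (suc ρ) (D , E) (S , T) h (true ∷ p)  = fitsTree⇒ ρ E T (proj₂ (∧-true {fitsTree ρ D S} h)) p

resolves : Outcome ρ → Tree Cap ρ → Bool
resolves (template t ps)     T = fitsTree (rankOf t) (spec t) (actsT {ρ = rankOf t} (basis ps) T)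
resolves (reference r cs ps) T = leadsTo (certificate cs ps) (present (ref r)) T

some-resolves : List (Outcome ρ) → Tree Cap ρ → Bool
some-resolves []       T = false
some-resolves {ρ} (o ∷ os) T = resolves {ρ} o T ∨ some-resolves {ρ} os T

-- Multiplicities of the elements on which the row r + m · u is nonzero
masked : Vec Bool ρ → Bool → Tree Cap ρ → Tree Cap ρ → Tree Cap ρ
masked []      b S T = if b then S else T
masked (c ∷ m) b (S₀ , S₁) (T₀ , T₁) = masked m b S₀ T₀ , masked m (b xor c) S₁ T₁

totalCap : ∀ ρ → Tree Cap ρ → Cap
totalCap zero    c       = c
totalCap (suc ρ) (S , T) = totalCap ρ S ⊞ totalCap ρ T

-- If some row `r + m · u` has at most one nonzero entry, the element to be uncontracted is a coloop
-- or in series with that entry.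
series? : ∀ ρ → Tree Cap (suc ρ) → Bool
series? ρ (S , T) = not (allPoints ρ λ m → not (totalCap ρ (masked m false S T) ≼ one))

-- The uncontracted element gets the column `true ∷ 𝟘`. It is alone there, since templates have no
-- loops; hence exactly `one`.
set𝟘 : ∀ ρ → Tree Cap ρ → Tree Cap ρ
set𝟘 zero    _       = one
set𝟘 (suc ρ) (S , T) = set𝟘 ρ S , T

extension-check : Name → Bool
extension-check t = everySplit (rankOf t) (spec t) λ (S , T) →
  series? (rankOf t) (S , T) ∨ some-resolves {suc (rankOf t)} (outcomes t) (S , set𝟘 (rankOf t) T)

sparse? : ∀ ρ → Tree Cap ρ → Bool
sparse? ρ T = allPoints ρ λ p → get T p ≼ none ∨ (∣ p ∣ ℕ.≤ᵇ 2)

some-sparse : ∀ ρ → List (List (ℕ × ℕ)) → Tree Cap ρ → Bool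
some-sparse ρ []         T = false
some-sparse ρ (ps ∷ pss) T = sparse? ρ (actsT {ρ = ρ} (basis ps) T) ∨ some-sparse ρ pss T

splitting-check : Name → Bool
splitting-check t = everySplit (rankOf t) (spec t) (some-sparse (suc (rankOf t)) (finishes t))

extension-checked : ∀ t → extension-check t ≡ true
extension-checked doubledK₃ = refl
extension-checked k₄        = refl
extension-checked w₄        = refl
extension-checked k₅∖e      = refl

splitting-checked : ∀ t → splitting-check t ≡ true
splitting-checked doubledK₃ = refl
splitting-checked k₄        = refl
splitting-checked w₄        = refl
splitting-checked k₅∖e      = refl

-- Base points of the templates

anyFin : ∀ k → (Fin k → Bool) → Bool
anyFin zero    f = false
anyFin (suc k) f = f zero ∨ anyFin k (f ∘ suc)

∨-true : ∀ {a b} → a ∨ b ≡ true → a ≡ true ⊎ b ≡ true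
∨-true {true}  _ = inj₁ refl
∨-true {false} h = inj₂ h

anyFin⇒ : ∀ k f → anyFin k f ≡ true → ∃ λ i → f i ≡ true
anyFin⇒ (suc k) f h with ∨-true {f zero} h
... | inj₁ p = zero , p
... | inj₂ q with anyFin⇒ k (f ∘ suc) q
...   | i , p = suc i , p

¬allPoints⇒ : ∀ ρ f → allPoints ρ f ≡ false → ∃ λ p → f p ≡ false
¬allPoints⇒ zero    f h = [] , h
¬allPoints⇒ (suc ρ) f h with allPoints ρ (f ∘ (false ∷_)) in eq
... | false = let (p , q) = ¬allPoints⇒ ρ _ eq in false ∷ p , q
... | true  = let (p , q) = ¬allPoints⇒ ρ _ h in true ∷ p , q

-- Both directions matter: normalising a functional takes an element at each unit vector, and
-- `splitOK` relies on the functional being normalised at each base point.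
units-based : Name → Bool
units-based t = allFin (rankOf t) (λ i → isBase (get (spec t) ⁅ i ⁆))
  ∧ allPoints (rankOf t) (λ p → isBase (get (spec t) p) ⊃ anyFin (rankOf t) (λ i → zero? (p ⊕ ⁅ i ⁆)))

units-based-checked : ∀ t → units-based t ≡ true
units-based-checked doubledK₃ = refl
units-based-checked k₄        = refl
units-based-checked w₄        = refl
units-based-checked k₅∖e      = refl

unit⇒base : ∀ t i → isBase (get (spec t) ⁅ i ⁆) ≡ true
unit⇒base t = allFin⇒ (rankOf t) _ (proj₁ (∧-true (units-based-checked t)))

base⇒unit : ∀ t p → isBase (get (spec t) p) ≡ true → ∃ λ i → p ≡ ⁅ i ⁆
base⇒unit t p h = let (i , z) = anyFin⇒ (rankOf t) _ (⊃-elim (allPoints⇒ (rankOf t) _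
                        (proj₂ (∧-true {allFin (rankOf t) (λ i → isBase (get (spec t) ⁅ i ⁆))} (units-based-checked t))) p) h)
                  in i , ⊕≡𝟘⇒≡ p ⁅ i ⁆ (zero?⇒ (p ⊕ ⁅ i ⁆) z)

𝟘-absent : ∀ t → get (spec t) 𝟘 ≡ absent
𝟘-absent doubledK₃ = refl
𝟘-absent k₄        = refl
𝟘-absent w₄        = refl
𝟘-absent k₅∖e      = refl

-- `d e ≡ 𝟘` says that `e` lies in no cycle, that is, it is a coloop; `d e ≡ ⁅ p ⁆` says that `e` is
-- in series with `p`, or equal to `p` when `e` is live.
Settled : {K : Vec Bool n → Set} {u : Vec (Vec Bool n) ρ} → State K u → Fin n → Set
Settled s e = State.d s e ≡ 𝟘 ⊎ ∃ λ p → State.live s p ≡ true × State.d s e ≡ ⁅ p ⁆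

record Templated (K : Vec Bool n → Set) (todo : List (Fin n)) (t : Name) : Set where
  field
    {u}     : Vec (Vec Bool n) (rankOf t)
    state   : State K u
    holds   : ∀ p → Holds (get (spec t) p) (At (State.live state) u p)
    settled : ∀ e → Settled state e ⊎ e ∈ₗ todo

lookup-combine : (u : Vec (Vec Bool n) ρ) (m : Vec Bool ρ) (e : Fin n) → lookup (combine (lookup u) m) e ≡ m · column u e
lookup-combine []      []      e = 𝟘-lookup e
lookup-combine (r ∷ u) (b ∷ m) e = trans (⊕-lookup (if b then r else 𝟘) (combine (lookup u) m) e)
  (cong₂ _xor_ (first b) (lookup-combine u m e))
  where
  first : ∀ b → lookup (if b then r else 𝟘) e ≡ b ∧ lookup r e
  first true  = refl
  first false = 𝟘-lookup e

combine-Ker : (u : Vec (Vec Bool n) ρ) (m : Vec Bool ρ) {y : Vec Bool n} → KerV u y → combine (lookup u) m · y ≡ false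
combine-Ker []      []      {y} []      = 𝟘-· y
combine-Ker (r ∷ u) (b ∷ m) {y} (p ∷ k) = trans (·-⊕ˡ (if b then r else 𝟘) (combine (lookup u) m) y)
  (cong₂ _xor_ (first b) (combine-Ker u m k))
  where
  first : ∀ b → (if b then r else 𝟘) · y ≡ false
  first true  = p
  first false = 𝟘-· y

mask : (u : Vec (Vec Bool n) ρ) → Vec Bool n → Vec Bool ρ → Vec Bool n
mask u r m = r ⊕ combine (lookup u) m

lookup-mask : (u : Vec (Vec Bool n) ρ) (r : Vec Bool n) (m : Vec Bool ρ) (e : Fin n) →
  lookup (mask u r m) e ≡ lookup r e xor (m · column u e)
lookup-mask u r m e = trans (⊕-lookup r (combine (lookup u) m) e) (cong (lookup r e xor_) (lookup-combine u m e))

mask-· : (u : Vec (Vec Bool n) ρ) (r : Vec Bool n) (m : Vec Bool ρ) {y : Vec Bool n} → KerV u y → mask u r m · y ≡ r · y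
mask-· u r m {y} k = trans (·-⊕ˡ r (combine (lookup u) m) y)
  (trans (cong (r · y xor_) (combine-Ker u m k)) (xor-identityʳ (r · y)))

mask-support : {K : Vec Bool n → Set} {u : Vec (Vec Bool n) ρ} (s : State K u) (r : Vec Bool n) (m : Vec Bool ρ) →
  (∀ i → State.live s i ≡ false → lookup r i ≡ false) → ∀ i → State.live s i ≡ false → lookup (mask u r m) i ≡ false
mask-support {u = u} s r m supp i ¬li = trans (lookup-mask u r m i) (cong₂ _xor_ (supp i ¬li)
  (trans (cong (m ·_) (State.u-supp s i ¬li)) (·-𝟘 m)))

get-masked : (m : Vec Bool ρ) (b : Bool) (S T : Tree Cap ρ) (p : Vec Bool ρ) →
  get (masked m b S T) p ≡ (if b xor (m · p) then get S p else get T p)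
get-masked [] b S T [] = cong (λ c → if c then S else T) (sym (xor-identityʳ b))
get-masked (c ∷ m) b (S₀ , S₁) (T₀ , T₁) (false ∷ p) = trans (get-masked m b S₀ T₀ p)
  (cong (λ d → if b xor (d xor (m · p)) then get S₀ p else get T₀ p) (sym (∧-zeroʳ c)))
get-masked (c ∷ m) b (S₀ , S₁) (T₀ , T₁) (true ∷ p) = trans (get-masked m (b xor c) S₁ T₁ p)
  (cong (λ d → if d then get S₁ p else get T₁ p)
    (trans (xor-assoc b c (m · p)) (cong (λ d → b xor (d xor (m · p))) (sym (Bool.∧-identityʳ c)))))

totalCap-AtMost : ∀ ρ (T : Tree Cap ρ) (P : Vec Bool ρ → Fin n → Set) → (∀ p → AtMost (get T p) (P p)) →
  AtMost (totalCap ρ T) (λ e → ∃ λ p → P p e)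
totalCap-AtMost zero    c P h = AtMost-map c (λ { ([] , q) → q }) (h [])
totalCap-AtMost (suc ρ) (S , T) P h = AtMost-⊞ (totalCap ρ S) (totalCap ρ T)
  (λ { (false ∷ p , q) → inj₁ (p , q) ; (true ∷ p , q) → inj₂ (p , q) })
  (totalCap-AtMost ρ S (P ∘ (false ∷_)) (h ∘ (false ∷_))) (totalCap-AtMost ρ T (P ∘ (true ∷_)) (h ∘ (true ∷_)))

sparseColumn : (u : Vec (Vec Bool n) ρ) (e : Fin n) → weight e (Vec.toList u) ≡ ∣ column u e ∣
sparseColumn []      e = refl
sparseColumn (r ∷ u) e with lookup r e
... | true  = cong suc (sparseColumn u e)
... | false = sparseColumn u e

-- The element e, absent so far, is added in series with p.

module _ (e : Fin n) where

  private
    Ker-unit : (R : List (Vec Bool n)) → Ker R ⁅ e ⁆ → All (λ r → lookup r e ≡ false) R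
    Ker-unit R k = All.map (λ {r} p → trans (sym (·-⁅⁆ e r)) p) k

    weight-absent : (R : List (Vec Bool n)) → All (λ r → lookup r e ≡ false) R → weight e R ≡ 0
    weight-absent []      []      = refl
    weight-absent (r ∷ R) (p ∷ h) rewrite p = weight-absent R h

  -- Since `⁅ e ⁆` lies in the kernel, `e` occurs in no row. The additional row `⁅ e ⁆` turns it
  -- into a pendant edge.
  loop-SparseKernel : {L : Vec Bool n → Set} → SparseKernel L → L ⁅ e ⁆ → SparseKernel (λ y → L y × lookup y e ≡ false)
  loop-SparseKernel (R , sparse , eq) ke = ⁅ e ⁆ ∷ R , sparse′ , λ y → mk⇔
    (λ { (l , ye) → trans (⁅⁆-· e y) ye ∷ to (eq y) l }) (λ { (p ∷ k) → from (eq y) k , trans (sym (⁅⁆-· e y)) p })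
    where
    sparse′ : Sparse (⁅ e ⁆ ∷ R)
    sparse′ f with e ≟ f
    ... | yes refl rewrite ⁅⁆-self e | weight-absent R (Ker-unit R (to (eq ⁅ e ⁆) ke)) = s≤s z≤n
    ... | no e≢f rewrite ⁅⁆-≢ e f e≢f = sparse f

  module _ (p : Fin n) (e≢p : e ≢ p) where
    private
      pair : Vec Bool n
      pair = ⁅ e ⁆ ⊕ ⁅ p ⁆

      pair-e : lookup pair e ≡ true
      pair-e = trans (⊕-lookup ⁅ e ⁆ ⁅ p ⁆ e) (cong₂ _xor_ (⁅⁆-self e) (⁅⁆-≢ p e (e≢p ∘ sym)))

      pair-p : lookup pair p ≡ true
      pair-p = trans (⊕-lookup ⁅ e ⁆ ⁅ p ⁆ p) (cong₂ _xor_ (⁅⁆-≢ e p e≢p) (⁅⁆-self p))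

      pair-other : ∀ f → e ≢ f → p ≢ f → lookup pair f ≡ false
      pair-other f e≢f p≢f = trans (⊕-lookup ⁅ e ⁆ ⁅ p ⁆ f) (cong₂ _xor_ (⁅⁆-≢ e f e≢f) (⁅⁆-≢ p f p≢f))

      pair-· : ∀ y → pair · y ≡ lookup y e xor lookup y p
      pair-· y = trans (·-⊕ˡ ⁅ e ⁆ ⁅ p ⁆ y) (cong₂ _xor_ (⁅⁆-· e y) (⁅⁆-· p y))

      -- Subdivision of the edge `p`: at one of its ends `e` takes its place, and `pair` is the star
      -- of the new vertex. If no row contains `p`, nothing is replaced, and `pair` becomes the only
      -- row with `p` and `e`.
      replaceFirst : List (Vec Bool n) → List (Vec Bool n)
      replaceFirst []      = []
      replaceFirst (r ∷ R) = if lookup r p then (r ⊕ pair) ∷ R else r ∷ replaceFirst R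

      replaced : ∀ R y → pair · y ≡ false → (Ker R y → Ker (replaceFirst R) y) × (Ker (replaceFirst R) y → Ker R y)
      replaced [] y py = id , id
      replaced (r ∷ R) y py with lookup r p
      ... | true  = (λ { (q ∷ k) → trans eq q ∷ k }) , λ { (q ∷ k) → trans (sym eq) q ∷ k }
        where
        eq : (r ⊕ pair) · y ≡ r · y
        eq = trans (·-⊕ˡ r pair y) (trans (cong (r · y xor_) py) (xor-identityʳ (r · y)))
      ... | false = let (f , g) = replaced R y py in (λ { (q ∷ k) → q ∷ f k }) , λ { (q ∷ k) → q ∷ g k }

      bit : Bool → ℕ
      bit b = if b then 1 else 0

      weight-e : ∀ R → All (λ r → lookup r e ≡ false) R → weight e (replaceFirst R) ≤ 1
      weight-e [] [] = z≤n
      weight-e (r ∷ R) (q ∷ h) with lookup r p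
      ... | true  rewrite ⊕-lookup r pair e | q | pair-e | weight-absent R h = s≤s z≤n
      ... | false rewrite q = weight-e R h

      weight-p : ∀ R → weight p R ≤ 2 → weight p (replaceFirst R) ≤ 1
      weight-p [] le = z≤n
      weight-p (r ∷ R) le with lookup r p in rp
      ... | true  rewrite ⊕-lookup r pair p | rp | pair-p = s≤s⁻¹ le
      ... | false rewrite rp = weight-p R le

      weight-other : ∀ R f → e ≢ f → p ≢ f → weight f (replaceFirst R) ≡ weight f R
      weight-other [] f _ _ = refl
      weight-other (r ∷ R) f e≢f p≢f with lookup r p
      ... | true  = cong (λ b → bit b + weight f R) (trans (⊕-lookup r pair f)
                      (trans (cong (lookup r f xor_) (pair-other f e≢f p≢f)) (xor-identityʳ (lookup r f))))
      ... | false = cong (bit (lookup r f) +_) (weight-other R f e≢f p≢f)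

    series-SparseKernel : {L : Vec Bool n → Set} → SparseKernel L → L ⁅ e ⁆ → SparseKernel (λ y → L y × lookup y e ≡ lookup y p)
    series-SparseKernel (R , sparse , eq) ke = pair ∷ replaceFirst R , sparse′ , λ y → mk⇔
      (λ { (l , h) → let q = trans (pair-· y) (≡⇒xor≡false h) in q ∷ proj₁ (replaced R y q) (to (eq y) l) })
      (λ { (q ∷ k) → from (eq y) (proj₂ (replaced R y q) k) , xor≡false⇒≡ (trans (sym (pair-· y)) q) })
      where
      sparse′ : Sparse (pair ∷ replaceFirst R)
      sparse′ f with e ≟ f | p ≟ f
      ... | yes refl | _ rewrite pair-e = s≤s (weight-e R (Ker-unit R (to (eq ⁅ e ⁆) ke)))
      ... | no _ | yes refl rewrite pair-p = s≤s (weight-p R (sparse p))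
      ... | no e≢f | no p≢f rewrite pair-other f e≢f p≢f | weight-other R f e≢f p≢f = sparse f

-- Extending a template by one element

module _ {K : Vec Bool n → Set} where

  -- The functional r₀ changed by rows of u so as to vanish on elements representing the unit vectors
  record Normalised {todo t} (P : Templated K todo t) (r₀ : Vec Bool n) : Set where
    open Templated P
    open State state
    field
      r        : Vec Bool n
      r-supp   : ∀ i → live i ≡ false → lookup r i ≡ false
      r-·      : ∀ {y} → KerV u y → r · y ≡ r₀ · y
      r-𝟘      : ∀ i → column u i ≡ 𝟘 → lookup r i ≡ lookup r₀ i
      T        : Tree Cap (suc (rankOf t))
      lower    : Lower live (r ∷ u) T
      upper    : Upper live (r ∷ u) T
      splitsOK : ∀ p → splitOK (get (spec t) p) (get (proj₁ T) p , get (proj₂ T) p) ≡ true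

  module Normalise {todo t} (P : Templated K todo t) (r₀ : Vec Bool n)
    (supp₀ : ∀ i → State.live (Templated.state P) i ≡ false → lookup r₀ i ≡ false) where
    open Templated P
    open State state

    private
      inhabited : ∀ sp {P : Fin n → Set} → isBase sp ≡ true → Holds sp P → ∃ P
      inhabited base  h (ex , _) = ex
      inhabited base₂ h (e , _ , _ , p , _) = e , p

      unit : ∀ i → ∃ (At live u ⁅ i ⁆)
      unit i = inhabited (get (spec t) ⁅ i ⁆) (unit⇒base t i) (holds ⁅ i ⁆)

      -- Row `i` of `u` is the one that distinguishes the element chosen at `⁅ i ⁆` from those at
      -- the other unit vectors; it is added when `r₀` is nonzero on that element.
      coefficients : Vec Bool (rankOf t)
      coefficients = tabulate λ i → lookup r₀ (proj₁ (unit i))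

    r : Vec Bool n
    r = mask u r₀ coefficients

    r-supp : ∀ i → live i ≡ false → lookup r i ≡ false
    r-supp = mask-support state r₀ coefficients supp₀

    r-· : ∀ {y} → KerV u y → r · y ≡ r₀ · y
    r-· = mask-· u r₀ coefficients

    private
      r-unit : ∀ i → lookup r (proj₁ (unit i)) ≡ false
      r-unit i = trans (lookup-mask u r₀ coefficients (proj₁ (unit i)))
        (trans (cong (λ c → lookup r₀ (proj₁ (unit i)) xor (coefficients · c)) (proj₂ (proj₂ (unit i))))
          (≡⇒xor≡false (sym (trans (·-⁅⁆ i coefficients) (lookup∘tabulate (λ i → lookup r₀ (proj₁ (unit i))) i)))))

    T : Tree Cap (suc (rankOf t))
    T = proj₁ (table live (r ∷ u))

    lower : Lower live (r ∷ u) T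
    lower = proj₁ (proj₂ (table live (r ∷ u)))

    upper : Upper live (r ∷ u) T
    upper = proj₂ (proj₂ (table live (r ∷ u)))

    splitsOK : ∀ p → splitOK (get (spec t) p) (get (proj₁ T) p , get (proj₂ T) p) ≡ true
    splitsOK p = Holds⇒splitOK {P = At live u p} {P₀ = At live (r ∷ u) (false ∷ p)} {P₁ = At live (r ∷ u) (true ∷ p)}
      (λ {e} at → parts e at) (λ { (l , eq) → l , cong Vec.tail eq }) (λ { (l , eq) → l , cong Vec.tail eq })
      (λ { (_ , eq) (_ , eq′) → true≢false (cong Vec.head eq′) (cong Vec.head eq) })
      (get (spec t) p) (get (proj₁ T) p) (get (proj₂ T) p) (holds p) based
      (lower (false ∷ p)) (upper (false ∷ p)) (lower (true ∷ p)) (upper (true ∷ p))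
      where
      parts : ∀ e → At live u p e → At live (r ∷ u) (false ∷ p) e ⊎ At live (r ∷ u) (true ∷ p) e
      parts e (l , eq) with lookup r e
      ... | false = inj₁ (l , cong (false ∷_) eq)
      ... | true  = inj₂ (l , cong (true ∷_) eq)
      based : isBase (get (spec t) p) ≡ true → ∃ (At live (r ∷ u) (false ∷ p))
      based h with base⇒unit t p h
      ... | i , refl = proj₁ (unit i) , proj₁ (proj₂ (unit i)) , cong₂ _∷_ (r-unit i) (proj₂ (proj₂ (unit i)))

    normalised : Normalised P r₀
    normalised = record { r = r ; r-supp = r-supp ; r-· = r-· ; T = T ; lower = lower ; upper = upper ; splitsOK = splitsOK
      ; r-𝟘 = λ i eq → trans (lookup-mask u r₀ coefficients i) (trans (cong (λ c → lookup r₀ i xor (coefficients · c)) eq)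
          (trans (cong (lookup r₀ i xor_) (·-𝟘 coefficients)) (xor-identityʳ (lookup r₀ i)))) }

  Outcomes : List (Fin n) → Set
  Outcomes todo = QMinor K ⊎ ∃ (Templated K todo)

  use-outcome : CutSpace K → ∀ {todo} (o : Outcome ρ) {u : Vec (Vec Bool n) ρ} (s : State K u) (T : Tree Cap ρ) →
    Lower (State.live s) u T → Upper (State.live s) u T → (∀ e → Settled s e ⊎ e ∈ₗ todo) →
    resolves o T ≡ true → Outcomes todo
  use-outcome cut (template t ps) {u} s T low up settled h with acts (basis ps) s
  ... | s′ , refl , refl = inj₂ (t , record
    { state = s′ ; settled = settled
    ; holds = λ p → fits⇒Holds (get (spec t) p) (get T′ p) (fitsTree⇒ (rankOf t) (spec t) T′ h p)
        (Lower-acts ops {u = u} {T} low p) (Upper-acts ops {u = u} {T} up p) })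
    where
    ops : List (Op (rankOf t))
    ops = basis ps
    T′ : Tree Cap (rankOf t)
    T′ = actsT ops T
  use-outcome cut (reference r cs ps) s T low up settled h
    with leadsTo⇒ (certificate cs ps) (present (ref r)) s T low h
  ... | v , s′ , T′ , low′ , h′ = inj₁ (conclude cut r (present⇒minor (ref r) s′ T′ low′ h′))

  use-outcomes : CutSpace K → ∀ {todo} (os : List (Outcome ρ)) {u : Vec (Vec Bool n) ρ} (s : State K u) (T : Tree Cap ρ) →
    Lower (State.live s) u T → Upper (State.live s) u T → (∀ e → Settled s e ⊎ e ∈ₗ todo) →
    some-resolves {ρ} os T ≡ true → Outcomes todo
  use-outcomes {ρ} cut (o ∷ os) s T low up settled h with ∨-true {resolves {ρ} o T} h
  ... | inj₁ p = use-outcome cut o s T low up settled p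
  ... | inj₂ q = use-outcomes cut os s T low up settled q

-- Sparse rows for a state whose contracted elements are coloops or in series

SparseKernel-map : {K L : Vec Bool n → Set} → (∀ y → K y → L y) → (∀ y → L y → K y) → SparseKernel K → SparseKernel L
SparseKernel-map K⇒L L⇒K (R , sparse , eq) = R , sparse , λ y → mk⇔ (to (eq y) ∘ L⇒K y) (K⇒L y ∘ from (eq y))

𝟘-column⇒Ker : (u : Vec (Vec Bool n) ρ) (e : Fin n) → column u e ≡ 𝟘 → KerV u ⁅ e ⁆
𝟘-column⇒Ker []      e eq = []
𝟘-column⇒Ker (r ∷ u) e eq = trans (·-⁅⁆ e r) (cong Vec.head eq) ∷ 𝟘-column⇒Ker u e (cong Vec.tail eq)

-- The kernel of `u` is sparse by `thin`, and in it the elements that are not live are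
-- unconstrained. Their equations are imposed one at a time, as pendant edges or subdivisions. An
-- element is still unconstrained only if it has not been treated before, hence the test for
-- membership.
State⇒SparseKernel : {K : Vec Bool n → Set} {u : Vec (Vec Bool n) ρ} (s : State K u) →
  (∀ e → State.live s e ≡ true → ∣ column u e ∣ ≤ 2) → (∀ e → Settled s e) → SparseKernel K
State⇒SparseKernel {n} {ρ} {u = u} s thin settled = SparseKernel-map
  (λ y (k , h) → ⇒K y k λ e → All.lookup h (Mem.∈-allFin e))
  (λ y k → K⇒u y k , All.tabulate λ {e} _ → K⇒d y k e) (extend (List.allFin n))
  where
  open State s
  L : List (Fin n) → Vec Bool n → Set
  L t y = KerV u y × All (λ e → lookup y e ≡ d e · y) t
  sparse : Sparse (Vec.toList u)
  sparse e with live e in le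
  ... | true  = ℕ.≤-trans (ℕ.≤-reflexive (sparseColumn u e)) (thin e le)
  ... | false = ℕ.≤-trans (ℕ.≤-reflexive (trans (sparseColumn u e) (trans (cong ∣_∣ (u-supp e le)) (Sub.∣⊥∣≡0 ρ)))) z≤n
  member? : ∀ e (t : List (Fin n)) → Dec (e ∈ₗ t)
  member? e = Anyₗ.any? (e ≟_)
  extend : ∀ t → SparseKernel (L t)
  extend [] = Vec.toList u , sparse , λ y → mk⇔ proj₁ (_, [])
  extend (e ∷ t) with live e in le | member? e t
  ... | true | _ = SparseKernel-map (λ y (k , h) → k , sym (trans (cong (_· y) (d-live e le)) (⁅⁆-· e y)) ∷ h)
      (λ y (k , h) → k , All.tail h) (extend t)
  ... | false | yes e∈t = SparseKernel-map (λ y (k , h) → k , All.lookup h e∈t ∷ h) (λ y (k , h) → k , All.tail h) (extend t)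
  ... | false | no e∉t = add (settled e)
    where
    free : L t ⁅ e ⁆
    free = 𝟘-column⇒Ker u e (u-supp e le) , All.tabulate λ {f} f∈t →
      trans (⁅⁆-≢ e f λ { refl → e∉t f∈t }) (sym (trans (·-⁅⁆ e (d f)) (d-supp f e le)))
    add : Settled s e → SparseKernel (L (e ∷ t))
    add (inj₁ eq) = SparseKernel-map
      (λ { y ((k , h) , ye) → k , trans ye (sym (trans (cong (_· y) eq) (𝟘-· y))) ∷ h })
      (λ { y (k , ye ∷ h) → (k , h) , trans ye (trans (cong (_· y) eq) (𝟘-· y)) })
      (loop-SparseKernel e (extend t) free)
    add (inj₂ (p , lp , eq)) = SparseKernel-map
      (λ { y ((k , h) , ye) → k , trans ye (sym (trans (cong (_· y) eq) (⁅⁆-· p y))) ∷ h })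
      (λ { y (k , ye ∷ h) → (k , h) , trans ye (trans (cong (_· y) eq) (⁅⁆-· p y)) })
      (series-SparseKernel e p (λ { refl → true≢false lp le }) (extend t) free)

get-set𝟘 : (T : Tree Cap ρ) (p : Vec Bool ρ) →
  (p ≡ 𝟘 × get (set𝟘 ρ T) p ≡ one) ⊎ (p ≢ 𝟘 × get (set𝟘 ρ T) p ≡ get T p)
get-set𝟘 c [] = inj₁ (refl , refl)
get-set𝟘 (S , T) (true ∷ p) = inj₂ ((λ ()) , refl)
get-set𝟘 (S , T) (false ∷ p) with get-set𝟘 S p
... | inj₁ (refl , eq) = inj₁ (refl , eq)
... | inj₂ (ne , eq)   = inj₂ (ne ∘ cong Vec.tail , eq)

AtMost-one : ∀ c {P : Fin n → Set} → c ≼ one ≡ true → AtMost c P → AtMost one P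
AtMost-one none _ h e f p _ = ⊥-elim (h e p)
AtMost-one one  _ h = h

-- Uncontracting the remaining elements of a template

module _ {K : Vec Bool n → Set} (cut : CutSpace K) where

  module _ {x todo t} (P : Templated K (x ∷ todo) t) (¬lx : State.live (Templated.state P) x ≡ false)
    (N : Normalised P (State.d (Templated.state P) x)) where
    open Templated P
    open State state
    open Normalised N

    private
      later : ∀ e → x ≢ e → Settled state e ⊎ e ∈ₗ todo
      later e x≢e with settled e
      ... | inj₁ h = inj₁ h
      ... | inj₂ (Anyₗ.here refl) = ⊥-elim (x≢e refl)
      ... | inj₂ (Anyₗ.there h) = inj₂ h

      -- The row `v` with at most one nonzero entry is `𝟘` or a unit vector and agrees with `d x` on
      -- the kernel of `u`. Taking it as the new `d x` settles `x` and leaves the template as it is.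
      in-series : series? (rankOf t) T ≡ true → Outcomes todo
      in-series h = inj₂ (t , record { state = state′ ; holds = holds ; settled = settled′ })
        where
        found : ∃ λ m₀ → totalCap (rankOf t) (masked m₀ false (proj₁ T) (proj₂ T)) ≼ one ≡ true
        found with ¬allPoints⇒ (rankOf t) _ (not-true h)
        ... | m₀ , h′ = m₀ , not-false h′
          where
          not-false : ∀ {b} → not b ≡ false → b ≡ true
          not-false {true} _ = refl
        m₀ : Vec Bool (rankOf t)
        m₀ = proj₁ found
        v : Vec Bool n
        v = mask u r m₀
        v-supp : ∀ i → live i ≡ false → lookup v i ≡ false
        v-supp = mask-support state r m₀ r-supp
        Selected : Vec Bool (rankOf t) → Fin n → Set
        Selected p e = At live u p e × lookup v e ≡ true
        selected : ∀ p → AtMost (get (masked m₀ false (proj₁ T) (proj₂ T)) p) (Selected p)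
        selected p rewrite get-masked m₀ false (proj₁ T) (proj₂ T) p with m₀ · p in mp
        ... | true = AtMost-map (get (proj₁ T) p) (λ { {e} ((l , refl) , ve) →
                l , cong (_∷ column u e) (flip (lookup r e) (trans (sym (trans (lookup-mask u r m₀ e) (cong (lookup r e xor_) mp))) ve)) }) (upper (false ∷ p))
          where
          flip : ∀ b → b xor true ≡ true → b ≡ false
          flip false _ = refl
        ... | false = AtMost-map (get (proj₂ T) p) (λ { {e} ((l , refl) , ve) →
                l , cong (_∷ column u e) (trans (sym (trans (lookup-mask u r m₀ e) (trans (cong (lookup r e xor_) mp) (xor-identityʳ (lookup r e))))) ve) }) (upper (true ∷ p))
        unique : ∀ e f → lookup v e ≡ true → lookup v f ≡ true → e ≡ f
        unique e f ve vf = AtMost-one _ (proj₂ found) (totalCap-AtMost (rankOf t) (masked m₀ false (proj₁ T) (proj₂ T)) Selected selected) e f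
          (column u e , (v⇒live ve , refl) , ve) (column u f , (v⇒live vf , refl) , vf)
          where
          v⇒live : ∀ {e} → lookup v e ≡ true → live e ≡ true
          v⇒live {e} ve with live e in le
          ... | true  = refl
          ... | false = true≢false ve (v-supp e le)
        state′ : State K u
        state′ = redefine state x v ¬lx v-supp λ y k → sym (trans (mask-· u r m₀ k) (r-· k))
        v-settled : v ≡ 𝟘 ⊎ ∃ λ p → live p ≡ true × v ≡ ⁅ p ⁆
        v-settled with ≡𝟘⊎∋ v
        ... | inj₁ eq = inj₁ eq
        ... | inj₂ (p , vp) = inj₂ (p , lp , lookup-ext entry)
          where
          lp : live p ≡ true
          lp with live p in le
          ... | true  = refl
          ... | false = true≢false vp (v-supp p le)
          entry : ∀ f → lookup v f ≡ lookup ⁅ p ⁆ f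
          entry f with p ≟ f
          ... | yes refl = trans vp (sym (⁅⁆-self p))
          ... | no p≢f = trans (¬-not λ vf → p≢f (unique p f vp vf)) (sym (⁅⁆-≢ p f p≢f))
        settled′ : ∀ e → Settled state′ e ⊎ e ∈ₗ todo
        settled′ e with x ≟ e
        ... | yes refl = inj₁ v-settled
        ... | no x≢e = later e x≢e

      extended : some-resolves {suc (rankOf t)} (outcomes t) (proj₁ T , set𝟘 (rankOf t) (proj₂ T)) ≡ true → Outcomes todo
      extended = use-outcomes cut (outcomes t) state′ (proj₁ T , set𝟘 (rankOf t) (proj₂ T)) low up settled′
        where
        w : Vec Bool n
        w = r ⊕ ⁅ x ⁆
        state′ : State K (w ∷ u)
        state′ = uncontract state x ¬lx r r-supp λ y k → sym (r-· k)
        live′ : Fin n → Bool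
        live′ = State.live state′
        at-x : At live′ (w ∷ u) (true ∷ 𝟘) x
        at-x = trans (cong (_∨ δ x x) ¬lx) (δ-refl x)
          , cong₂ _∷_ (trans (⊕-lookup r ⁅ x ⁆ x) (cong₂ _xor_ (r-supp x ¬lx) (⁅⁆-self x))) (u-supp x ¬lx)
        w-other : ∀ e → x ≢ e → lookup w e ≡ lookup r e
        w-other e x≢e = trans (⊕-lookup r ⁅ x ⁆ e) (trans (cong (lookup r e xor_) (⁅⁆-≢ x e x≢e)) (xor-identityʳ (lookup r e)))
        old⇒new : ∀ {p e} → At live (r ∷ u) p e → At live′ (w ∷ u) p e
        old⇒new {e = e} (le , eq) = cong (_∨ δ x e) le
          , trans (cong (_∷ column u e) (w-other e λ { refl → true≢false le ¬lx })) eq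
        new⇒old : ∀ {p e} → At live′ (w ∷ u) p e → x ≡ e ⊎ At live (r ∷ u) p e
        new⇒old {e = e} (le , eq) with x ≟ e
        ... | yes x≡e = inj₁ x≡e
        ... | no x≢e = inj₂ (trans (sym (Bool.∨-identityʳ (live e))) le , trans (cong (_∷ column u e) (sym (w-other e x≢e))) eq)
        low : Lower live′ (w ∷ u) (proj₁ T , set𝟘 (rankOf t) (proj₂ T))
        low (false ∷ p) = AtLeast-map (get (proj₁ T) p) old⇒new (lower (false ∷ p))
        low (true ∷ p) with get-set𝟘 (proj₂ T) p
        ... | inj₁ (refl , eq) = subst (λ c → AtLeast c (At live′ (w ∷ u) (true ∷ 𝟘))) (sym eq) (x , at-x)
        ... | inj₂ (_ , eq) = subst (λ c → AtLeast c (At live′ (w ∷ u) (true ∷ p))) (sym eq)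
          (AtLeast-map (get (proj₂ T) p) old⇒new (lower (true ∷ p)))
        x-only : ∀ e → At live′ (w ∷ u) (true ∷ 𝟘) e → x ≡ e
        x-only e at with new⇒old at
        ... | inj₁ x≡e = x≡e
        ... | inj₂ (le , eq) = ⊥-elim (subst (λ sp → Holds sp (At live u 𝟘)) (𝟘-absent t) (holds 𝟘) e (le , cong Vec.tail eq))
        not-x : ∀ {h p e} → h ∷ p ≢ true ∷ 𝟘 → At live′ (w ∷ u) (h ∷ p) e → At live (r ∷ u) (h ∷ p) e
        not-x ne at with new⇒old at
        ... | inj₁ refl = ⊥-elim (ne (trans (sym (proj₂ at)) (proj₂ at-x)))
        ... | inj₂ old = old
        up : Upper live′ (w ∷ u) (proj₁ T , set𝟘 (rankOf t) (proj₂ T))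
        up (false ∷ p) = AtMost-map (get (proj₁ T) p) (not-x λ ()) (upper (false ∷ p))
        up (true ∷ p) with get-set𝟘 (proj₂ T) p
        ... | inj₁ (refl , eq) = subst (λ c → AtMost c (At live′ (w ∷ u) (true ∷ 𝟘))) (sym eq)
          λ e f ate atf → trans (sym (x-only e ate)) (x-only f atf)
        ... | inj₂ (ne , eq) = subst (λ c → AtMost c (At live′ (w ∷ u) (true ∷ p))) (sym eq)
          (AtMost-map (get (proj₂ T) p) (not-x (ne ∘ cong Vec.tail)) (upper (true ∷ p)))
        settled′ : ∀ e → Settled state′ e ⊎ e ∈ₗ todo
        settled′ e with x ≟ e
        ... | yes refl = inj₁ (inj₂ (x , proj₁ at-x , refl))
        ... | no x≢e with later e x≢e
        ...   | inj₁ (inj₁ eq) = inj₁ (inj₁ eq)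
        ...   | inj₁ (inj₂ (p , lp , eq)) = inj₁ (inj₂ (p , cong (_∨ δ x p) lp , eq))
        ...   | inj₂ e∈ = inj₂ e∈

    extendBy : Outcomes todo
    extendBy with ∨-true {series? (rankOf t) T}
      (everySplit⇒ (rankOf t) (spec t)
        (λ (S , T) → series? (rankOf t) (S , T) ∨ some-resolves {suc (rankOf t)} (outcomes t) (S , set𝟘 (rankOf t) T)) (extension-checked t) (proj₁ T) (proj₂ T) splitsOK)
    ... | inj₁ h = in-series h
    ... | inj₂ h = extended h

  module _ {t} (P : Templated K [] t) (S r₀ : Vec Bool n)
    (supp₀ : ∀ i → State.live (Templated.state P) i ≡ false → lookup r₀ i ≡ false)
    (eq₀ : ∀ y → (∀ e → lookup y e ≡ State.d (Templated.state P) e · y) → r₀ · y ≡ S · y) (N : Normalised P r₀) where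
   private
    open Templated P
    open State state using (live; K⇒u)
    open Normalised N
    T′-of : ∀ pss → some-sparse (suc (rankOf t)) pss T ≡ true → ∃ λ ps → sparse? (suc (rankOf t)) (actsT {ρ = suc (rankOf t)} (basis ps) T) ≡ true
    T′-of (ps ∷ pss) h with ∨-true {sparse? (suc (rankOf t)) (actsT {ρ = suc (rankOf t)} (basis ps) T)} h
    ... | inj₁ p = ps , p
    ... | inj₂ q = T′-of pss q
    chosen : ∃ λ ps → sparse? (suc (rankOf t)) (actsT {ρ = suc (rankOf t)} (basis ps) T) ≡ true
    chosen = T′-of (finishes t) (everySplit⇒ (rankOf t) (spec t) (some-sparse (suc (rankOf t)) (finishes t)) (splitting-checked t) (proj₁ T) (proj₂ T) splitsOK)
    ops : List (Op (suc (rankOf t)))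
    ops = basis (proj₁ chosen)
    s₀ : State (λ y → K y × S · y ≡ false) (r ∷ u)
    s₀ = rebase (restrict state S r₀ supp₀ eq₀)
      (λ { y (p ∷ k) → trans (r-· k) p ∷ k }) (λ { y (p ∷ k) → trans (sym (r-· k)) p ∷ k })
      λ i eq → cong₂ _∷_ (trans (r-𝟘 i (cong Vec.tail eq)) (cong Vec.head eq)) (cong Vec.tail eq)
    s : State (λ y → K y × S · y ≡ false) (actsR ops (r ∷ u))
    s = proj₁ (acts ops s₀)
    live≡ : State.live s ≡ live
    live≡ = proj₁ (proj₂ (acts ops s₀))
    thin : ∀ e → State.live s e ≡ true → ∣ column (actsR ops (r ∷ u)) e ∣ ≤ 2
    thin e le with ∨-true {get (actsT ops T) (column (actsR ops (r ∷ u)) e) ≼ none}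
      (allPoints⇒ (suc (rankOf t)) (λ p → get (actsT ops T) p ≼ none ∨ (∣ p ∣ ℕ.≤ᵇ 2)) (proj₂ chosen) (column (actsR ops (r ∷ u)) e))
    ... | inj₂ h = ℕ.≤ᵇ⇒≤ _ 2 (subst Bool.T (sym h) tt)
    ... | inj₁ h = ⊥-elim (absent-cap _ h (Upper-acts ops {u = r ∷ u} {T} upper (column (actsR ops (r ∷ u)) e)))
      where
      absent-cap : ∀ c → c ≼ none ≡ true → AtMost c (At live (actsR ops (r ∷ u)) (column (actsR ops (r ∷ u)) e)) → ⊥
      absent-cap none _ h = h e (trans (cong (λ l → l e) (sym live≡)) le , refl)
    settled′ : ∀ e → Settled s e
    settled′ e with settled e
    ... | inj₁ h = subst₂ (λ live d → d e ≡ 𝟘 ⊎ ∃ λ p → live p ≡ true × d e ≡ ⁅ p ⁆)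
        (sym live≡) (sym (proj₂ (proj₂ (acts ops s₀)))) h

   splitting-sparse : SparseKernel (λ y → K y × S · y ≡ false)
   splitting-sparse = State⇒SparseKernel s thin settled′

  good : ∀ {t} → Templated K [] t → Good K
  good P S with reduced (Templated.state P) S
  ... | r₀ , supp₀ , eq₀ = splitting-sparse P S r₀ supp₀ eq₀ (Normalise.normalised P r₀ supp₀)

  complete : ∀ todo → ∃ (Templated K todo) → QMinor K ⊎ Good K
  complete [] (t , P) = inj₂ (good P)
  complete (x ∷ todo) (t , P) with State.live (Templated.state P) x in lx
  ... | false with extendBy P lx (Normalise.normalised P (State.d (Templated.state P) x) (State.d-supp (Templated.state P) x))
  ...   | inj₁ q = inj₁ q
  ...   | inj₂ P′ = complete todo P′
  complete (x ∷ todo) (t , P) | true = complete todo (t , record { state = state ; holds = holds ; settled = settled′ })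
    where
    open Templated P
    settled′ : ∀ e → Settled state e ⊎ e ∈ₗ todo
    settled′ e with settled e
    ... | inj₁ h = inj₁ h
    ... | inj₂ (Anyₗ.here refl) = inj₁ (inj₂ (x , lx , State.d-live state x lx))
    ... | inj₂ (Anyₗ.there h) = inj₂ h

  atLeast : Cap → List Cap
  atLeast c = List.filter (λ c′ → c ≼ c′ Bool.≟ true) caps

  AtLeast⇒∈ : ∀ c c′ {P : Fin n → Set} → AtLeast c P → AtMost c′ P → c′ ∈ₗ atLeast c
  AtLeast⇒∈ c c′ lo hi = Mem.∈-filter⁺ (λ c′ → c ≼ c′ Bool.≟ true) (∈caps c′) (compare c c′ lo hi)
    where
    compare : ∀ c c′ {P : Fin n → Set} → AtLeast c P → AtMost c′ P → c ≼ c′ ≡ true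
    compare none _    lo hi = refl
    compare one  none (e , p) hi = ⊥-elim (hi e p)
    compare one  one  lo hi = refl
    compare one  many lo hi = refl
    compare many none (e , _ , _ , p , _) hi = ⊥-elim (hi e p)
    compare many one  (e , f , ne , p , q) hi = ⊥-elim (ne (hi e f p q))
    compare many many lo hi = refl

  -- At the entrance only the lower bounds `B` are known. All tables above `B` are checked, which
  -- takes care of loops, additional points and fat edges.
  enter : (os : List (Outcome ρ)) (B : Tree Cap ρ) → everyTree ρ (mapTree ρ atLeast B) (some-resolves {ρ} os) ≡ true →
    {u : Vec (Vec Bool n) ρ} (s : State K u) → Lower (State.live s) u B → QMinor K ⊎ Good K
  enter {ρ} os B h {u} s low with table (State.live s) u
  ... | T , lower , upper with use-outcomes cut os s T lower upper (λ e → inj₂ (Mem.∈-allFin e))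
      (everyTree⇒ ρ (mapTree ρ atLeast B) (some-resolves {ρ} os) h T λ p →
        subst (get T p ∈ₗ_) (sym (get-map atLeast B p)) (AtLeast⇒∈ (get B p) (get T p) (low p) (upper p)))
  ...   | inj₁ q = inj₁ q
  ...   | inj₂ P = complete (List.allFin n) P

  -- A doubled triangle, respectively K₄, obtained by contraction
  enter₂ : {u : Vec (Vec Bool n) 2} (s : State K u) → (∀ p → p ≢ 𝟘 → AtLeast many (At (State.live s) u p)) → QMinor K ⊎ Good K
  enter₂ s h = enter entries₂ ((none , many) , (many , many)) refl s
    λ { (false ∷ false ∷ []) → tt ; (false ∷ true ∷ []) → h _ (λ ()) ; (true ∷ false ∷ []) → h _ (λ ()) ; (true ∷ true ∷ []) → h _ (λ ()) }

  enter₃ : {u : Vec (Vec Bool n) 3} (s : State K u) →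
    (∀ p → p ≢ 𝟘 → p ≢ true ∷ true ∷ true ∷ [] → AtLeast one (At (State.live s) u p)) → QMinor K ⊎ Good K
  enter₃ s h = enter entries₃ (((none , one) , (one , one)) , ((one , one) , (one , none))) refl s
    λ { (false ∷ false ∷ false ∷ []) → tt ; (false ∷ false ∷ true ∷ []) → h _ (λ ()) (λ ())
      ; (false ∷ true ∷ false ∷ []) → h _ (λ ()) (λ ()) ; (false ∷ true ∷ true ∷ []) → h _ (λ ()) (λ ())
      ; (true ∷ false ∷ false ∷ []) → h _ (λ ()) (λ ()) ; (true ∷ false ∷ true ∷ []) → h _ (λ ()) (λ ())
      ; (true ∷ true ∷ false ∷ []) → h _ (λ ()) (λ ()) ; (true ∷ true ∷ true ∷ []) → tt }

-- Triangular row lists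

Triangular : List (Fin n × Vec Bool n) → Set
Triangular []             = ⊤
Triangular ((x , r) ∷ ps) = lookup r x ≡ true × All (λ p → lookup (proj₂ p) x ≡ false) ps × Triangular ps

rowsOf : List (Fin n × Vec Bool n) → List (Vec Bool n)
rowsOf = List.map proj₂

unit∈Ker : (ps : List (Fin n × Vec Bool n)) (x : Fin n) → All (λ p → lookup (proj₂ p) x ≡ false) ps → Ker (rowsOf ps) ⁅ x ⁆
unit∈Ker []       x []      = []
unit∈Ker (p ∷ ps) x (q ∷ h) = trans (·-⁅⁆ x (proj₂ p)) q ∷ unit∈Ker ps x h

-- The row is reduced by the pivots in turn until it vanishes or supplies a new pivot. By the last
-- component the reduction creates no entry at a pivot passed before, as `Triangular` demands.
insert : (ps : List (Fin n × Vec Bool n)) (r : Vec Bool n) → Triangular ps →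
  ∃ λ qs → Triangular qs × (∀ y → Ker (rowsOf qs) y ⇔ (Ker (rowsOf ps) y × r · y ≡ false)) ×
    (∀ x → lookup r x ≡ false → All (λ p → lookup (proj₂ p) x ≡ false) ps → All (λ p → lookup (proj₂ p) x ≡ false) qs)
insert [] r _ with ≡𝟘⊎∋ r
... | inj₁ refl = [] , tt , (λ y → mk⇔ (λ _ → [] , 𝟘-· y) (λ _ → [])) , λ _ _ _ → []
... | inj₂ (x , rx) = (x , r) ∷ [] , (rx , [] , tt) , (λ y → mk⇔ (λ { (p ∷ []) → [] , p }) (λ { (_ , p) → p ∷ [] })) , λ _ rx _ → rx ∷ []
insert ((x , s) ∷ ps) r (sx , absent-x , tri) with lookup r x in rx
... | false with insert ps r tri
...   | qs , tri′ , eq , vanish = (x , s) ∷ qs , (sx , vanish x rx absent-x , tri′)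
        , (λ y → mk⇔ (λ { (p ∷ k) → let (k′ , q) = to (eq y) k in p ∷ k′ , q }) (λ { (p ∷ k , q) → p ∷ from (eq y) (k , q) }))
        , λ { z rz (p ∷ h) → p ∷ vanish z rz h }
insert ((x , s) ∷ ps) r (sx , absent-x , tri) | true with insert ps (r ⊕ s) tri
...   | qs , tri′ , eq , vanish = (x , s) ∷ qs
        , (sx , vanish x (trans (⊕-lookup r s x) (cong₂ _xor_ rx sx)) absent-x , tri′)
        , (λ y → mk⇔
            (λ { (p ∷ k) → let (k′ , q) = to (eq y) k in p ∷ k′ , trans (sym (drop-s y p)) q })
            (λ { (p ∷ k , q) → p ∷ from (eq y) (k , trans (drop-s y p) q) }))
        , λ { z rz (p ∷ h) → p ∷ vanish z (trans (⊕-lookup r s z) (cong₂ _xor_ rz p)) h }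
  where
  drop-s : ∀ y → s · y ≡ false → (r ⊕ s) · y ≡ r · y
  drop-s y p = trans (·-⊕ˡ r s y) (trans (cong (r · y xor_) p) (xor-identityʳ (r · y)))

triangulate : (R : List (Vec Bool n)) → ∃ λ ps → Triangular ps × ∀ y → Ker (rowsOf ps) y ⇔ Ker R y
triangulate [] = [] , tt , λ y → mk⇔ id id
triangulate (r ∷ R) with triangulate R
... | ps , tri , eq with insert ps r tri
...   | qs , tri′ , eq′ , _ = qs , tri′ , λ y → mk⇔
        (λ k → let (k′ , q) = to (eq′ y) k in q ∷ to (eq y) k′) (λ { (q ∷ k) → from (eq′ y) (from (eq y) k , q) })

all-live : (u : Vec (Vec Bool n) ρ) → State (KerV u) u
all-live u = record
  { live = λ _ → true ; d = ⁅_⁆ ; d-live = λ _ _ → refl ; d-supp = λ _ _ () ; u-supp = λ _ ()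
  ; K⇒u = λ _ k → k ; K⇒d = λ y _ e → sym (⁅⁆-· e y) ; ⇒K = λ _ k _ → k }

State-map : {K L : Vec Bool n → Set} {u : Vec (Vec Bool n) ρ} → (∀ y → K y → L y) → (∀ y → L y → K y) → State K u → State L u
State-map K⇒L L⇒K s = record
  { live = live ; d = d ; d-live = d-live ; d-supp = d-supp ; u-supp = u-supp
  ; K⇒u = λ y → K⇒u y ∘ L⇒K y ; K⇒d = λ y → K⇒d y ∘ L⇒K y ; ⇒K = λ y k h → K⇒L y (⇒K y k h) }
  where
  open State s

-- The rows are imposed from the last to the first. At its turn the pivot of a row is still
-- unconstrained, so the row is solved for it and the rows `u` stay unchanged.
triangular-State : (u : Vec (Vec Bool n) ρ) (ps : List (Fin n × Vec Bool n)) → Triangular ps →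
  All (λ p → column u (proj₁ p) ≡ 𝟘) ps → State (λ y → KerV u y × Ker (rowsOf ps) y) u
triangular-State u [] _ _ = State-map (λ y k → k , []) (λ y → proj₁) (all-live u)
triangular-State u ((x , r) ∷ ps) (rx , absent-x , tri) (ux ∷ h) = State-map
  (λ { y ((k , ks) , p) → k , p ∷ ks }) (λ { y (k , p ∷ ks) → (k , ks) , p })
  (solve-for (triangular-State u ps tri h) x r (𝟘-column⇒Ker u x ux , unit∈Ker ps x absent-x) rx)

-- Sums and multiplicities over lists of elements

occ : Fin n → List (Fin n) → ℕ
occ = count _≟_

sumOver : (Fin n → Bool) → List (Fin n) → Bool
sumOver g []       = false
sumOver g (e ∷ es) = g e xor sumOver g es

vecOf : List (Fin n) → Vec Bool n
vecOf []       = 𝟘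
vecOf (e ∷ es) = ⁅ e ⁆ ⊕ vecOf es

vecOf-· : (es : List (Fin n)) (y : Vec Bool n) → vecOf es · y ≡ sumOver (lookup y) es
vecOf-· []       y = 𝟘-· y
vecOf-· (e ∷ es) y = trans (·-⊕ˡ ⁅ e ⁆ (vecOf es) y) (cong₂ _xor_ (⁅⁆-· e y) (vecOf-· es y))

occ-++ : (e : Fin n) (xs ys : List (Fin n)) → occ e (xs ++ ys) ≡ occ e xs + occ e ys
occ-++ e []       ys = refl
occ-++ e (x ∷ xs) ys = trans (cong ((if Relation.Nullary.does (e ≟ x) then 1 else 0) +_) (occ-++ e xs ys))
  (sym (ℕ.+-assoc (if Relation.Nullary.does (e ≟ x) then 1 else 0) (occ e xs) (occ e ys)))

sumOver-++ : (g : Fin n → Bool) (xs ys : List (Fin n)) → sumOver g (xs ++ ys) ≡ sumOver g xs xor sumOver g ys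
sumOver-++ g []       ys = refl
sumOver-++ g (x ∷ xs) ys = trans (cong (g x xor_) (sumOver-++ g xs ys)) (sym (xor-assoc (g x) (sumOver g xs) (sumOver g ys)))

occ-∈ : {e : Fin n} {xs : List (Fin n)} → e ∈ₗ xs → 1 ≤ occ e xs
occ-∈ {e = e} {x ∷ xs} (Anyₗ.here refl) with e ≟ e
... | yes _ = s≤s z≤n
... | no ne = ⊥-elim (ne refl)
occ-∈ {e = e} {x ∷ xs} (Anyₗ.there e∈) with e ≟ x
... | yes _ = s≤s z≤n
... | no _ = occ-∈ e∈

odd : ℕ → Bool
odd zero    = false
odd (suc k) = not (odd k)

odd-+ : ∀ a b → odd (a + b) ≡ odd a xor odd b
odd-+ zero    b = refl
odd-+ (suc a) b = trans (cong not (odd-+ a b)) (Bool.not-distribˡ-xor (odd a) (odd b))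

vecOf-lookup : (es : List (Fin n)) (e : Fin n) → lookup (vecOf es) e ≡ odd (occ e es)
vecOf-lookup []       e = 𝟘-lookup e
vecOf-lookup (x ∷ es) e = trans (⊕-lookup ⁅ x ⁆ (vecOf es) e) (trans (cong₂ _xor_ (first (e ≟ x)) (vecOf-lookup es e))
  (sym (odd-+ (if Relation.Nullary.does (e ≟ x) then 1 else 0) (occ e es))))
  where
  first : (d : Dec (e ≡ x)) → lookup ⁅ x ⁆ e ≡ odd (if Relation.Nullary.does d then 1 else 0)
  first (yes refl) = ⁅⁆-self e
  first (no e≢x)   = ⁅⁆-≢ x e (e≢x ∘ sym)

·-enumerated : (S y : Vec Bool n) (es : List (Fin n)) → (∀ e → occ e es ≡ 1) →
  S · y ≡ sumOver (λ e → lookup S e ∧ lookup y e) es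
·-enumerated {n} S y es once = trans (cong (_· y) (lookup-ext {x = S} {y = chosen es} λ e → sym (trans (entry es e) (cong (λ k → odd k ∧ lookup S e) (once e))))) (value es)
  where
  chosen : List (Fin n) → Vec Bool n
  chosen []       = 𝟘
  chosen (e ∷ es) = (if lookup S e then ⁅ e ⁆ else 𝟘) ⊕ chosen es
  value : ∀ es → chosen es · y ≡ sumOver (λ e → lookup S e ∧ lookup y e) es
  value []       = 𝟘-· y
  value (e ∷ es) = trans (·-⊕ˡ (if lookup S e then ⁅ e ⁆ else 𝟘) (chosen es) y) (cong₂ _xor_ (first (lookup S e)) (value es))
    where
    first : ∀ b → (if b then ⁅ e ⁆ else 𝟘) · y ≡ b ∧ lookup y e
    first true  = ⁅⁆-· e y
    first false = 𝟘-· y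
  entry : ∀ es e → lookup (chosen es) e ≡ odd (occ e es) ∧ lookup S e
  entry []       e = 𝟘-lookup e
  entry (x ∷ es) e = trans (⊕-lookup (if lookup S x then ⁅ x ⁆ else 𝟘) (chosen es) e) (trans (cong₂ _xor_ (first (e ≟ x) (lookup S x) refl) (entry es e))
    (trans (sym (∧-distribʳ-xor (lookup S e) (odd (if Relation.Nullary.does (e ≟ x) then 1 else 0)) (odd (occ e es))))
      (cong (_∧ lookup S e) (sym (odd-+ (if Relation.Nullary.does (e ≟ x) then 1 else 0) (occ e es))))))
    where
    first : (d : Dec (e ≡ x)) (b : Bool) → lookup S x ≡ b →
      lookup (if b then ⁅ x ⁆ else 𝟘) e ≡ odd (if Relation.Nullary.does d then 1 else 0) ∧ lookup S e
    first (yes refl) true  eq = trans (⁅⁆-self e) (sym eq)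
    first (yes refl) false eq = trans (𝟘-lookup e) (sym eq)
    first (no e≢x)   true  eq = ⁅⁆-≢ x e (e≢x ∘ sym)
    first (no e≢x)   false eq = 𝟘-lookup e

-- Trees with an apex: a node is the list of its legs, which lead to the apex, and of its branches.
-- The marks of legs record a functional on the space described by a tree.

data Item (n : ℕ) : Set where
  leg    : Bool → Fin n → Item n
  branch : Fin n → List (Item n) → Item n

Tree∗ : ℕ → Set
Tree∗ n = List (Item n)

tops : Tree∗ n → List (Fin n)
tops []                = []
tops (leg _ e ∷ is)    = e ∷ tops is
tops (branch e _ ∷ is) = e ∷ tops is

legs : Bool → Tree∗ n → List (Fin n)
legs b []                 = []
legs b (leg c e ∷ is)     = if b xor c then legs b is else e ∷ legs b is
legs b (branch e ks ∷ is) = legs b ks ++ legs b is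

branches : Tree∗ n → List (Fin n)
branches []                 = []
branches (leg _ _ ∷ is)     = branches is
branches (branch e ks ∷ is) = e ∷ branches ks ++ branches is

allLegs : Tree∗ n → List (Fin n)
allLegs is = legs false is ++ legs true is

-- y is orthogonal to the stars of all nodes below a node
Below : Vec Bool n → Tree∗ n → Set
Below y []                 = ⊤
Below y (leg _ _ ∷ is)     = Below y is
Below y (branch e ks ∷ is) = (lookup y e xor sumOver (lookup y) (tops ks) ≡ false × Below y ks) × Below y is

OnTree : Vec Bool n → Tree∗ n → Set
OnTree y T = sumOver (lookup y) (tops T) ≡ false × Below y T

tops-++ : (is js : Tree∗ n) → tops (is ++ js) ≡ tops is ++ tops js
tops-++ []                js = refl
tops-++ (leg _ e ∷ is)    js = cong (e ∷_) (tops-++ is js)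
tops-++ (branch e _ ∷ is) js = cong (e ∷_) (tops-++ is js)

legs-++ : ∀ b (is js : Tree∗ n) → legs b (is ++ js) ≡ legs b is ++ legs b js
legs-++ b [] js = refl
legs-++ b (leg c e ∷ is) js with b xor c
... | true  = legs-++ b is js
... | false = cong (e ∷_) (legs-++ b is js)
legs-++ b (branch e ks ∷ is) js = trans (cong (legs b ks ++_) (legs-++ b is js)) (sym (List.++-assoc (legs b ks) (legs b is) (legs b js)))

branches-++ : (is js : Tree∗ n) → branches (is ++ js) ≡ branches is ++ branches js
branches-++ []                 js = refl
branches-++ (leg _ _ ∷ is)     js = branches-++ is js
branches-++ (branch e ks ∷ is) js = cong (e ∷_) (trans (cong (branches ks ++_) (branches-++ is js))
  (sym (List.++-assoc (branches ks) (branches is) (branches js))))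

Below-++ : ∀ {y : Vec Bool n} (is js : Tree∗ n) → Below y (is ++ js) ⇔ (Below y is × Below y js)
Below-++ []                 js = mk⇔ (tt ,_) proj₂
Below-++ (leg _ _ ∷ is)     js = Below-++ is js
Below-++ (branch e ks ∷ is) js = mk⇔ (λ (p , q) → let (r , s) = to (Below-++ is js) q in (p , r) , s)
  (λ ((p , r) , s) → p , from (Below-++ is js) (r , s))

occ-legs-++ : ∀ b x (is js : Tree∗ n) → occ x (legs b (is ++ js)) ≡ occ x (legs b is) + occ x (legs b js)
occ-legs-++ b x is js = trans (cong (occ x) (legs-++ b is js)) (occ-++ x (legs b is) (legs b js))

occ-branches-++ : ∀ x (is js : Tree∗ n) → occ x (branches (is ++ js)) ≡ occ x (branches is) + occ x (branches js)
occ-branches-++ x is js = trans (cong (occ x) (branches-++ is js)) (occ-++ x (branches is) (branches js))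

sum-tops-++ : (g : Fin n → Bool) (is js : Tree∗ n) → sumOver g (tops (is ++ js)) ≡ sumOver g (tops is) xor sumOver g (tops js)
sum-tops-++ g is js = trans (cong (sumOver g) (tops-++ is js)) (sumOver-++ g (tops is) (tops js))

sumOver-occ : (g : Vec Bool n) (xs ys : List (Fin n)) → (∀ x → occ x xs ≡ occ x ys) → sumOver (lookup g) xs ≡ sumOver (lookup g) ys
sumOver-occ g xs ys eq = trans (sym (vecOf-· xs g)) (trans
  (cong (_· g) (lookup-ext {x = vecOf xs} {y = vecOf ys} λ x → trans (vecOf-lookup xs x) (trans (cong odd (eq x)) (sym (vecOf-lookup ys x)))))
  (vecOf-· ys g))

-- Orthogonality to the star at the lower end of a branch allows the branch to be replaced by the
-- tops of its subtree; repeating this ends with the legs.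
tops≡legs : (y : Vec Bool n) (is : Tree∗ n) → Below y is →
  sumOver (lookup y) (tops is) ≡ sumOver (lookup y) (legs false is) xor sumOver (lookup y) (legs true is)
tops≡legs y [] _ = refl
tops≡legs y (leg false e ∷ is) h = trans (cong (lookup y e xor_) (tops≡legs y is h))
  (sym (xor-assoc (lookup y e) (sumOver (lookup y) (legs false is)) (sumOver (lookup y) (legs true is))))
tops≡legs y (leg true e ∷ is) h = trans (cong (lookup y e xor_) (tops≡legs y is h))
  (solve 3 (λ a b c → a :+ (b :+ c) := b :+ (a :+ c)) refl (lookup y e) (sumOver (lookup y) (legs false is)) (sumOver (lookup y) (legs true is)))
tops≡legs y (branch e ks ∷ is) ((p , h) , h′) = trans
  (cong₂ _xor_ (trans (xor≡false⇒≡ {lookup y e} p) (tops≡legs y ks h)) (tops≡legs y is h′))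
  (trans (xor-interchange (s false ks) (s true ks) (s false is) (s true is))
    (sym (cong₂ _xor_ (sumOver-++ (lookup y) (legs false ks) (legs false is)) (sumOver-++ (lookup y) (legs true ks) (legs true is)))))
  where
  s : Bool → Tree∗ _ → Bool
  s b js = sumOver (lookup y) (legs b js)

allLegs-sum : (y : Vec Bool n) (is : Tree∗ n) → Below y is → sumOver (lookup y) (allLegs is) ≡ sumOver (lookup y) (tops is)
allLegs-sum y is h = trans (sumOver-++ (lookup y) (legs false is) (legs true is)) (sym (tops≡legs y is h))

-- Two equivalences of trees: _≈_ is a congruence for nodes, whereas _≃_ allows for rerooting.

record _≃_ (is js : Tree∗ n) : Set where
  constructor equivalent
  field
    ≃-legs     : ∀ b x → occ x (legs b is) ≡ occ x (legs b js)
    ≃-branches : ∀ x → occ x (branches is) ≡ occ x (branches js)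
    ≃-on       : ∀ y → OnTree y is ⇔ OnTree y js
open _≃_

≃-refl : {is : Tree∗ n} → is ≃ is
≃-refl = equivalent (λ _ _ → refl) (λ _ → refl) λ _ → mk⇔ id id

≃-trans : {is js ks : Tree∗ n} → is ≃ js → js ≃ ks → is ≃ ks
≃-trans p q = equivalent (λ b x → trans (≃-legs p b x) (≃-legs q b x)) (λ x → trans (≃-branches p x) (≃-branches q x))
  λ y → mk⇔ (to (≃-on q y) ∘ to (≃-on p y)) (from (≃-on p y) ∘ from (≃-on q y))

record _≈_ (is js : Tree∗ n) : Set where
  constructor same
  field
    ≈-legs     : ∀ b x → occ x (legs b is) ≡ occ x (legs b js)
    ≈-branches : ∀ x → occ x (branches is) ≡ occ x (branches js)
    ≈-tops     : ∀ g → sumOver g (tops is) ≡ sumOver g (tops js)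
    ≈-below    : ∀ y → Below y is ⇔ Below y js
open _≈_

≈⇒≃ : {is js : Tree∗ n} → is ≈ js → is ≃ js
≈⇒≃ p = equivalent (≈-legs p) (≈-branches p) λ y → mk⇔
  (λ (q , h) → trans (sym (≈-tops p (lookup y))) q , to (≈-below p y) h)
  (λ (q , h) → trans (≈-tops p (lookup y)) q , from (≈-below p y) h)

++-≈-comm : (is js : Tree∗ n) → (is ++ js) ≈ (js ++ is)
++-≈-comm is js = same
  (λ b x → trans (occ-legs-++ b x is js) (trans (ℕ.+-comm (occ x (legs b is)) _) (sym (occ-legs-++ b x js is))))
  (λ x → trans (occ-branches-++ x is js) (trans (ℕ.+-comm (occ x (branches is)) _) (sym (occ-branches-++ x js is))))
  (λ g → trans (sum-tops-++ g is js) (trans (xor-comm (sumOver g (tops is)) _) (sym (sum-tops-++ g js is))))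
  λ y → mk⇔ (λ h → let (p , q) = to (Below-++ is js) h in from (Below-++ js is) (q , p))
            (λ h → let (p , q) = to (Below-++ js is) h in from (Below-++ is js) (q , p))

++-≈ : {is is′ js js′ : Tree∗ n} → is ≈ is′ → js ≈ js′ → (is ++ js) ≈ (is′ ++ js′)
++-≈ {is = is} {is′} {js} {js′} p q = same
  (λ b x → trans (occ-legs-++ b x is js) (trans (cong₂ _+_ (≈-legs p b x) (≈-legs q b x)) (sym (occ-legs-++ b x is′ js′))))
  (λ x → trans (occ-branches-++ x is js) (trans (cong₂ _+_ (≈-branches p x) (≈-branches q x)) (sym (occ-branches-++ x is′ js′))))
  (λ g → trans (sum-tops-++ g is js) (trans (cong₂ _xor_ (≈-tops p g) (≈-tops q g)) (sym (sum-tops-++ g is′ js′))))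
  λ y → mk⇔ (λ h → let (a , b) = to (Below-++ is js) h in from (Below-++ is′ js′) (to (≈-below p y) a , to (≈-below q y) b))
            (λ h → let (a , b) = to (Below-++ is′ js′) h in from (Below-++ is js) (from (≈-below p y) a , from (≈-below q y) b))

≈-refl : {is : Tree∗ n} → is ≈ is
≈-refl = same (λ _ _ → refl) (λ _ → refl) (λ _ → refl) λ _ → mk⇔ id id

≈-trans : {is js ks : Tree∗ n} → is ≈ js → js ≈ ks → is ≈ ks
≈-trans p q = same (λ b x → trans (≈-legs p b x) (≈-legs q b x)) (λ x → trans (≈-branches p x) (≈-branches q x))
  (λ g → trans (≈-tops p g) (≈-tops q g)) λ y → mk⇔ (to (≈-below q y) ∘ to (≈-below p y)) (from (≈-below p y) ∘ from (≈-below q y))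

≈-reflexive : {is js : Tree∗ n} → is ≡ js → is ≈ js
≈-reflexive refl = ≈-refl

≈-shift : (is js : Tree∗ n) (i : Item n) → (is ++ i ∷ js) ≈ (i ∷ is ++ js)
≈-shift is js i = ≈-trans (≈-reflexive (sym (List.++-assoc is (i ∷ []) js))) (++-≈ (++-≈-comm is (i ∷ [])) ≈-refl)

-- Both ends of `e` have the same form, `e` together with the other items there. The condition at
-- the root and the one below `e` are exchanged, so the trees agree on `OnTree` but not on `Below`.
reroot : (e : Fin n) (ks is : Tree∗ n) → (branch e ks ∷ is) ≃ (branch e is ∷ ks)
reroot e ks is = equivalent
  (λ b x → trans (occ-++ x (legs b ks) (legs b is)) (trans (ℕ.+-comm (occ x (legs b ks)) _) (sym (occ-++ x (legs b is) (legs b ks)))))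
  (λ x → cong ((if Relation.Nullary.does (x ≟ e) then 1 else 0) +_) (trans (occ-++ x (branches ks) (branches is))
    (trans (ℕ.+-comm (occ x (branches ks)) _) (sym (occ-++ x (branches is) (branches ks))))))
  λ y → mk⇔ (λ (p , (q , h) , h′) → q , (p , h′) , h) (λ (p , (q , h) , h′) → q , (p , h′) , h)

at? : Fin n → Fin n → ℕ
at? x e = if Relation.Nullary.does (x ≟ e) then 1 else 0

total : Fin n → Tree∗ n → ℕ
total x is = (occ x (legs false is) + occ x (legs true is)) + occ x (branches is)

≃-total : {is js : Tree∗ n} → is ≃ js → ∀ x → total x is ≡ total x js
≃-total p x = cong₂ _+_ (cong₂ _+_ (≃-legs p false x) (≃-legs p true x)) (≃-branches p x)

total-leg : ∀ (x : Fin n) b e is → total x (leg b e ∷ is) ≡ at? x e + total x is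
total-leg x false e is = trans (cong (_+ occ x (branches is)) (ℕ.+-assoc (at? x e) (occ x (legs false is)) (occ x (legs true is))))
  (ℕ.+-assoc (at? x e) (occ x (legs false is) + occ x (legs true is)) (occ x (branches is)))
total-leg x true e is = trans (cong (_+ occ x (branches is)) (ℕ+.x∙yz≈y∙xz (occ x (legs false is)) (at? x e) (occ x (legs true is))))
  (ℕ.+-assoc (at? x e) (occ x (legs false is) + occ x (legs true is)) (occ x (branches is)))

total-++ : ∀ (x : Fin n) is js → total x (is ++ js) ≡ total x is + total x js
total-++ x is js = trans
  (cong₂ _+_ (trans (cong₂ _+_ (occ-legs-++ false x is js) (occ-legs-++ true x is js))
      (ℕ+.interchange (occ x (legs false is)) (occ x (legs false js)) (occ x (legs true is)) (occ x (legs true js))))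
    (occ-branches-++ x is js))
  (ℕ+.interchange (occ x (legs false is) + occ x (legs true is)) (occ x (legs false js) + occ x (legs true js)) (occ x (branches is)) (occ x (branches js)))

total-branch₁ : ∀ (x : Fin n) e ks → total x (branch e ks ∷ []) ≡ at? x e + total x ks
total-branch₁ x e ks = trans (cong₂ _+_ (cong₂ _+_ (cong (occ x) (List.++-identityʳ (legs false ks))) (cong (occ x) (List.++-identityʳ (legs true ks))))
    (cong (λ l → at? x e + occ x l) (List.++-identityʳ (branches ks))))
  (ℕ+.x∙yz≈y∙xz (occ x (legs false ks) + occ x (legs true ks)) (at? x e) (occ x (branches ks)))

total-branch : ∀ (x : Fin n) e ks is → total x (branch e ks ∷ is) ≡ (at? x e + total x ks) + total x is
total-branch x e ks is = trans (total-++ x (branch e ks ∷ []) is) (cong (_+ total x is) (total-branch₁ x e ks))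

-- The items pre of the current node have been passed; they include the branch back to the former root.
extract : ∀ b (pre is : Tree∗ n) → legs b is ≡ [] ⊎ ∃ λ e → ∃ λ rs → (pre ++ is) ≃ (leg b e ∷ rs)
extract b pre [] = inj₁ refl
extract false pre (leg false e ∷ is) = inj₂ (e , pre ++ is , ≈⇒≃ (≈-shift pre is (leg false e)))
extract true pre (leg true e ∷ is) = inj₂ (e , pre ++ is , ≈⇒≃ (≈-shift pre is (leg true e)))
extract false pre (leg true e ∷ is) with extract false (pre ++ leg true e ∷ []) is
... | inj₁ h = inj₁ h
... | inj₂ (f , rs , eq) = inj₂ (f , rs , ≃-trans (≈⇒≃ (≈-reflexive (sym (List.++-assoc pre (leg true e ∷ []) is)))) eq)
extract true pre (leg false e ∷ is) with extract true (pre ++ leg false e ∷ []) is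
... | inj₁ h = inj₁ h
... | inj₂ (f , rs , eq) = inj₂ (f , rs , ≃-trans (≈⇒≃ (≈-reflexive (sym (List.++-assoc pre (leg false e ∷ []) is)))) eq)
extract b pre (branch e ks ∷ is) with extract b (branch e (pre ++ is) ∷ []) ks
... | inj₂ (f , rs , eq) = inj₂ (f , rs , ≃-trans (≃-trans (≈⇒≃ (≈-shift pre is (branch e ks))) (reroot e ks (pre ++ is))) eq)
... | inj₁ h with extract b (pre ++ branch e ks ∷ []) is
...   | inj₁ h′ = inj₁ (cong₂ _++_ h h′)
...   | inj₂ (f , rs , eq) = inj₂ (f , rs , ≃-trans (≈⇒≃ (≈-reflexive (sym (List.++-assoc pre (branch e ks ∷ []) is)))) eq)

-- The star of a root with leg `e` is also the star of the node at the lower end of a branch `e`. A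
-- tree can thus be hung by one of its legs from a new node.
leg⇔branch : ∀ {y : Vec Bool n} b e rs → OnTree y (leg b e ∷ rs) ⇔ Below y (branch e rs ∷ [])
leg⇔branch b e rs = mk⇔ (λ h → h , tt) proj₁

μ : Vec Bool n → Tree∗ n → Bool
μ y T = sumOver (lookup y) (legs true T)

μ-≃ : {is js : Tree∗ n} → is ≃ js → ∀ y → μ y is ≡ μ y js
μ-≃ {is = is} {js} p y = sumOver-occ y (legs true is) (legs true js) (≃-legs p true)

-- On the tree all legs add up to zero, so the functional is given by the unmarked legs just as well
-- as by the marked ones.
unmarked-legs : (y : Vec Bool n) (T : Tree∗ n) → OnTree y T → sumOver (lookup y) (legs false T) ≡ μ y T
unmarked-legs y T (p , h) = xor≡false⇒≡ (trans (sym (tops≡legs y T h)) p)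

totalF : Fin n → List (Tree∗ n) → ℕ
totalF x []      = 0
totalF x (T ∷ F) = total x T + totalF x F

OnForest : Vec Bool n → List (Tree∗ n) → Set
OnForest y = All (OnTree y)

μF : Vec Bool n → List (Tree∗ n) → Bool
μF y []      = false
μF y (T ∷ F) = μ y T xor μF y F

-- Modulo the stars, S is the sum of the legs marked with the parity of S on their path to the root.
relabel : Vec Bool n → Bool → Tree∗ n → Tree∗ n
relabel S p []                 = []
relabel S p (leg _ e ∷ is)     = leg (lookup S e xor p) e ∷ relabel S p is
relabel S p (branch e ks ∷ is) = branch e (relabel S (p xor lookup S e) ks) ∷ relabel S p is

relabel-tops : ∀ (S : Vec Bool n) p is → tops (relabel S p is) ≡ tops is
relabel-tops S p []                 = refl
relabel-tops S p (leg _ e ∷ is)     = cong (e ∷_) (relabel-tops S p is)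
relabel-tops S p (branch e ks ∷ is) = cong (e ∷_) (relabel-tops S p is)

relabel-total : ∀ (S : Vec Bool n) p is x → total x (relabel S p is) ≡ total x is
relabel-total S p [] x = refl
relabel-total S p (leg b e ∷ is) x = trans (total-leg x (lookup S e xor p) e (relabel S p is))
  (trans (cong (at? x e +_) (relabel-total S p is x)) (sym (total-leg x b e is)))
relabel-total S p (branch e ks ∷ is) x = trans (total-branch x e (relabel S (p xor lookup S e) ks) (relabel S p is))
  (trans (cong₂ (λ a b → (at? x e + a) + b) (relabel-total S (p xor lookup S e) ks x) (relabel-total S p is x)) (sym (total-branch x e ks is)))

relabel-below : ∀ (S : Vec Bool n) p is y → Below y is ⇔ Below y (relabel S p is)
relabel-below S p [] y = mk⇔ id id
relabel-below S p (leg _ e ∷ is) y = relabel-below S p is y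
relabel-below S p (branch e ks ∷ is) y = mk⇔
  (λ ((q , h) , h′) → (trans (cong (λ l → lookup y e xor sumOver (lookup y) l) (relabel-tops S (p xor lookup S e) ks)) q
    , to (relabel-below S (p xor lookup S e) ks y) h) , to (relabel-below S p is y) h′)
  (λ ((q , h) , h′) → (trans (cong (λ l → lookup y e xor sumOver (lookup y) l) (sym (relabel-tops S (p xor lookup S e) ks))) q
    , from (relabel-below S (p xor lookup S e) ks y) h) , from (relabel-below S p is y) h′)

relabel-on : ∀ (S : Vec Bool n) p is y → OnTree y is ⇔ OnTree y (relabel S p is)
relabel-on S p is y = mk⇔
  (λ (q , h) → trans (cong (sumOver (lookup y)) (relabel-tops S p is)) q , to (relabel-below S p is y) h)
  (λ (q , h) → trans (cong (sumOver (lookup y)) (sym (relabel-tops S p is))) q , from (relabel-below S p is y) h)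

labelList : Tree∗ n → List (Fin n)
labelList []                 = []
labelList (leg _ e ∷ is)     = e ∷ labelList is
labelList (branch e ks ∷ is) = e ∷ labelList ks ++ labelList is

occ-labelList : ∀ (x : Fin n) is → occ x (labelList is) ≡ total x is
occ-labelList x [] = refl
occ-labelList x (leg b e ∷ is) = trans (cong (at? x e +_) (occ-labelList x is)) (sym (total-leg x b e is))
occ-labelList x (branch e ks ∷ is) = trans (cong (at? x e +_) (trans (occ-++ x (labelList ks) (labelList is))
  (cong₂ _+_ (occ-labelList x ks) (occ-labelList x is)))) (trans (sym (ℕ.+-assoc (at? x e) (total x ks) (total x is))) (sym (total-branch x e ks is)))

-- For `y` orthogonal to the stars below, the value at a branch is the sum over the tops of its
-- subtree. A branch in `S` therefore has the same effect as toggling the parity `p` in its subtree.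
relabel-sum : ∀ (S y : Vec Bool n) p is → Below y is →
  sumOver (λ e → lookup S e ∧ lookup y e) (labelList is) xor (p ∧ sumOver (lookup y) (tops is)) ≡ μ y (relabel S p is)
relabel-sum S y p [] _ = ∧-zeroʳ p
relabel-sum S y p (leg b e ∷ is) h = go (lookup S e) p (relabel-sum S y p is h)
  where
  D = sumOver (λ e → lookup S e ∧ lookup y e) (labelList is)
  t = sumOver (lookup y) (tops is)
  go : ∀ s p → D xor (p ∧ t) ≡ μ y (relabel S p is) →
    ((s ∧ lookup y e) xor D) xor (p ∧ (lookup y e xor t)) ≡ μ y (leg (s xor p) e ∷ relabel S p is)
  go true  true  ih = trans (solve 3 (λ a d t → (a :+ d) :+ (a :+ t) := (d :+ t) :+ (a :+ a)) refl (lookup y e) D t)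
    (trans (cong ((D xor t) xor_) (xor-same (lookup y e))) (trans (xor-identityʳ (D xor t)) ih))
  go true  false ih = trans (xor-assoc (lookup y e) D false) (cong (lookup y e xor_) ih)
  go false true  ih = trans (solve 3 (λ a d t → d :+ (a :+ t) := a :+ (d :+ t)) refl (lookup y e) D t) (cong (lookup y e xor_) ih)
  go false false ih = ih
relabel-sum S y p (branch e ks ∷ is) ((q , h) , h′) = begin
  ((s ∧ lookup y e) xor sumOver g (labelList ks ++ labelList is)) xor (p ∧ (lookup y e xor t))
    ≡⟨ cong₂ (λ a b → ((s ∧ a) xor b) xor (p ∧ (a xor t))) (xor≡false⇒≡ {lookup y e} q) (sumOver-++ g (labelList ks) (labelList is)) ⟩
  ((s ∧ κ) xor (D₁ xor D₂)) xor (p ∧ (κ xor t))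
    ≡⟨ solve 6 (λ s p κ t a b → (s :* κ :+ (a :+ b)) :+ p :* (κ :+ t) := (a :+ (p :+ s) :* κ) :+ (b :+ p :* t)) refl s p κ t D₁ D₂ ⟩
  (D₁ xor ((p xor s) ∧ κ)) xor (D₂ xor (p ∧ t))
    ≡⟨ cong₂ _xor_ (relabel-sum S y (p xor s) ks h) (relabel-sum S y p is h′) ⟩
  μ y (relabel S (p xor s) ks) xor μ y (relabel S p is)
    ≡⟨ sumOver-++ (lookup y) (legs true (relabel S (p xor s) ks)) (legs true (relabel S p is)) ⟨
  _ ∎
  where
  open ≡-Reasoning
  g = λ e → lookup S e ∧ lookup y e
  s = lookup S e
  t = sumOver (lookup y) (tops is)
  κ = sumOver (lookup y) (tops ks)
  D₁ = sumOver g (labelList ks)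
  D₂ = sumOver g (labelList is)

-- How a functional meets a tree

Neutral : Tree∗ n → Set
Neutral T = ∀ y → OnTree y T → μ y T ≡ false

record Mixed (T : Tree∗ n) : Set where
  field
    eᵃ eᵇ   : Fin n
    rsᵃ rsᵇ : Tree∗ n
    ≃ᵃ      : T ≃ (leg false eᵃ ∷ rsᵃ)
    ≃ᵇ      : T ≃ (leg true eᵇ ∷ rsᵇ)

neutral-or-mixed : (T : Tree∗ n) → Neutral T ⊎ Mixed T
neutral-or-mixed T with extract true [] T
... | inj₁ no-leg = inj₁ λ y _ → cong (sumOver (lookup y)) no-leg
... | inj₂ (eᵇ , rsᵇ , ≃ᵇ) with extract false [] T
...   | inj₁ no-leg = inj₁ λ y h → trans (sym (unmarked-legs y T h)) (cong (sumOver (lookup y)) no-leg)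
...   | inj₂ (eᵃ , rsᵃ , ≃ᵃ) = inj₂ record { ≃ᵃ = ≃ᵃ ; ≃ᵇ = ≃ᵇ }

record Single (T : Tree∗ n) : Set where
  field
    e      : Fin n
    rs     : Tree∗ n
    totals : ∀ x → total x T ≡ at? x e + total x rs
    on     : ∀ y → OnTree y T ⇔ Below y (branch e rs ∷ [])
    marks  : ∀ y → OnTree y T → μ y T ≡ lookup y e

record Double (T : Tree∗ n) : Set where
  field
    a a′ b b′ : Fin n
    a≢a′      : a ≢ a′
    b≢b′      : b ≢ b′
    a∈        : 1 ≤ occ a (legs false T)
    a′∈       : 1 ≤ occ a′ (legs false T)
    b∈        : 1 ≤ occ b (legs true T)
    b′∈       : 1 ≤ occ b′ (legs true T)

at?-self : (e : Fin n) → at? e e ≡ 1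
at?-self e with e ≟ e
... | yes _ = refl
... | no ne = ⊥-elim (ne refl)

leg∈ : ∀ b e (rs : Tree∗ n) {T} → T ≃ (leg b e ∷ rs) → 1 ≤ occ e (legs b T)
leg∈ false e rs p = subst (1 ≤_) (sym (trans (≃-legs p false e) (cong (_+ occ e (legs false rs)) (at?-self e)))) (s≤s z≤n)
leg∈ true  e rs p = subst (1 ≤_) (sym (trans (≃-legs p true e) (cong (_+ occ e (legs true rs)) (at?-self e)))) (s≤s z≤n)

rest∈ : ∀ b e {f} (rs : Tree∗ n) {T} → T ≃ (leg b e ∷ rs) → f ∈ₗ legs b rs → 1 ≤ occ f (legs b T)
rest∈ false e {f} rs p f∈ = subst (1 ≤_) (sym (≃-legs p false f)) (ℕ.≤-trans (occ-∈ f∈) (ℕ.m≤n+m _ (at? f e)))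
rest∈ true  e {f} rs p f∈ = subst (1 ≤_) (sym (≃-legs p true f)) (ℕ.≤-trans (occ-∈ f∈) (ℕ.m≤n+m _ (at? f e)))

rest≢ : ∀ b e {f} (rs : Tree∗ n) {T} → T ≃ (leg b e ∷ rs) → (∀ x → total x T ≤ 1) → f ∈ₗ legs b rs → e ≢ f
rest≢ b e rs p once f∈ refl = ℕ.<-irrefl refl (ℕ.≤-trans (s≤s (ℕ.≤-trans (occ-∈ f∈) (part b))) (ℕ.≤-trans
  (ℕ.≤-reflexive (trans (cong (_+ total e rs) (sym (at?-self e))) (trans (sym (total-leg e b e rs)) (sym (≃-total p e))))) (once e)))
  where
  part : ∀ c → occ e (legs c rs) ≤ total e rs
  part false = ℕ.≤-trans (ℕ.m≤m+n _ (occ e (legs true rs))) (ℕ.m≤m+n _ (occ e (branches rs)))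
  part true  = ℕ.≤-trans (ℕ.m≤n+m _ (occ e (legs false rs))) (ℕ.m≤m+n _ (occ e (branches rs)))

-- If one of the marks occurs on a single leg, the functional is the value at this leg; for the
-- unmarked side this is `unmarked-legs`. Rerooting there hangs the whole tree by that leg.
single-or-double : (T : Tree∗ n) → Mixed T → (∀ x → total x T ≤ 1) → Single T ⊎ Double T
single-or-double T M once = decide (legs true rsᵇ) refl (legs false rsᵃ) refl
  where
  open Mixed M
  decide : ∀ l → legs true rsᵇ ≡ l → ∀ l′ → legs false rsᵃ ≡ l′ → Single T ⊎ Double T
  decide [] eq _ _ = inj₁ record
    { e = eᵇ ; rs = rsᵇ ; totals = λ x → trans (≃-total ≃ᵇ x) (total-leg x true eᵇ rsᵇ)
    ; on = λ y → mk⇔ (to (leg⇔branch true eᵇ rsᵇ) ∘ to (≃-on ≃ᵇ y)) (from (≃-on ≃ᵇ y) ∘ from (leg⇔branch true eᵇ rsᵇ))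
    ; marks = λ y _ → trans (μ-≃ ≃ᵇ y) (trans (cong (λ l → lookup y eᵇ xor sumOver (lookup y) l) eq) (xor-identityʳ (lookup y eᵇ))) }
  decide (b′ ∷ _) _ [] eq = inj₁ record
    { e = eᵃ ; rs = rsᵃ ; totals = λ x → trans (≃-total ≃ᵃ x) (total-leg x false eᵃ rsᵃ)
    ; on = λ y → mk⇔ (to (leg⇔branch false eᵃ rsᵃ) ∘ to (≃-on ≃ᵃ y)) (from (≃-on ≃ᵃ y) ∘ from (leg⇔branch false eᵃ rsᵃ))
    ; marks = λ y h → trans (sym (unmarked-legs y T h)) (trans (sumOver-occ y (legs false T) (eᵃ ∷ legs false rsᵃ) (≃-legs ≃ᵃ false))
        (trans (cong (λ l → lookup y eᵃ xor sumOver (lookup y) l) eq) (xor-identityʳ (lookup y eᵃ)))) }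
  decide (b′ ∷ l) eq (a′ ∷ l′) eq′ = inj₂ record
    { a = eᵃ ; a′ = a′ ; b = eᵇ ; b′ = b′
    ; a≢a′ = rest≢ false eᵃ rsᵃ ≃ᵃ once a′∈ ; b≢b′ = rest≢ true eᵇ rsᵇ ≃ᵇ once b′∈
    ; a∈ = leg∈ false eᵃ rsᵃ ≃ᵃ ; a′∈ = rest∈ false eᵃ rsᵃ ≃ᵃ a′∈
    ; b∈ = leg∈ true eᵇ rsᵇ ≃ᵇ ; b′∈ = rest∈ true eᵇ rsᵇ ≃ᵇ b′∈ }
    where
    a′∈ : a′ ∈ₗ legs false rsᵃ
    a′∈ = subst (a′ ∈ₗ_) (sym eq′) (Anyₗ.here refl)
    b′∈ : b′ ∈ₗ legs true rsᵇ
    b′∈ = subst (b′ ∈ₗ_) (sym eq) (Anyₗ.here refl)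

labelsF : List (Tree∗ n) → List (Fin n)
labelsF []      = []
labelsF (T ∷ F) = labelList T ++ labelsF F

occ-labelsF : ∀ (x : Fin n) F → occ x (labelsF F) ≡ totalF x F
occ-labelsF x []      = refl
occ-labelsF x (T ∷ F) = trans (occ-++ x (labelList T) (labelsF F)) (cong₂ _+_ (occ-labelList x T) (occ-labelsF x F))

record Sorted (S : Vec Bool n) (F : List (Tree∗ n)) : Set where
  field
    {I P}   : List (Tree∗ n)
    mixed   : All Mixed I
    neutral : All Neutral P
    on      : ∀ y → OnForest y F ⇔ (OnForest y I × OnForest y P)
    marks   : ∀ y → OnForest y F → sumOver (λ e → lookup S e ∧ lookup y e) (labelsF F) ≡ μF y I
    totals  : ∀ x → totalF x F ≡ totalF x I + totalF x P

sort : (S : Vec Bool n) (F : List (Tree∗ n)) → Sorted S F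
sort S [] = record { mixed = [] ; neutral = [] ; on = λ y → mk⇔ (λ _ → [] , []) (λ _ → []) ; marks = λ _ _ → refl ; totals = λ _ → refl }
sort S (T ∷ F) with sort S F | neutral-or-mixed (relabel S false T)
... | record { I = I ; P = P ; mixed = mixed ; neutral = neutral ; on = on ; marks = marks ; totals = totals } | inj₁ nt = record
  { I = I ; P = relabel S false T ∷ P ; mixed = mixed ; neutral = nt ∷ neutral
  ; on = λ y → mk⇔ (λ { (p ∷ ps) → let (i , q) = to (on y) ps in i , to (relabel-on S false T y) p ∷ q })
                   (λ { (i , p ∷ q) → from (relabel-on S false T y) p ∷ from (on y) (i , q) })
  ; marks = λ { y (p ∷ ps) → trans (sumOver-++ (λ e → lookup S e ∧ lookup y e) (labelList T) (labelsF F))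
      (cong₂ _xor_ (trans (trans (sym (xor-identityʳ (sumOver (λ e → lookup S e ∧ lookup y e) (labelList T)))) (relabel-sum S y false T (proj₂ p))) (nt y (to (relabel-on S false T y) p))) (marks y ps)) }
  ; totals = λ x → trans (cong₂ _+_ (sym (relabel-total S false T x)) (totals x)) (ℕ+.x∙yz≈y∙xz (total x (relabel S false T)) (totalF x I) (totalF x P)) }
... | record { I = I ; P = P ; mixed = mixed ; neutral = neutral ; on = on ; marks = marks ; totals = totals } | inj₂ mx = record
  { I = relabel S false T ∷ I ; P = P ; mixed = mx ∷ mixed ; neutral = neutral
  ; on = λ y → mk⇔ (λ { (p ∷ ps) → let (i , q) = to (on y) ps in to (relabel-on S false T y) p ∷ i , q })
                   (λ { (p ∷ i , q) → from (relabel-on S false T y) p ∷ from (on y) (i , q) })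
  ; marks = λ { y (p ∷ ps) → trans (sumOver-++ (λ e → lookup S e ∧ lookup y e) (labelList T) (labelsF F))
      (cong₂ _xor_ (trans (sym (xor-identityʳ (sumOver (λ e → lookup S e ∧ lookup y e) (labelList T)))) (relabel-sum S y false T (proj₂ p))) (marks y ps)) }
  ; totals = λ x → trans (cong₂ _+_ (sym (relabel-total S false T x)) (totals x)) (sym (ℕ.+-assoc (total x (relabel S false T)) (totalF x I) (totalF x P))) }

-- The space that arises from a forest by imposing the marked functional; LB are the marked loops.
Marked : List (Tree∗ n) → List (Tree∗ n) → List (Fin n) → Vec Bool n → Set
Marked I P LB y = (OnForest y I × OnForest y P) × μF y I xor sumOver (lookup y) LB ≡ false

-- The columns of M(K₃) with every edge doubled, or those of M(K₄): six points of the Fano plane,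
-- the seventh being `true ∷ true ∷ true ∷ []`.
Found : (Vec Bool n → Set) → Set
Found {n} K =
  (∃ λ (u : Vec (Vec Bool n) 2) → State K u × ∀ p → p ≢ 𝟘 → ∃ λ e → ∃ λ f → e ≢ f × column u e ≡ p × column u f ≡ p) ⊎
  (∃ λ (u : Vec (Vec Bool n) 3) → State K u × ∀ p → p ≢ 𝟘 → p ≢ true ∷ true ∷ true ∷ [] → ∃ λ e → column u e ≡ p)

-- Rows of a tree in triangular form, with the branches as pivots

branchRows : Tree∗ n → List (Fin n × Vec Bool n)
branchRows []                 = []
branchRows (leg _ _ ∷ is)     = branchRows is
branchRows (branch e ks ∷ is) = (e , vecOf (e ∷ allLegs ks)) ∷ branchRows ks ++ branchRows is

rowsOf-++ : (ps qs : List (Fin n × Vec Bool n)) → rowsOf (ps ++ qs) ≡ rowsOf ps ++ rowsOf qs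
rowsOf-++ ps qs = List.map-++ proj₂ ps qs

branchRows-Ker : ∀ (y : Vec Bool n) is → Below y is ⇔ Ker (rowsOf (branchRows is)) y
branchRows-Ker y []                 = mk⇔ (λ _ → []) (λ _ → tt)
branchRows-Ker y (leg _ _ ∷ is)     = branchRows-Ker y is
branchRows-Ker y (branch e ks ∷ is) = mk⇔
  (λ ((p , h) , h′) → trans (eq h) p ∷ subst (λ R → Ker R y) (sym (rowsOf-++ (branchRows ks) (branchRows is)))
    (All.++⁺ (to (branchRows-Ker y ks) h) (to (branchRows-Ker y is) h′)))
  (λ { (p ∷ k) → let k′ = subst (λ R → Ker R y) (rowsOf-++ (branchRows ks) (branchRows is)) k
                     h = from (branchRows-Ker y ks) (All.++⁻ˡ (rowsOf (branchRows ks)) k′) in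
       (trans (sym (eq h)) p , h) , from (branchRows-Ker y is) (All.++⁻ʳ (rowsOf (branchRows ks)) k′) })
  where
  eq : Below y ks → vecOf (e ∷ allLegs ks) · y ≡ lookup y e xor sumOver (lookup y) (tops ks)
  eq h = trans (vecOf-· (e ∷ allLegs ks) y) (cong (lookup y e xor_) (allLegs-sum y ks h))

Avoids : Fin n → List (Fin n × Vec Bool n) → Set
Avoids x = All (λ p → lookup (proj₂ p) x ≡ false)

branchRows-avoid : ∀ (x : Fin n) is → total x is ≡ 0 → Avoids x (branchRows is)
branchRows-avoid x [] _ = []
branchRows-avoid x (leg b e ∷ is) h = branchRows-avoid x is (ℕ.m+n≡0⇒n≡0 (at? x e) (trans (sym (total-leg x b e is)) h))
branchRows-avoid x (branch e ks ∷ is) h = row ∷ All.++⁺ (branchRows-avoid x ks ks≡0) (branchRows-avoid x is (ℕ.m+n≡0⇒n≡0 (at? x e + total x ks) h′))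
  where
  h′ : (at? x e + total x ks) + total x is ≡ 0
  h′ = trans (sym (total-branch x e ks is)) h
  e+ks≡0 : at? x e + total x ks ≡ 0
  e+ks≡0 = ℕ.m+n≡0⇒m≡0 (at? x e + total x ks) h′
  ks≡0 : total x ks ≡ 0
  ks≡0 = ℕ.m+n≡0⇒n≡0 (at? x e) e+ks≡0
  row : lookup (vecOf (e ∷ allLegs ks)) x ≡ false
  row = trans (vecOf-lookup (e ∷ allLegs ks) x) (cong odd (cong₂ _+_ (ℕ.m+n≡0⇒m≡0 (at? x e) e+ks≡0)
    (trans (occ-++ x (legs false ks) (legs true ks)) (ℕ.m+n≡0⇒m≡0 _ ks≡0))))

Triangular-++ : (ps qs : List (Fin n × Vec Bool n)) → Triangular ps → Triangular qs →
  All (λ p → Avoids (proj₁ p) qs) ps → Triangular (ps ++ qs)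
Triangular-++ []       qs _ tri _ = tri
Triangular-++ (p ∷ ps) qs (h , avoid , tri) tri′ (a ∷ as) = h , All.++⁺ avoid a , Triangular-++ ps qs tri tri′ as

pivots : (is : Tree∗ n) → All (λ p → 1 ≤ occ (proj₁ p) (branches is)) (branchRows is)
pivots []                 = []
pivots (leg _ _ ∷ is)     = pivots is
pivots (branch e ks ∷ is) = ℕ.≤-trans (ℕ.≤-reflexive (sym (at?-self e))) (ℕ.m≤m+n (at? e e) _)
  ∷ All.++⁺ (All.map (λ {p} h → within (proj₁ p) (ℕ.≤-trans h (ℕ.m≤m+n _ (occ (proj₁ p) (branches is))))) (pivots ks))
            (All.map (λ {p} h → within (proj₁ p) (ℕ.≤-trans h (ℕ.m≤n+m _ (occ (proj₁ p) (branches ks))))) (pivots is))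
  where
  within : ∀ x → 1 ≤ occ x (branches ks) + occ x (branches is) → 1 ≤ occ x (e ∷ branches ks ++ branches is)
  within x h = ℕ.≤-trans h (ℕ.≤-trans (ℕ.≤-reflexive (sym (occ-++ x (branches ks) (branches is)))) (ℕ.m≤n+m _ (at? x e)))

only : ∀ a b → a + b ≤ 1 → 1 ≤ a → b ≡ 0
only (suc zero)    zero    _ _ = refl
only (suc zero)    (suc b) (s≤s ())
only (suc (suc a)) b (s≤s ()) _

branchRows-triangular : ∀ (is : Tree∗ n) → (∀ x → total x is ≤ 1) → Triangular (branchRows is)
branchRows-triangular [] _ = tt
branchRows-triangular (leg b e ∷ is) once = branchRows-triangular is λ x →
  ℕ.≤-trans (ℕ.m≤n+m _ (at? x e)) (ℕ.≤-trans (ℕ.≤-reflexive (sym (total-leg x b e is))) (once x))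
branchRows-triangular (branch e ks ∷ is) once = head-row ,
  All.++⁺ (branchRows-avoid e ks ks≡0) (branchRows-avoid e is (only _ _ (once′ e) (ℕ.≤-trans (ℕ.≤-reflexive (sym (at?-self e))) (ℕ.m≤m+n (at? e e) _)))) ,
  Triangular-++ (branchRows ks) (branchRows is)
    (branchRows-triangular ks λ x → ℕ.≤-trans (ℕ.m≤n+m _ (at? x e)) (ℕ.≤-trans (ℕ.m≤m+n _ (total x is)) (once′ x)))
    (branchRows-triangular is λ x → ℕ.≤-trans (ℕ.m≤n+m _ (at? x e + total x ks)) (once′ x))
    (All.map (λ {p} h → branchRows-avoid (proj₁ p) is (only _ _ (once′ (proj₁ p))
      (ℕ.≤-trans h (ℕ.≤-trans (ℕ.m≤n+m _ (occ (proj₁ p) (legs false ks) + occ (proj₁ p) (legs true ks))) (ℕ.m≤n+m _ (at? (proj₁ p) e)))))) (pivots ks))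
  where
  once′ : ∀ x → (at? x e + total x ks) + total x is ≤ 1
  once′ x = ℕ.≤-trans (ℕ.≤-reflexive (sym (total-branch x e ks is))) (once x)
  ks≡0 : total e ks ≡ 0
  ks≡0 = only (at? e e) _ (ℕ.≤-trans (ℕ.m≤m+n _ (total e is)) (once′ e)) (ℕ.≤-reflexive (sym (at?-self e)))
  head-row : lookup (vecOf (e ∷ allLegs ks)) e ≡ true
  head-row = trans (vecOf-lookup (e ∷ allLegs ks) e) (cong odd (cong₂ _+_ (at?-self e)
    (trans (occ-++ e (legs false ks) (legs true ks)) (ℕ.m+n≡0⇒m≡0 _ ks≡0))))

-- Each branch is the pivot of its own row and gets contracted, which shrinks every tree to the
-- nodes described by `u`.
items-State : (u : Vec (Vec Bool n) ρ) (is : Tree∗ n) → (∀ x → total x is ≤ 1) →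
  (∀ x → 1 ≤ occ x (branches is) → column u x ≡ 𝟘) → State (λ y → KerV u y × Below y is) u
items-State u is once free = State-map
  (λ y (k , h) → k , from (branchRows-Ker y is) h) (λ y (k , h) → k , to (branchRows-Ker y is) h)
  (triangular-State u (branchRows is) (branchRows-triangular is once) (All.map (λ {p} h → free (proj₁ p) h) (pivots is)))

-- Trees turned into branches, by rerooting at a leg

record Items (F : List (Tree∗ n)) : Set where
  field
    flat      : Tree∗ n
    on     : ∀ y → OnForest y F ⇔ Below y flat
    totals : ∀ x → total x flat ≡ totalF x F

cons-Items : ∀ {T : Tree∗ n} {F} (is : Tree∗ n) → (∀ y → OnTree y T ⇔ Below y is) → (∀ x → total x is ≡ total x T) → Items F → Items (T ∷ F)
cons-Items is on₁ totals₁ js = record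
  { flat = is ++ flat
  ; on = λ y → mk⇔ (λ { (p ∷ ps) → from (Below-++ is flat) (to (on₁ y) p , to (on y) ps) })
                   (λ h → let (p , q) = to (Below-++ is flat) h in from (on₁ y) p ∷ from (on y) q)
  ; totals = λ x → trans (total-++ x is flat) (cong₂ _+_ (totals₁ x) (totals x)) }
  where
  open Items js

rooted-at-leg : ∀ b e (rs : Tree∗ n) {T F} → T ≃ (leg b e ∷ rs) → Items F → Items (T ∷ F)
rooted-at-leg b e rs eq = cons-Items (branch e rs ∷ [])
  (λ y → mk⇔ (to (leg⇔branch b e rs) ∘ to (≃-on eq y)) (from (≃-on eq y) ∘ from (leg⇔branch b e rs)))
  (λ x → trans (total-branch₁ x e rs) (sym (trans (≃-total eq x) (total-leg x b e rs))))

items-of : (F : List (Tree∗ n)) → Items F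
items-of [] = record { flat = [] ; on = λ y → mk⇔ (λ _ → tt) (λ _ → []) ; totals = λ _ → refl }
items-of (T ∷ F) with extract false [] T
... | inj₂ (e , rs , eq) = rooted-at-leg false e rs eq (items-of F)
... | inj₁ no-A with extract true [] T
...   | inj₂ (e , rs , eq) = rooted-at-leg true e rs eq (items-of F)
-- In a tree without legs the condition at the root follows from the conditions below it.
...   | inj₁ no-B = cons-Items T (λ y → mk⇔ proj₂ λ h → trans (tops≡legs y T h)
          (cong₂ _xor_ (cong (sumOver (lookup y)) no-A) (cong (sumOver (lookup y)) no-B)) , h) (λ x → refl) (items-of F)

record MarkedItems (F : List (Tree∗ n)) : Set where
  field
    items : Items F
    marks : ∀ y → μ y (Items.flat items) ≡ μF y F
    head∈ : ∀ {T F′} → F ≡ T ∷ F′ → ∃ λ x → 1 ≤ occ x (legs true (Items.flat items))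

-- A mixed tree can be hung by an unmarked leg; its marked legs then remain legs and still represent
-- the functional.
marked-items : {F : List (Tree∗ n)} → All Mixed F → MarkedItems F
marked-items [] = record { items = items-of [] ; marks = λ y → refl ; head∈ = λ () }
marked-items (M ∷ Ms) = record
  { items = rooted-at-leg false eᵃ rsᵃ ≃ᵃ items
  ; marks = λ y → trans (sumOver-++ (lookup y) (legs true rsᵃ) (legs true (Items.flat items)))
      (cong₂ _xor_ (sym (μ-≃ ≃ᵃ y)) (marks y))
  ; head∈ = λ { refl → eᵇ , b∈ } }
  where
  open Mixed M
  open MarkedItems (marked-items Ms)
  b∈ : 1 ≤ occ eᵇ (legs true ((branch eᵃ rsᵃ ∷ []) ++ Items.flat items))
  b∈ = ℕ.≤-trans (leg∈ true eᵇ rsᵇ ≃ᵇ) (ℕ.≤-trans (ℕ.≤-reflexive (≃-legs ≃ᵃ true eᵇ))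
    (ℕ.≤-trans (ℕ.m≤m+n _ _) (ℕ.≤-reflexive (sym (occ-++ eᵇ (legs true rsᵃ) (legs true (Items.flat items)))))))

unitℕ : Fin k → Vec ℕ k
unitℕ zero    = 1 ∷ replicate _ 0
unitℕ (suc i) = 0 ∷ unitℕ i

-- The entries count the occurrences of one element in disjoint classes. Knowing one class of the
-- element fixes all counts, and with them its column.
pinned : (c : Vec ℕ k) → Vec.sum c ≤ 1 → ∀ i → 1 ≤ lookup c i → c ≡ unitℕ i
pinned (suc zero ∷ c) h zero _ = cong (1 ∷_) (zeros c (ℕ.n≤0⇒n≡0 (s≤s⁻¹ h)))
  where
  zeros : ∀ {k} (c : Vec ℕ k) → Vec.sum c ≡ 0 → c ≡ replicate _ 0
  zeros []      _ = refl
  zeros (a ∷ c) h = cong₂ _∷_ (ℕ.m+n≡0⇒m≡0 a h) (zeros c (ℕ.m+n≡0⇒n≡0 a h))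
pinned (suc (suc a) ∷ c) (s≤s ()) zero _
pinned (zero ∷ c) h (suc i) ci = cong (0 ∷_) (pinned c h i ci)
pinned (suc a ∷ c) h (suc i) ci = ⊥-elim (ℕ.<-irrefl refl (ℕ.≤-trans (s≤s (ℕ.≤-trans ci (entry≤sum c i))) (ℕ.≤-trans (s≤s (ℕ.m≤n+m (Vec.sum c) a)) h)))
  where
  entry≤sum : ∀ {k} (c : Vec ℕ k) i → lookup c i ≤ Vec.sum c
  entry≤sum (a ∷ c) zero    = ℕ.m≤m+n a _
  entry≤sum (a ∷ c) (suc i) = ℕ.≤-trans (entry≤sum c i) (ℕ.m≤n+m _ a)

positive : ∀ a b → 1 ≤ a + b → 1 ≤ a ⊎ 1 ≤ b
positive zero    b h = inj₂ h
positive (suc a) b h = inj₁ (s≤s z≤n)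

Two-columns : (u : Vec (Vec Bool n) ρ) → Vec Bool ρ → Set
Two-columns u p = ∃ λ e → ∃ λ f → e ≢ f × column u e ≡ p × column u f ≡ p

-- A tree in which both marks occur twice, and two parallel connections outside it

module _ {T : Tree∗ n} {I′ P : List (Tree∗ n)} {LB : List (Fin n)} (D : Double T) (Ms : All Mixed I′)
  (once : ∀ x → ((total x T + totalF x I′) + totalF x P) + occ x LB ≤ 1) where
  private
    open Double D
    module I = MarkedItems (marked-items Ms)
    It = I.items
    J₁ = Items.flat It
    J₂ = Items.flat (items-of P)

    legs₂ : List (Fin n)
    legs₂ = legs true T ++ legs true J₁ ++ LB

    u : Vec (Vec Bool n) 2
    u = vecOf (allLegs T) ∷ vecOf legs₂ ∷ []

    c : Fin n → Vec ℕ 8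
    c x = occ x (legs false T) ∷ occ x (legs true T) ∷ occ x (branches T) ∷ occ x (legs false J₁) ∷ occ x (legs true J₁) ∷ occ x (branches J₁)
      ∷ total x J₂ ∷ occ x LB ∷ []

    c-once : ∀ x → Vec.sum (c x) ≤ 1
    c-once x = ℕ.≤-trans (ℕ.≤-reflexive (trans
      (solveℕ 8 (λ a b c d e f g h → a ⊹ (b ⊹ (c ⊹ (d ⊹ (e ⊹ (f ⊹ (g ⊹ (h ⊹ conℕ 0)))))))
          :≡ ((((a ⊹ b) ⊹ c) ⊹ ((d ⊹ e) ⊹ f)) ⊹ g) ⊹ h) refl (occ x (legs false T)) (occ x (legs true T)) (occ x (branches T))
          (occ x (legs false J₁)) (occ x (legs true J₁)) (occ x (branches J₁)) (total x J₂) (occ x LB))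
      (cong₂ (λ i p → ((total x T + i) + p) + occ x LB) (Items.totals It x) (Items.totals (items-of P) x)))) (once x)

    pattern₂ : Vec ℕ 8 → Vec Bool 2
    pattern₂ (a₀ ∷ a₁ ∷ _ ∷ _ ∷ j₁ ∷ _ ∷ _ ∷ l ∷ []) = odd (a₀ + a₁) ∷ odd (a₁ + (j₁ + l)) ∷ []

    col : ∀ x i → 1 ≤ lookup (c x) i → column u x ≡ pattern₂ (unitℕ i)
    col x i h = trans (cong₂ (λ a b → a ∷ b ∷ [])
      (trans (vecOf-lookup (allLegs T) x) (cong odd (occ-++ x (legs false T) (legs true T))))
      (trans (vecOf-lookup legs₂ x) (cong odd (trans (occ-++ x (legs true T) (legs true J₁ ++ LB))
        (cong (occ x (legs true T) +_) (occ-++ x (legs true J₁) LB))))))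
      (cong pattern₂ (pinned (c x) (c-once x) i h))

    items : Tree∗ n
    items = T ++ (J₁ ++ J₂)

    items-once : ∀ x → total x items ≤ 1
    items-once x = ℕ.≤-trans (ℕ.≤-reflexive (trans (total-++ x T (J₁ ++ J₂)) (trans (cong (total x T +_) (trans (total-++ x J₁ J₂)
      (cong₂ _+_ (Items.totals It x) (Items.totals (items-of P) x)))) (sym (ℕ.+-assoc (total x T) _ _)))))
      (ℕ.≤-trans (ℕ.m≤m+n _ (occ x LB)) (once x))

    free : ∀ x → 1 ≤ occ x (branches items) → column u x ≡ 𝟘
    free x h with positive (occ x (branches T)) _ (ℕ.≤-trans h (ℕ.≤-reflexive (occ-branches-++ x T (J₁ ++ J₂))))
    ... | inj₁ p = col x (# 2) p
    ... | inj₂ q with positive (occ x (branches J₁)) _ (ℕ.≤-trans q (ℕ.≤-reflexive (occ-branches-++ x J₁ J₂)))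
    ...   | inj₁ p = col x (# 5) p
    ...   | inj₂ p = col x (# 6) (ℕ.≤-trans p (ℕ.m≤n+m _ (occ x (legs false J₂) + occ x (legs true J₂))))

    second-row : ∀ y → vecOf legs₂ · y ≡ (μ y T xor μF y I′) xor sumOver (lookup y) LB
    second-row y = trans (vecOf-· legs₂ y) (trans (sumOver-++ (lookup y) (legs true T) (legs true J₁ ++ LB)) (trans
      (cong (μ y T xor_) (trans (sumOver-++ (lookup y) (legs true J₁) LB) (cong (_xor sumOver (lookup y) LB) (I.marks y))))
      (sym (xor-assoc (μ y T) (μF y I′) (sumOver (lookup y) LB)))))

    first-row : ∀ y → Below y T → vecOf (allLegs T) · y ≡ sumOver (lookup y) (tops T)
    first-row y h = trans (vecOf-· (allLegs T) y) (allLegs-sum y T h)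

    state : State (Marked (T ∷ I′) P LB) u
    state = State-map
      (λ { y ((p ∷ q ∷ []) , h) → let (hT , h′) = to (Below-++ T (J₁ ++ J₂)) h ; (h₁ , h₂) = to (Below-++ J₁ J₂) h′ in
        (((trans (sym (first-row y hT)) p , hT) ∷ from (Items.on It y) h₁) , from (Items.on (items-of P) y) h₂) , trans (sym (second-row y)) q })
      (λ { y (((pT , hT) ∷ pI , pP) , m) → (trans (first-row y hT) pT ∷ trans (second-row y) m ∷ []) ,
        from (Below-++ T (J₁ ++ J₂)) (hT , from (Below-++ J₁ J₂) (to (Items.on It y) pI , to (Items.on (items-of P) y) pP)) })
      (items-State u items items-once free)

  -- Contracting branches shrinks `T` to a node, and splitting the apex gives two more. The unmarked
  -- legs of `T`, its marked legs and the connections between the two halves of the apex are the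
  -- three double edges. The second connection besides `x` is another marked loop or runs through
  -- another mixed tree.
  found₂ : ∀ {x} → 1 ≤ occ x LB → (∃ λ z → x ≢ z × 1 ≤ occ z LB) ⊎ (∃ λ M → ∃ λ I″ → I′ ≡ M ∷ I″) → Found (Marked (T ∷ I′) P LB)
  found₂ {x} x∈ other = inj₁ (u , state , λ
    { (false ∷ false ∷ []) ne → ⊥-elim (ne refl)
    ; (false ∷ true ∷ []) _ → outside other
    ; (true ∷ false ∷ []) _ → a , a′ , a≢a′ , col a (# 0) a∈ , col a′ (# 0) a′∈
    ; (true ∷ true ∷ []) _ → b , b′ , b≢b′ , col b (# 1) b∈ , col b′ (# 1) b′∈ })
    where
    outside : _ → Two-columns u (false ∷ true ∷ [])
    outside (inj₁ (z , x≢z , z∈)) = x , z , x≢z , col x (# 7) x∈ , col z (# 7) z∈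
    outside (inj₂ (M , I″ , eq)) with I.head∈ eq
    ... | z , z∈ = x , z , (λ { refl → clash (trans (sym (pinned (c x) (c-once x) (# 7) x∈)) (pinned (c x) (c-once x) (# 4) z∈)) })
                 , col x (# 7) x∈ , col z (# 4) z∈
      where
      clash : unitℕ {8} (# 7) ≢ unitℕ (# 4)
      clash ()

-- A branch both sides of which carry both marks

module _ {T : Tree∗ n} {P : List (Tree∗ n)} {LB : List (Fin n)} {e : Fin n} {ks os : Tree∗ n} (eq : T ≃ (branch e ks ∷ os))
  (once : ∀ x → (total x T + totalF x P) + occ x LB ≤ 1) where
  private
    J₂ = Items.flat (items-of P)

    legs₃ : List (Fin n)
    legs₃ = legs true ks ++ legs true os ++ LB

    u : Vec (Vec Bool n) 3
    u = vecOf (e ∷ allLegs ks) ∷ vecOf (e ∷ allLegs os) ∷ vecOf legs₃ ∷ []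

    c : Fin n → Vec ℕ 9
    c x = at? x e ∷ occ x (legs false ks) ∷ occ x (legs true ks) ∷ occ x (branches ks)
      ∷ occ x (legs false os) ∷ occ x (legs true os) ∷ occ x (branches os) ∷ total x J₂ ∷ occ x LB ∷ []

    c-once : ∀ x → Vec.sum (c x) ≤ 1
    c-once x = ℕ.≤-trans (ℕ.≤-reflexive (trans
      (solveℕ 9 (λ z a b c d e f g h → z ⊹ (a ⊹ (b ⊹ (c ⊹ (d ⊹ (e ⊹ (f ⊹ (g ⊹ (h ⊹ conℕ 0))))))))
          :≡ (((z ⊹ ((a ⊹ b) ⊹ c)) ⊹ ((d ⊹ e) ⊹ f)) ⊹ g) ⊹ h) refl (at? x e) (occ x (legs false ks)) (occ x (legs true ks)) (occ x (branches ks))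
          (occ x (legs false os)) (occ x (legs true os)) (occ x (branches os)) (total x J₂) (occ x LB))
      (cong₂ (λ t p → (t + p) + occ x LB) (sym (trans (≃-total eq x) (total-branch x e ks os))) (Items.totals (items-of P) x)))) (once x)

    pattern₃ : Vec ℕ 9 → Vec Bool 3
    pattern₃ (z ∷ k₀ ∷ k₁ ∷ _ ∷ o₀ ∷ o₁ ∷ _ ∷ _ ∷ l ∷ []) = odd (z + (k₀ + k₁)) ∷ odd (z + (o₀ + o₁)) ∷ odd (k₁ + (o₁ + l)) ∷ []

    col : ∀ x i → 1 ≤ lookup (c x) i → column u x ≡ pattern₃ (unitℕ i)
    col x i h = trans (cong₂ _∷_ (row ks) (cong₂ (λ a b → a ∷ b ∷ []) (row os)
        (trans (vecOf-lookup legs₃ x) (cong odd (trans (occ-++ x (legs true ks) (legs true os ++ LB))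
          (cong (occ x (legs true ks) +_) (occ-++ x (legs true os) LB)))))))
      (cong pattern₃ (pinned (c x) (c-once x) i h))
      where
      row : ∀ is → lookup (vecOf (e ∷ allLegs is)) x ≡ odd (at? x e + (occ x (legs false is) + occ x (legs true is)))
      row is = trans (vecOf-lookup (e ∷ allLegs is) x) (cong (λ k → odd (at? x e + k)) (occ-++ x (legs false is) (legs true is)))

    items : Tree∗ n
    items = ks ++ (os ++ J₂)

    items-once : ∀ x → total x items ≤ 1
    items-once x = ℕ.≤-trans (ℕ.≤-trans (ℕ.≤-reflexive (trans (total-++ x ks (os ++ J₂)) (cong (total x ks +_) (total-++ x os J₂))))
      (ℕ.≤-trans (ℕ.m≤n+m _ (at? x e)) (ℕ.≤-reflexive (trans
        (solveℕ 4 (λ z k o j → z ⊹ (k ⊹ (o ⊹ j)) :≡ ((z ⊹ k) ⊹ o) ⊹ j) refl (at? x e) (total x ks) (total x os) (total x J₂))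
        (cong₂ _+_ (sym (trans (≃-total eq x) (total-branch x e ks os))) (Items.totals (items-of P) x))))))
      (ℕ.≤-trans (ℕ.m≤m+n _ (occ x LB)) (once x))

    free : ∀ x → 1 ≤ occ x (branches items) → column u x ≡ 𝟘
    free x h with positive (occ x (branches ks)) _ (ℕ.≤-trans h (ℕ.≤-reflexive (occ-branches-++ x ks (os ++ J₂))))
    ... | inj₁ p = col x (# 3) p
    ... | inj₂ q with positive (occ x (branches os)) _ (ℕ.≤-trans q (ℕ.≤-reflexive (occ-branches-++ x os J₂)))
    ...   | inj₁ p = col x (# 6) p
    ...   | inj₂ p = col x (# 7) (ℕ.≤-trans p (ℕ.m≤n+m _ (occ x (legs false J₂) + occ x (legs true J₂))))

    side-row : ∀ y is → Below y is → vecOf (e ∷ allLegs is) · y ≡ lookup y e xor sumOver (lookup y) (tops is)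
    side-row y is h = trans (vecOf-· (e ∷ allLegs is) y) (cong (lookup y e xor_) (allLegs-sum y is h))

    third-row : ∀ y → vecOf legs₃ · y ≡ (μ y T xor false) xor sumOver (lookup y) LB
    third-row y = trans (vecOf-· legs₃ y) (trans (sumOver-++ (lookup y) (legs true ks) (legs true os ++ LB)) (trans
      (cong (μ y ks xor_) (sumOver-++ (lookup y) (legs true os) LB)) (trans (sym (xor-assoc (μ y ks) (μ y os) (sumOver (lookup y) LB)))
      (cong (_xor sumOver (lookup y) LB) (trans (sym (trans (μ-≃ eq y) (sumOver-++ (lookup y) (legs true ks) (legs true os)))) (sym (xor-identityʳ (μ y T))))))))

    state : State (Marked (T ∷ []) P LB) u
    state = State-map
      (λ { y ((p ∷ q ∷ r ∷ []) , h) → let (hk , h′) = to (Below-++ ks (os ++ J₂)) h ; (ho , hP) = to (Below-++ os J₂) h′ in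
        ((from (≃-on eq y) (trans (sym (side-row y os ho)) q , (trans (sym (side-row y ks hk)) p , hk) , ho) ∷ []) , from (Items.on (items-of P) y) hP)
        , trans (sym (third-row y)) r })
      (λ { y ((pT ∷ [] , pP) , m) → let (q , (p , hk) , ho) = to (≃-on eq y) pT in
        (trans (side-row y ks hk) p ∷ trans (side-row y os ho) q ∷ trans (third-row y) m ∷ [])
        , from (Below-++ ks (os ++ J₂)) (hk , from (Below-++ os J₂) (ho , to (Items.on (items-of P) y) pP)) })
      (items-State u items items-once free)

  -- The nodes of K₄ are the two sides of the branch `e` and the two halves of the apex. Here `e`
  -- and `x` are opposite edges, and a leg of each mark on each side of `e` gives the other four.
  found₃ : ∀ {x k₀ k₁ o₀ o₁} → 1 ≤ occ x LB → k₀ ∈ₗ legs false ks → k₁ ∈ₗ legs true ks → o₀ ∈ₗ legs false os → o₁ ∈ₗ legs true os →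
    Found (Marked (T ∷ []) P LB)
  found₃ {x} {k₀} {k₁} {o₀} {o₁} x∈ k₀∈ k₁∈ o₀∈ o₁∈ = inj₂ (u , state , λ
    { (false ∷ false ∷ false ∷ []) ne _ → ⊥-elim (ne refl)
    ; (false ∷ false ∷ true ∷ []) _ _ → x , col x (# 8) x∈
    ; (false ∷ true ∷ false ∷ []) _ _ → o₀ , col o₀ (# 4) (occ-∈ o₀∈)
    ; (false ∷ true ∷ true ∷ []) _ _ → o₁ , col o₁ (# 5) (occ-∈ o₁∈)
    ; (true ∷ false ∷ false ∷ []) _ _ → k₀ , col k₀ (# 1) (occ-∈ k₀∈)
    ; (true ∷ false ∷ true ∷ []) _ _ → k₁ , col k₁ (# 2) (occ-∈ k₁∈)
    ; (true ∷ true ∷ false ∷ []) _ _ → e , col e (# 0) (ℕ.≤-reflexive (sym (at?-self e)))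
    ; (true ∷ true ∷ true ∷ []) _ ne → ⊥-elim (ne refl) })

≈-sym : {is js : Tree∗ n} → is ≈ js → js ≈ is
≈-sym p = same (λ b x → sym (≈-legs p b x)) (λ x → sym (≈-branches p x)) (λ g → sym (≈-tops p g))
  λ y → mk⇔ (from (≈-below p y)) (to (≈-below p y))

-- Either some node separates the two marks, or some branch has both marks on both sides.

data Scan (T : Tree∗ n) : Set where
  sink  : ∀ pa pb → T ≃ (pa ++ pb) → legs true pa ≡ [] → legs false pb ≡ [] → Scan T
  cross : ∀ e ks os {k₀ k₁ o₀ o₁} → T ≃ (branch e ks ∷ os) →
    k₀ ∈ₗ legs false ks → k₁ ∈ₗ legs true ks → o₀ ∈ₗ legs false os → o₁ ∈ₗ legs true os → Scan T

nil-or-∈ : ∀ {A : Set} (l : List A) → l ≡ [] ⊎ ∃ λ x → x ∈ₗ l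
nil-or-∈ []      = inj₁ refl
nil-or-∈ (x ∷ l) = inj₂ (x , Anyₗ.here refl)

-- Items of the root are sorted into `pa`, without marked legs, and `pb`, without unmarked ones. A
-- branch carrying both marks becomes the place of the new root if the rest of the tree lacks one
-- mark: the old root is then a branch that fits into `pa` or `pb`, so the walk never turns back.
scan : {T : Tree∗ n} (pa pb is : Tree∗ n) → T ≃ ((pa ++ pb) ++ is) → legs true pa ≡ [] → legs false pb ≡ [] → Scan T
scan pa pb [] eq a b = sink pa pb (≃-trans eq (≈⇒≃ (≈-reflexive (List.++-identityʳ (pa ++ pb))))) a b
scan pa pb (leg false e ∷ is) eq a b = scan (leg false e ∷ pa) pb is (≃-trans eq (≈⇒≃ (≈-shift (pa ++ pb) is (leg false e)))) a b
scan pa pb (leg true e ∷ is) eq a b = scan pa (leg true e ∷ pb) is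
  (≃-trans eq (≈⇒≃ (≈-trans (≈-shift (pa ++ pb) is (leg true e)) (++-≈ (≈-sym (≈-shift pa pb (leg true e))) ≈-refl)))) a b
scan {T = T} pa pb (branch e ks ∷ is) eq a b = decide (nil-or-∈ (legs true ks)) (nil-or-∈ (legs false ks))
    (nil-or-∈ (legs true os)) (nil-or-∈ (legs false os))
  where
  os : Tree∗ _
  os = (pa ++ pb) ++ is
  eq′ : T ≃ (branch e ks ∷ os)
  eq′ = ≃-trans eq (≈⇒≃ (≈-shift (pa ++ pb) is (branch e ks)))
  decide : legs true ks ≡ [] ⊎ _ → legs false ks ≡ [] ⊎ _ → legs true os ≡ [] ⊎ _ → legs false os ≡ [] ⊎ _ → Scan T
  decide (inj₁ h) _ _ _ = scan (branch e ks ∷ pa) pb is eq′ (cong₂ _++_ h a) b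
  decide (inj₂ _) (inj₁ h) _ _ = scan pa (branch e ks ∷ pb) is
    (≃-trans eq′ (≈⇒≃ (++-≈ (≈-sym (≈-shift pa pb (branch e ks))) ≈-refl))) a (cong₂ _++_ h b)
  decide (inj₂ _) (inj₂ _) (inj₁ h) _ = scan (branch e os ∷ []) [] ks (≃-trans eq′ (reroot e ks os)) (cong (_++ []) h) refl
  decide (inj₂ _) (inj₂ _) (inj₂ _) (inj₁ h) = scan [] (branch e os ∷ []) ks (≃-trans eq′ (reroot e ks os)) refl (cong (_++ []) h)
  decide (inj₂ (k₁ , k₁∈)) (inj₂ (k₀ , k₀∈)) (inj₂ (o₁ , o₁∈)) (inj₂ (o₀ , o₀∈)) = cross e ks os eq′ k₀∈ k₁∈ o₀∈ o₁∈

-- Graphs with an apex for lists of rows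

record Outer (K : Vec Bool n → Set) : Set where
  field
    F    : List (Tree∗ n)
    ls   : List (Fin n)
    once : ∀ x → totalF x F + occ x ls ≡ 1
    on   : ∀ y → K y ⇔ OnForest y F

record Joined (I P : List (Tree∗ n)) (LB : List (Fin n)) : Set where
  field
    F      : List (Tree∗ n)
    totals : ∀ x → totalF x F ≡ (totalF x I + totalF x P) + occ x LB
    on     : ∀ y → Marked I P LB y ⇔ OnForest y F

-- When every tree meets the functional in one element, a new node joins these elements and the loops.
module _ {P : List (Tree∗ n)} (LB : List (Fin n)) where
  private
    loops : List (Fin n) → Tree∗ n
    loops = List.map (leg false)

    loops-total : ∀ x L → total x (loops L) ≡ occ x L
    loops-total x []      = refl
    loops-total x (e ∷ L) = trans (total-leg x false e (loops L)) (cong (at? x e +_) (loops-total x L))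

    loops-tops : ∀ L → tops (loops L) ≡ L
    loops-tops []      = refl
    loops-tops (e ∷ L) = cong (e ∷_) (loops-tops L)

    loops-below : ∀ y L → Below y (loops L)
    loops-below y []      = tt
    loops-below y (e ∷ L) = loops-below y L

  join : {I : List (Tree∗ n)} → All Single I → Joined I P LB
  join {I} ss = record
    { F = (loops LB ++ branched ss) ∷ P
    ; totals = λ x → trans (cong (_+ totalF x P) (trans (total-++ x (loops LB) (branched ss)) (cong₂ _+_ (loops-total x LB) (branched-total x ss))))
        (trans (ℕ.+-assoc (occ x LB) (totalF x I) (totalF x P)) (ℕ.+-comm (occ x LB) _))
    ; on = λ y → mk⇔
        (λ { ((i , p) , m) → (trans (root y (branched ss)) (trans (xor-comm (sumOver (lookup y) LB) _)
              (trans (cong (_xor sumOver (lookup y) LB) (sym (branched-marks y ss i))) m))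
            , from (Below-++ (loops LB) (branched ss)) (loops-below y LB , to (branched-on y ss) i)) ∷ p })
        (λ { ((r , h) ∷ p) → let i = from (branched-on y ss) (proj₂ (to (Below-++ (loops LB) (branched ss)) h)) in
            (i , p) , trans (cong (_xor sumOver (lookup y) LB) (branched-marks y ss i))
              (trans (xor-comm (sumOver (lookup y) (tops (branched ss))) _) (trans (sym (root y (branched ss))) r)) }) }
    where
    branched : ∀ {I} → All Single I → Tree∗ n
    branched []       = []
    branched (s ∷ ss) = branch (Single.e s) (Single.rs s) ∷ branched ss
    branched-total : ∀ x {I} (ss : All Single I) → total x (branched ss) ≡ totalF x I
    branched-total x []       = refl
    branched-total x (s ∷ ss) = trans (total-branch x (Single.e s) (Single.rs s) (branched ss))
      (cong₂ _+_ (sym (Single.totals s x)) (branched-total x ss))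
    branched-on : ∀ y {I} (ss : All Single I) → OnForest y I ⇔ Below y (branched ss)
    branched-on y []       = mk⇔ (λ _ → tt) (λ _ → [])
    branched-on y (s ∷ ss) = mk⇔ (λ { (p ∷ ps) → proj₁ (to (Single.on s y) p) , to (branched-on y ss) ps })
      (λ { (h , h′) → from (Single.on s y) (h , tt) ∷ from (branched-on y ss) h′ })
    branched-marks : ∀ y {I} (ss : All Single I) → OnForest y I → μF y I ≡ sumOver (lookup y) (tops (branched ss))
    branched-marks y []       []       = refl
    branched-marks y (s ∷ ss) (p ∷ ps) = cong₂ _xor_ (Single.marks s y p) (branched-marks y ss ps)
    root : ∀ y is → sumOver (lookup y) (tops (loops LB ++ is)) ≡ sumOver (lookup y) LB xor sumOver (lookup y) (tops is)
    root y is = trans (sum-tops-++ (lookup y) (loops LB) is) (cong (λ l → sumOver (lookup y) l xor sumOver (lookup y) (tops is)) (loops-tops LB))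

-- A node separating the marks is split in two, connected by x.
split-sink : {T : Tree∗ n} {P : List (Tree∗ n)} (x : Fin n) (pa pb : Tree∗ n) → T ≃ (pa ++ pb) →
  legs true pa ≡ [] → legs false pb ≡ [] → Joined (T ∷ []) P (x ∷ [])
split-sink {T = T} {P} x pa pb eq a b = record
  { F = (branch x pb ∷ pa) ∷ P
  ; totals = λ z → trans (cong (_+ totalF z P) (trans (total-branch z x pb pa) (trans (sums (at? z x) (total z pb) (total z pa))
      (cong (_+ (at? z x + 0)) (trans (ℕ.+-comm (total z pb) (total z pa)) (trans (sym (total-++ z pa pb)) (sym (≃-total eq z))))))))
      (shuffle (total z T) (at? z x + 0) (totalF z P))
  ; on = λ y → mk⇔
      (λ { ((pT ∷ [] , p) , m) → let (r , h) = to (≃-on eq y) pT ; (ha , hb) = to (Below-++ pa pb) h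
                                     q = ≡⇒xor≡false (sym (trans (tops-pb y hb) (trans (sym (marks y)) (trans (sym (xor-identityʳ (μ y T)))
                                           (trans (xor≡false⇒≡ m) (xor-identityʳ (lookup y x))))))) in
        (trans (cong (_xor sumOver (lookup y) (tops pa)) (xor≡false⇒≡ {lookup y x} q))
          (trans (xor-comm (sumOver (lookup y) (tops pb)) _) (trans (sym (sum-tops-++ (lookup y) pa pb)) r)) , (q , hb) , ha) ∷ p })
      (λ { ((r , (q , hb) , ha) ∷ p) →
        (from (≃-on eq y) (trans (sum-tops-++ (lookup y) pa pb) (trans (xor-comm (sumOver (lookup y) (tops pa)) _)
            (trans (cong (_xor sumOver (lookup y) (tops pa)) (sym (xor≡false⇒≡ {lookup y x} q))) r)) , from (Below-++ pa pb) (ha , hb)) ∷ [] , p)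
        , trans (cong₂ _xor_ (trans (xor-identityʳ (μ y T)) (trans (marks y) (sym (tops-pb y hb)))) (xor-identityʳ (lookup y x)))
            (trans (xor-comm (sumOver (lookup y) (tops pb)) (lookup y x)) q) }) }
  where
  sums : ∀ z b a → (z + b) + a ≡ (b + a) + (z + 0)
  sums z b a = trans (trans (ℕ.+-assoc z b a) (ℕ.+-comm z (b + a))) (cong ((b + a) +_) (sym (ℕ.+-identityʳ z)))
  shuffle : ∀ t z p → (t + z) + p ≡ ((t + 0) + p) + z
  shuffle t z p = trans (solveℕ 3 (λ t z p → (t ⊹ z) ⊹ p :≡ (t ⊹ p) ⊹ z) refl t z p) (cong (λ t → (t + p) + z) (sym (ℕ.+-identityʳ t)))
  marks : ∀ y → μ y T ≡ sumOver (lookup y) (legs true pb)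
  marks y = trans (μ-≃ eq y) (trans (cong (sumOver (lookup y)) (legs-++ true pa pb)) (trans (sumOver-++ (lookup y) (legs true pa) (legs true pb))
    (cong (λ l → sumOver (lookup y) l xor sumOver (lookup y) (legs true pb)) a)))
  tops-pb : ∀ y → Below y pb → sumOver (lookup y) (tops pb) ≡ sumOver (lookup y) (legs true pb)
  tops-pb y h = trans (tops≡legs y pb h) (cong (λ l → sumOver (lookup y) l xor sumOver (lookup y) (legs true pb)) b)

data Doubles : List (Tree∗ n) → Set where
  all-single : ∀ {I : List (Tree∗ n)} → All Single I → Doubles I
  a-double   : ∀ {I I′ : List (Tree∗ n)} {T : Tree∗ n} → Double T → All Mixed I′ → (∀ (y : Vec Bool n) → OnForest y I ⇔ OnForest y (T ∷ I′)) →
    (∀ (y : Vec Bool n) → μF y I ≡ μF y (T ∷ I′)) → (∀ (x : Fin n) → totalF x I ≡ totalF x (T ∷ I′)) → Doubles I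

doubles : {I : List (Tree∗ n)} → All Mixed I → (∀ x → totalF x I ≤ 1) → Doubles I
doubles [] once = all-single []
doubles {I = T ∷ I} (M ∷ Ms) once with single-or-double T M (λ x → ℕ.≤-trans (ℕ.m≤m+n _ _) (once x))
... | inj₂ D = a-double D Ms (λ y → mk⇔ id id) (λ y → refl) (λ x → refl)
... | inj₁ s with doubles Ms (λ x → ℕ.≤-trans (ℕ.m≤n+m _ (total x T)) (once x))
...   | all-single ss = all-single (s ∷ ss)
...   | a-double {I′ = I′} {T = T′} D Ms′ on marks totals = a-double D (M ∷ Ms′)
        (λ y → mk⇔ (λ { (p ∷ ps) → case to (on y) ps of λ { (q ∷ qs) → q ∷ p ∷ qs } })
                   (λ { (q ∷ p ∷ qs) → p ∷ from (on y) (q ∷ qs) }))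
        (λ y → trans (cong (μ y T xor_) (marks y)) (swap₃ (μ y T) (μ y T′) (μF y I′)))
        (λ x → trans (cong (total x T +_) (totals x)) (ℕ+.x∙yz≈y∙xz (total x T) (total x T′) (totalF x I′)))
  where
  swap₃ : ∀ a b c → a xor (b xor c) ≡ b xor (a xor c)
  swap₃ = solve 3 (λ a b c → a :+ (b :+ c) := b :+ (a :+ c)) refl

Found-map : {K L : Vec Bool n → Set} → (∀ y → K y → L y) → (∀ y → L y → K y) → Found K → Found L
Found-map f g (inj₁ (u , s , h)) = inj₁ (u , State-map f g s , h)
Found-map f g (inj₂ (u , s , h)) = inj₂ (u , State-map f g s , h)

-- If a tree carries both marks twice, a second mixed tree or a second marked loop gives the doubled
-- triangle. Otherwise this tree and the loop `x` are all that the functional meets, and `scan`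
-- either finds a node at which to split the tree or a branch that gives K₄.
impose : {I P : List (Tree∗ n)} → All Mixed I → ∀ x LB →
  (∀ z → (totalF z I + totalF z P) + occ z (x ∷ LB) ≤ 1) → Joined I P (x ∷ LB) ⊎ Found (Marked I P (x ∷ LB))
impose {I = I} {P} Ms x LB once with doubles Ms (λ z → ℕ.≤-trans (ℕ.m≤m+n _ (totalF z P)) (ℕ.≤-trans (ℕ.m≤m+n _ (occ z (x ∷ LB))) (once z)))
... | all-single ss = inj₁ (join (x ∷ LB) ss)
... | a-double {I′ = I′} {T = T} D Ms′ on marks totals = finish LB I′ Ms′ on marks totals once
  where
  x∈ : ∀ LB → 1 ≤ occ x (x ∷ LB)
  x∈ LB = occ-∈ {xs = x ∷ LB} (Anyₗ.here refl)
  finish : ∀ LB I′ → All Mixed I′ → (∀ y → OnForest y I ⇔ OnForest y (T ∷ I′)) → (∀ y → μF y I ≡ μF y (T ∷ I′)) →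
    (∀ z → totalF z I ≡ totalF z (T ∷ I′)) → (∀ z → (totalF z I + totalF z P) + occ z (x ∷ LB) ≤ 1) →
    Joined I P (x ∷ LB) ⊎ Found (Marked I P (x ∷ LB))
  finish LB I′ Ms′ on marks totals once = go LB I′ refl refl
    where
    once′ : ∀ z → ((total z T + totalF z I′) + totalF z P) + occ z (x ∷ LB) ≤ 1
    once′ z = subst (λ k → (k + totalF z P) + occ z (x ∷ LB) ≤ 1) (totals z) (once z)
    ⇐Marked : ∀ y → Marked (T ∷ I′) P (x ∷ LB) y → Marked I P (x ∷ LB) y
    ⇐Marked y ((i , p) , m) = (from (on y) i , p) , trans (cong (_xor sumOver (lookup y) (x ∷ LB)) (marks y)) m
    ⇒Marked : ∀ y → Marked I P (x ∷ LB) y → Marked (T ∷ I′) P (x ∷ LB) y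
    ⇒Marked y ((i , p) , m) = (to (on y) i , p) , trans (cong (_xor sumOver (lookup y) (x ∷ LB)) (sym (marks y))) m
    via₂ : (∃ λ z → x ≢ z × 1 ≤ occ z (x ∷ LB)) ⊎ (∃ λ M → ∃ λ I″ → I′ ≡ M ∷ I″) → Found (Marked I P (x ∷ LB))
    via₂ other = Found-map ⇐Marked ⇒Marked (found₂ {LB = x ∷ LB} D Ms′ once′ (x∈ LB) other)
    go : ∀ LB₀ I₀ → LB ≡ LB₀ → I′ ≡ I₀ → Joined I P (x ∷ LB) ⊎ Found (Marked I P (x ∷ LB))
    go LB₀ (M ∷ I″) _ eq = inj₂ (via₂ (inj₂ (M , I″ , eq)))
    go (z ∷ L) [] refl _ = inj₂ (via₂ (inj₁ (z , x≢z , ℕ.≤-trans (occ-∈ {xs = z ∷ L} (Anyₗ.here refl)) (ℕ.m≤n+m _ (at? z x)))))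
      where
      x≢z : x ≢ z
      x≢z refl = ℕ.<-irrefl refl (ℕ.≤-trans (ℕ.≤-trans (ℕ.+-mono-≤ (ℕ.≤-reflexive (sym (at?-self x))) (ℕ.≤-trans (ℕ.≤-reflexive (sym (at?-self x))) (ℕ.m≤m+n (at? x x) (occ x L))))
        (ℕ.m≤n+m (occ x (x ∷ x ∷ L)) (totalF x I + totalF x P))) (once x))
    go [] [] refl refl with scan [] [] T ≃-refl refl refl
    ... | sink pa pb eq a b = inj₁ (record
        { F = Joined.F joined
        ; totals = λ z → trans (Joined.totals joined z) (cong (λ k → (k + totalF z P) + occ z (x ∷ [])) (sym (totals z)))
        ; on = λ y → mk⇔ (to (Joined.on joined y) ∘ ⇒Marked y) (⇐Marked y ∘ from (Joined.on joined y)) })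
      where
      joined : Joined (T ∷ []) P (x ∷ [])
      joined = split-sink x pa pb eq a b
    ... | cross e ks os eq k₀∈ k₁∈ o₀∈ o₁∈ = inj₂ (Found-map ⇐Marked ⇒Marked
        (found₃ {LB = x ∷ []} eq (λ z → subst (λ k → (k + totalF z P) + occ z (x ∷ []) ≤ 1) (ℕ.+-identityʳ (total z T)) (once′ z)) {x = x} (x∈ []) k₀∈ k₁∈ o₀∈ o₁∈))

partition : (S : Vec Bool n) (ls : List (Fin n)) → ∃ λ LB → ∃ λ LA → (∀ x → occ x ls ≡ occ x LB + occ x LA) ×
  (∀ y → sumOver (λ e → lookup S e ∧ lookup y e) ls ≡ sumOver (lookup y) LB) ×
  (∀ x → lookup S x ≡ true → x ∈ₗ ls → x ∈ₗ LB) × (∀ x → lookup S x ≡ false → occ x LB ≡ 0)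
partition S [] = [] , [] , (λ _ → refl) , (λ _ → refl) , (λ _ _ ()) , λ _ _ → refl
partition S (e ∷ ls) with partition S ls | lookup S e in Se
... | LB , LA , occs , sums , keep , zero-S | true = e ∷ LB , LA , (λ x → trans (cong (at? x e +_) (occs x)) (sym (ℕ.+-assoc (at? x e) (occ x LB) (occ x LA))))
    , (λ y → cong (lookup y e xor_) (sums y))
    , (λ { x _ (Anyₗ.here refl) → Anyₗ.here refl ; x Sx (Anyₗ.there x∈) → Anyₗ.there (keep x Sx x∈) })
    , λ x Sx → cong₂ _+_ (other x Sx) (zero-S x Sx)
  where
  other : ∀ x → lookup S x ≡ false → at? x e ≡ 0
  other x Sx with x ≟ e
  ... | yes refl = true≢false Se Sx
  ... | no _ = refl
... | LB , LA , occs , sums , keep , zero-S | false = LB , e ∷ LA , (λ x → trans (cong (at? x e +_) (occs x)) (ℕ+.x∙yz≈y∙xz (at? x e) (occ x LB) (occ x LA)))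
    , sums
    , (λ { x Sx (Anyₗ.here refl) → true≢false Sx Se ; x Sx (Anyₗ.there x∈) → keep x Sx x∈ })
    , zero-S

1≤occ⇒∈ : (x : Fin n) (xs : List (Fin n)) → 1 ≤ occ x xs → x ∈ₗ xs
1≤occ⇒∈ x (y ∷ xs) h with x ≟ y
... | yes refl = Anyₗ.here refl
... | no _ = Anyₗ.there (1≤occ⇒∈ x xs h)

-- The pivot `x` lies in no tree, so it is a loop marked by `S`, and the list of marked loops is
-- nonempty as `impose` requires. The additional conclusion keeps the pivots of the rows still to
-- come outside the trees.
extend-outer : {K : Vec Bool n → Set} (O : Outer K) (S : Vec Bool n) (x : Fin n) → lookup S x ≡ true → totalF x (Outer.F O) ≡ 0 →
  (∃ λ (O′ : Outer (λ y → K y × S · y ≡ false)) → ∀ z → lookup S z ≡ false → totalF z (Outer.F O) ≡ 0 → totalF z (Outer.F O′) ≡ 0) ⊎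
  Found (λ y → K y × S · y ≡ false)
extend-outer {K = K} O S x Sx x∉F with sort S (Outer.F O) | partition S (Outer.ls O)
... | sorted | LB , LA , occs , sums , keep , zero-S = go LB refl (keep x Sx (1≤occ⇒∈ x ls (ℕ.≤-reflexive (sym (trans (cong (_+ occ x ls) (sym x∉F)) (once x))))))
  where
  open Outer O
  open Sorted sorted renaming (on to sorted-on)
  ⇔Marked : ∀ LB′ → LB ≡ LB′ → ∀ y → (K y × S · y ≡ false) ⇔ Marked I P LB′ y
  ⇔Marked .LB refl y = mk⇔ (λ (k , Sy) → let f = to (on y) k in to (sorted-on y) f , trans (sym (value f)) Sy)
                      (λ (ip , m) → let f = from (sorted-on y) ip in from (on y) f , trans (value f) m)
    where
    value : OnForest y F → S · y ≡ μF y I xor sumOver (lookup y) LB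
    value f = trans (·-enumerated S y (labelsF F ++ ls) λ z → trans (occ-++ z (labelsF F) ls) (trans (cong (_+ occ z ls) (occ-labelsF z F)) (once z)))
      (trans (sumOver-++ (λ e → lookup S e ∧ lookup y e) (labelsF F) ls) (cong₂ _xor_ (marks y f) (sums y)))
  parts : ∀ z → ((totalF z I + totalF z P) + occ z LB) + occ z LA ≡ 1
  parts z = trans (ℕ.+-assoc (totalF z I + totalF z P) (occ z LB) (occ z LA)) (trans (cong₂ _+_ (sym (totals z)) (sym (occs z))) (once z))
  go : ∀ LB′ → LB ≡ LB′ → x ∈ₗ LB → _
  go [] refl ()
  go (w ∷ L) eq _ with impose {P = P} mixed w L (λ z → ℕ.≤-trans (ℕ.m≤m+n _ (occ z LA)) (ℕ.≤-reflexive (trans (cong (λ l → ((totalF z I + totalF z P) + occ z l) + occ z LA) (sym eq)) (parts z))))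
  ... | inj₂ found = inj₂ (Found-map (λ y → from (⇔Marked (w ∷ L) eq y)) (λ y → to (⇔Marked (w ∷ L) eq y)) found)
  ... | inj₁ joined = inj₁ (record
      { F = Joined.F joined ; ls = LA
      ; once = λ z → trans (cong (_+ occ z LA) (trans (Joined.totals joined z) (cong (λ l → (totalF z I + totalF z P) + occ z l) (sym eq)))) (parts z)
      ; on = λ y → mk⇔ (to (Joined.on joined y) ∘ to (⇔Marked (w ∷ L) eq y)) (from (⇔Marked (w ∷ L) eq y) ∘ from (Joined.on joined y)) }
    , λ z Sz z∉F → trans (Joined.totals joined z) (cong₂ _+_ (trans (sym (totals z)) z∉F) (trans (cong (occ z) (sym eq)) (zero-S z Sz))))

occ-allFin : ∀ n (x : Fin n) → occ x (List.allFin n) ≡ 1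
occ-allFin (suc n) zero = cong suc (missing n suc λ i ())
  where
  missing : ∀ k (f : Fin k → Fin (suc n)) → (∀ i → zero ≢ f i) → occ zero (List.tabulate f) ≡ 0
  missing zero    f ne = refl
  missing (suc k) f ne with zero ≟ f zero
  ... | yes eq = ⊥-elim (ne zero eq)
  ... | no _ = missing k (f ∘ suc) (ne ∘ suc)
occ-allFin (suc n) (suc x) = trans (shift n id) (occ-allFin n x)
  where
  shift : ∀ k (f : Fin k → Fin n) → occ (suc x) (List.tabulate (suc ∘ f)) ≡ occ x (List.tabulate f)
  shift zero    f = refl
  shift (suc k) f with x ≟ f zero
  ... | yes _ = cong suc (shift k (f ∘ suc))
  ... | no _ = shift k (f ∘ suc)

outer-or-found : (ps : List (Fin n × Vec Bool n)) → Triangular ps →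
  (∃ λ (O : Outer (Ker (rowsOf ps))) → ∀ z → Avoids z ps → totalF z (Outer.F O) ≡ 0) ⊎ Found (Ker (rowsOf ps))
outer-or-found {n} [] _ = inj₁ (record { F = [] ; ls = List.allFin n ; once = occ-allFin n ; on = λ y → mk⇔ (λ _ → []) (λ _ → []) } , λ _ _ → refl)
outer-or-found ((x , r) ∷ ps) (rx , avoid , tri) with outer-or-found ps tri
-- A minor found for the rows treated so far survives, since the new row is solved for its pivot and
-- that element is contracted.
... | inj₂ (inj₁ (u , s , h)) = inj₂ (inj₁ (u , State-map (λ y (k , p) → p ∷ k) (λ { y (p ∷ k) → k , p }) (solve-for s x r (unit∈Ker ps x avoid) rx) , h))
... | inj₂ (inj₂ (u , s , h)) = inj₂ (inj₂ (u , State-map (λ y (k , p) → p ∷ k) (λ { y (p ∷ k) → k , p }) (solve-for s x r (unit∈Ker ps x avoid) rx) , h))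
... | inj₁ (O , misses) with extend-outer O r x rx (misses x avoid)
...   | inj₂ found = inj₂ (Found-map (λ y (k , p) → p ∷ k) (λ { y (p ∷ k) → k , p }) found)
...   | inj₁ (O′ , misses′) = inj₁ (record
        { F = Outer.F O′ ; ls = Outer.ls O′ ; once = Outer.once O′
        ; on = λ y → mk⇔ (λ { (p ∷ k) → to (Outer.on O′ y) (k , p) }) (λ f → let (k , p) = from (Outer.on O′ y) f in p ∷ k) }
      , λ { z (p ∷ h) → misses′ z p (misses z h) })

-- The stars of a forest as sparse rows

starsBelow : Tree∗ n → List (List (Fin n))
starsBelow []                 = []
starsBelow (leg _ _ ∷ is)     = starsBelow is
starsBelow (branch e ks ∷ is) = (e ∷ tops ks) ∷ starsBelow ks ++ starsBelow is

starsOf : List (Tree∗ n) → List (List (Fin n))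
starsOf []      = []
starsOf (T ∷ F) = tops T ∷ starsBelow T ++ starsOf F

vecsOf : List (List (Fin n)) → List (Vec Bool n)
vecsOf = List.map vecOf

occs : Fin n → List (List (Fin n)) → ℕ
occs x []       = 0
occs x (l ∷ ls) = occ x l + occs x ls

occs-++ : ∀ (x : Fin n) ls ms → occs x (ls ++ ms) ≡ occs x ls + occs x ms
occs-++ x []       ms = refl
occs-++ x (l ∷ ls) ms = trans (cong (occ x l +_) (occs-++ x ls ms)) (sym (ℕ.+-assoc (occ x l) (occs x ls) (occs x ms)))

weight≤occs : ∀ (x : Fin n) ls → weight x (vecsOf ls) ≤ occs x ls
weight≤occs x []       = z≤n
weight≤occs x (l ∷ ls) = ℕ.+-mono-≤ (subst (λ b → (if b then 1 else 0) ≤ occ x l) (sym (vecOf-lookup l x)) (parity (occ x l))) (weight≤occs x ls)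
  where
  parity : ∀ k → (if odd k then 1 else 0) ≤ k
  parity zero    = z≤n
  parity (suc k) with odd k
  ... | true  = z≤n
  ... | false = s≤s z≤n

-- Every branch lies in two stars, every leg in one.
stars-once : ∀ (x : Fin n) is → (occ x (tops is) + occs x (starsBelow is)) + (occ x (legs false is) + occ x (legs true is)) ≡ total x is + total x is
stars-once x [] = refl
stars-once x (leg b e ∷ is) = trans (split b) (trans (cong ((at? x e + at? x e) +_) (stars-once x is))
  (trans (solveℕ 2 (λ a t → (a ⊹ a) ⊹ (t ⊹ t) :≡ (a ⊹ t) ⊹ (a ⊹ t)) refl (at? x e) (total x is)) (sym (cong₂ _+_ (total-leg x b e is) (total-leg x b e is)))))
  where
  split : ∀ b → ((at? x e + occ x (tops is)) + occs x (starsBelow is)) + (occ x (legs false (leg b e ∷ is)) + occ x (legs true (leg b e ∷ is)))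
    ≡ (at? x e + at? x e) + ((occ x (tops is) + occs x (starsBelow is)) + (occ x (legs false is) + occ x (legs true is)))
  split false = solveℕ 5 (λ a t s f g → ((a ⊹ t) ⊹ s) ⊹ ((a ⊹ f) ⊹ g) :≡ (a ⊹ a) ⊹ ((t ⊹ s) ⊹ (f ⊹ g))) refl
    (at? x e) (occ x (tops is)) (occs x (starsBelow is)) (occ x (legs false is)) (occ x (legs true is))
  split true = solveℕ 5 (λ a t s f g → ((a ⊹ t) ⊹ s) ⊹ (f ⊹ (a ⊹ g)) :≡ (a ⊹ a) ⊹ ((t ⊹ s) ⊹ (f ⊹ g))) refl
    (at? x e) (occ x (tops is)) (occs x (starsBelow is)) (occ x (legs false is)) (occ x (legs true is))
stars-once x (branch e ks ∷ is) = begin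
  ((a + t) + ((a + tk) + occs x (starsBelow ks ++ starsBelow is))) + (occ x (legs false ks ++ legs false is) + occ x (legs true ks ++ legs true is))
    ≡⟨ cong₂ (λ p q → ((a + t) + ((a + tk) + p)) + q) (occs-++ x (starsBelow ks) (starsBelow is))
         (cong₂ _+_ (occ-++ x (legs false ks) (legs false is)) (occ-++ x (legs true ks) (legs true is))) ⟩
  ((a + t) + ((a + tk) + (sk + s))) + ((fk + f) + (gk + g))
    ≡⟨ solveℕ 9 (λ a t tk sk s fk f gk g → ((a ⊹ t) ⊹ ((a ⊹ tk) ⊹ (sk ⊹ s))) ⊹ ((fk ⊹ f) ⊹ (gk ⊹ g))
         :≡ (a ⊹ a) ⊹ (((tk ⊹ sk) ⊹ (fk ⊹ gk)) ⊹ ((t ⊹ s) ⊹ (f ⊹ g)))) refl a t tk sk s fk f gk g ⟩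
  (a + a) + (((tk + sk) + (fk + gk)) + ((t + s) + (f + g)))
    ≡⟨ cong ((a + a) +_) (cong₂ _+_ (stars-once x ks) (stars-once x is)) ⟩
  (a + a) + ((total x ks + total x ks) + (total x is + total x is))
    ≡⟨ solveℕ 3 (λ a b c → (a ⊹ a) ⊹ ((b ⊹ b) ⊹ (c ⊹ c)) :≡ ((a ⊹ b) ⊹ c) ⊹ ((a ⊹ b) ⊹ c)) refl a (total x ks) (total x is) ⟩
  ((a + total x ks) + total x is) + ((a + total x ks) + total x is)
    ≡⟨ cong₂ _+_ (total-branch x e ks is) (total-branch x e ks is) ⟨
  _ ∎
  where
  open ≡-Reasoning
  a = at? x e
  t = occ x (tops is)
  tk = occ x (tops ks)
  s = occs x (starsBelow is)
  sk = occs x (starsBelow ks)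
  f = occ x (legs false is)
  fk = occ x (legs false ks)
  g = occ x (legs true is)
  gk = occ x (legs true ks)

starsBelow-Ker : ∀ (y : Vec Bool n) is → Below y is ⇔ Ker (vecsOf (starsBelow is)) y
starsBelow-Ker y []                 = mk⇔ (λ _ → []) (λ _ → tt)
starsBelow-Ker y (leg _ _ ∷ is)     = starsBelow-Ker y is
starsBelow-Ker y (branch e ks ∷ is) = mk⇔
  (λ ((p , h) , h′) → trans (vecOf-· (e ∷ tops ks) y) p ∷ subst (λ R → Ker R y) (sym (List.map-++ vecOf (starsBelow ks) (starsBelow is)))
    (All.++⁺ (to (starsBelow-Ker y ks) h) (to (starsBelow-Ker y is) h′)))
  (λ { (p ∷ k) → let k′ = subst (λ R → Ker R y) (List.map-++ vecOf (starsBelow ks) (starsBelow is)) k in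
       (trans (sym (vecOf-· (e ∷ tops ks) y)) p , from (starsBelow-Ker y ks) (All.++⁻ˡ (vecsOf (starsBelow ks)) k′))
       , from (starsBelow-Ker y is) (All.++⁻ʳ (vecsOf (starsBelow ks)) k′) })

starsOf-Ker : ∀ (y : Vec Bool n) F → OnForest y F ⇔ Ker (vecsOf (starsOf F)) y
starsOf-Ker y []      = mk⇔ (λ _ → []) (λ _ → [])
starsOf-Ker y (T ∷ F) = mk⇔
  (λ { ((p , h) ∷ f) → trans (vecOf-· (tops T) y) p ∷ subst (λ R → Ker R y) (sym (List.map-++ vecOf (starsBelow T) (starsOf F)))
    (All.++⁺ (to (starsBelow-Ker y T) h) (to (starsOf-Ker y F) f)) })
  (λ { (p ∷ k) → let k′ = subst (λ R → Ker R y) (List.map-++ vecOf (starsBelow T) (starsOf F)) k in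
       (trans (sym (vecOf-· (tops T) y)) p , from (starsBelow-Ker y T) (All.++⁻ˡ (vecsOf (starsBelow T)) k′))
       ∷ from (starsOf-Ker y F) (All.++⁻ʳ (vecsOf (starsBelow T)) k′) })

-- Marking the forest by S, the space cut out by S is again given by stars: the row of S consists of
-- the marked legs and loops.
outer⇒good : {K : Vec Bool n → Set} → Outer K → Good K
outer⇒good {n} {K} O S with partition S (Outer.ls O)
... | LB , LA , occs-ls , sums , _ , _ = vecsOf rows , sparse , λ y → mk⇔ (⇒ y) (⇐ y)
  where
  open Outer O
  relabelF : List (Tree∗ n) → List (Tree∗ n)
  relabelF = List.map (relabel S false)
  legsF : List (Tree∗ n) → List (Fin n)
  legsF []      = []
  legsF (T ∷ F) = legs true T ++ legsF F
  rows : List (List (Fin n))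
  rows = (legsF (relabelF F) ++ LB) ∷ starsOf (relabelF F)
  bound : ∀ x F → occ x (legsF (relabelF F)) + occs x (starsOf (relabelF F)) ≤ totalF x F + totalF x F
  bound x [] = z≤n
  bound x (T ∷ F) = ℕ.≤-trans (ℕ.≤-reflexive (trans (cong₂ _+_ (occ-++ x (legs true T′) (legsF (relabelF F)))
        (cong (occ x (tops T′) +_) (occs-++ x (starsBelow T′) (starsOf (relabelF F)))))
      (solveℕ 5 (λ g m t s r → (g ⊹ m) ⊹ (t ⊹ (s ⊹ r)) :≡ ((t ⊹ s) ⊹ g) ⊹ (m ⊹ r)) refl
        (occ x (legs true T′)) (occ x (legsF (relabelF F))) (occ x (tops T′)) (occs x (starsBelow T′)) (occs x (starsOf (relabelF F))))))
    (ℕ.≤-trans (ℕ.+-mono-≤ (ℕ.≤-trans (ℕ.+-monoʳ-≤ (occ x (tops T′) + occs x (starsBelow T′)) (ℕ.m≤n+m (occ x (legs true T′)) (occ x (legs false T′))))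
        (ℕ.≤-reflexive (trans (stars-once x T′) (cong₂ _+_ (relabel-total S false T x) (relabel-total S false T x))))) (bound x F))
      (ℕ.≤-reflexive (solveℕ 2 (λ a b → (a ⊹ a) ⊹ (b ⊹ b) :≡ (a ⊹ b) ⊹ (a ⊹ b)) refl (total x T) (totalF x F))))
    where T′ = relabel S false T
  sparse : Sparse (vecsOf rows)
  sparse x = ℕ.≤-trans (weight≤occs x rows) (ℕ.≤-trans
    (ℕ.≤-reflexive (trans (cong (_+ occs x (starsOf (relabelF F))) (occ-++ x (legsF (relabelF F)) LB))
      (solveℕ 3 (λ m l s → (m ⊹ l) ⊹ s :≡ (m ⊹ s) ⊹ l) refl (occ x (legsF (relabelF F))) (occ x LB) (occs x (starsOf (relabelF F))))))
    (ℕ.≤-trans (ℕ.+-mono-≤ (bound x F) (ℕ.≤-trans (ℕ.m≤m+n (occ x LB) (occ x LA)) (ℕ.≤-trans (ℕ.≤-reflexive (sym (occs-ls x))) (ℕ.m≤m+n (occ x ls) (occ x ls)))))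
      (ℕ.≤-reflexive (trans (solveℕ 2 (λ t l → (t ⊹ t) ⊹ (l ⊹ l) :≡ (t ⊹ l) ⊹ (t ⊹ l)) refl (totalF x F) (occ x ls)) (cong₂ _+_ (once x) (once x))))))
  relabelled : ∀ y F → OnForest y F ⇔ OnForest y (relabelF F)
  relabelled y []      = mk⇔ (λ _ → []) (λ _ → [])
  relabelled y (T ∷ F) = mk⇔ (λ { (p ∷ f) → to (relabel-on S false T y) p ∷ to (relabelled y F) f })
    (λ { (p ∷ f) → from (relabel-on S false T y) p ∷ from (relabelled y F) f })
  marks : ∀ y F → OnForest y F → sumOver (λ e → lookup S e ∧ lookup y e) (labelsF F) ≡ sumOver (lookup y) (legsF (relabelF F))
  marks y []      []      = refl
  marks y (T ∷ F) (p ∷ f) = trans (sumOver-++ (λ e → lookup S e ∧ lookup y e) (labelList T) (labelsF F)) (trans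
    (cong₂ _xor_ (trans (sym (xor-identityʳ (sumOver (λ e → lookup S e ∧ lookup y e) (labelList T)))) (relabel-sum S y false T (proj₂ p))) (marks y F f))
    (sym (sumOver-++ (lookup y) (legs true (relabel S false T)) (legsF (relabelF F)))))
  value : ∀ y → OnForest y F → S · y ≡ vecOf (legsF (relabelF F) ++ LB) · y
  value y f = trans (·-enumerated S y (labelsF F ++ ls) λ z → trans (occ-++ z (labelsF F) ls) (trans (cong (_+ occ z ls) (occ-labelsF z F)) (once z)))
    (trans (sumOver-++ (λ e → lookup S e ∧ lookup y e) (labelsF F) ls) (trans (cong₂ _xor_ (marks y F f) (sums y))
      (sym (trans (vecOf-· (legsF (relabelF F) ++ LB) y) (sumOver-++ (lookup y) (legsF (relabelF F)) LB)))))
  ⇒ : ∀ y → K y × S · y ≡ false → Ker (vecsOf rows) y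
  ⇒ y (ky , Sy) = trans (sym (value y (to (on y) ky))) Sy ∷ to (starsOf-Ker y (relabelF F)) (to (relabelled y F) (to (on y) ky))
  ⇐ : ∀ y → Ker (vecsOf rows) y → K y × S · y ≡ false
  ⇐ y (p ∷ r) = let f = from (relabelled y F) (from (starsOf-Ker y (relabelF F)) r) in from (on y) f , trans (value y f) p

QMinor-or-good : (R : List (Vec Bool n)) → CutSpace (Ker R) → QMinor (Ker R) ⊎ Good (Ker R)
QMinor-or-good R cut with triangulate R
... | ps , tri , eq with outer-or-found ps tri
...   | inj₁ (O , _) = inj₂ (outer⇒good record { F = Outer.F O ; ls = Outer.ls O ; once = Outer.once O
        ; on = λ y → mk⇔ (to (Outer.on O y) ∘ from (eq y)) (to (eq y) ∘ from (Outer.on O y)) })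
...   | inj₂ found with Found-map (λ y → to (eq y)) (λ y → from (eq y)) found
...     | inj₁ (u , s , h) = enter₂ cut s λ p ne → let (e , f , e≢f , ce , cf) = h p ne in
            e , f , e≢f , (State.column≢𝟘⇒live s (λ z → ne (trans (sym ce) z)) , ce) , (State.column≢𝟘⇒live s (λ z → ne (trans (sym cf) z)) , cf)
...     | inj₂ (u , s , h) = enter₃ cut s λ p ne ne′ → let (e , ce) = h p ne ne′ in
            e , State.column≢𝟘⇒live s (λ z → ne (trans (sym ce) z)) , ce

-- From spaces back to matroids

Ker-∷ʳ : (A : Mat ρ n) (S y : Vec Bool n) → Ker (Vec.toList (A Vec.∷ʳ S)) y ⇔ (Ker (Vec.toList A) y × S · y ≡ false)
Ker-∷ʳ []      S y = mk⇔ (λ { (p ∷ []) → [] , p }) (λ { (_ , p) → p ∷ [] })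
Ker-∷ʳ (r ∷ A) S y = mk⇔ (λ { (p ∷ k) → let (k′ , q) = to (Ker-∷ʳ A S y) k in p ∷ k′ , q })
  (λ { (p ∷ k , q) → p ∷ from (Ker-∷ʳ A S y) (k , q) })

-- `Good` speaks about the kernel of one matrix; by `Ker-unique` every other representing matrix has
-- the same kernel, hence the same splittings.
good⇒InC : ∀ {M} {R : List (Vec Bool (size M))} k → Represented M (Ker R) → Cographic M → Good (Ker R) → InC k M
good⇒InC {M} {R} k rep cographic good-R = cographic , λ r A repA S _ →
  SparseKernel⇒Graphic {M = BinM (splitMat A S)} (BinIndep⇔ (splitMat A S)) (SparseKernel-map
    (λ y (k , p) → from (Ker-∷ʳ A S y) (Ker-unique R (Vec.toList A) rep (Represents⇒Represented {M = M} {A = A} repA) y k , p))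
    (λ y h → let (k , p) = to (Ker-∷ʳ A S y) h in Ker-unique (Vec.toList A) R (Represents⇒Represented {M = M} {A = A} repA) rep y k , p)
    (good-R S))

Iso-refl : ∀ M → Iso M M
Iso-refl M = id , (λ _ _ h → h) , (λ y → y , refl) , λ X → subst (λ Y → Indep M X ⇔ Indep M Y) (sym (image-id X)) (mk⇔ id id)

theorem1p4 : (k : ℕ) → 2 ≤ k → (M : Matroid) → Binary M → Cographic M → ¬ InC k M →
    Σ Matroid λ P → IsMinor P M ×
    ((Σ Matroid λ E → MinMinimalNotIn (k ∸ 1) E × SingleExt P E)
    ⊎ (Σ (Fin 9) λ i → Iso P (cycleM (Q i)))
    ⊎ (Σ ℕ λ n → n ≤ k × Σ (Fin 9) λ i → Coext P (cycleM (Q i)) n))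
theorem1p4 k _ M (r , A , repA) cographic ¬inC with QMinor-or-good (Vec.toList A) (cutSpace (Vec.toList A) rep cographic)
  where
  rep : Represented M (Ker (Vec.toList A))
  rep = Represents⇒Represented {M = M} {A = A} repA
... | inj₂ h = ⊥-elim (¬inC (good⇒InC {M = M} k (Represents⇒Represented {M = M} {A = A} repA) cographic h))
... | inj₁ (i , minor) = cycleM (Q i)
    , MinorVec⇒IsMinor {M = M} {N = cycleM (Q i)} (Represents⇒Represented {M = M} {A = A} repA) (cycleM-represented (Q i)) minor
    , inj₂ (inj₁ (i , Iso-refl (cycleM (Q i))))
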